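{- Let $\mathbb{K}$ be a field, $S=\mathbb{K}[x_1,\ldots,x_n]$, and let $X$ and $Y$ be simplicial complexes on the vertex set $[n]=\{1,\ldots,n\}$. Then $$\mathrm{pd}(I_X\cap I_Y)\leq \mathrm{pd}(I_X)+\mathrm{pd}(I_Y)$$ and $$\mathrm{pd}(I_X+I_Y)\leq \mathrm{pd}(I_X)+\mathrm{pd}(I_Y)+1.$$
   Context: For a simplicial complex $X$ on $[n]$, $I_X$ is the ideal of $S$ generated by the monomials $\prod_{i\in A}x_i$ for all $A\subset[n]$ with $A\notin X$ (the Stanley–Reisner ideal). $\mathrm{pd}(M)$ denotes the projective dimension of a graded $S$-module $M$, i.e. the length of a minimal graded free resolution of $M$ over $S$. -}

module Defs where

open import Level using (Level; _⊔_; suc)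
open import Data.Nat using (ℕ; zero; suc)
open import Data.Bool using (Bool; true; false; if_then_else_)
open import Data.Fin using (Fin)
open import Data.Fin.Subset using (Subset; _⊆_)
open import Data.Vec using (Vec)
import Data.Vec as Vec
open import Data.Vec.Properties using (≡-dec)
import Data.Nat as ℕ
open import Data.List using (List; []; _∷_; _++_; map; concatMap; foldr)
open import Data.Product using (Σ; _×_; _,_; ∃)
open import Data.Sum using (_⊎_)
open import Relation.Nullary using (¬_; yes; no)
open import Relation.Binary.PropositionalEquality using (_≡_)
open import Algebra.Bundles using (CommutativeRing)

record Field (c ℓ : Level) : Set (Level.suc (c ⊔ ℓ)) where
  field
    commutativeRing : CommutativeRing c ℓ
  open CommutativeRing commutativeRing public
  field
    1≉0     : ¬ (1# ≈ 0#)
    inverse : ∀ x → ¬ (x ≈ 0#) → Σ Carrier (λ y → (x * y) ≈ 1#)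

record SimplicialComplex (n : ℕ) : Set where
  field
    face   : Subset n → Bool
    closed : ∀ {A B : Subset n} → A ⊆ B → face B ≡ true → face A ≡ true
open SimplicialComplex public

NonFace : ∀ {n} → SimplicialComplex n → Subset n → Set
NonFace X A = face X A ≡ false

module Poly {c ℓ : Level} (K : Field c ℓ) (n : ℕ) where
  open Field K

  Exp : Set
  Exp = Vec ℕ n

  -- a polynomial is a finite formal sum of terms  coefficient · x^exponent
  Pol : Set c
  Pol = List (Carrier × Exp)

  coeff : Pol → Exp → Carrier
  coeff [] e = 0#
  coeff ((a , e′) ∷ p) e with ≡-dec ℕ._≟_ e′ e
  ... | yes _ = a + coeff p e
  ... | no  _ = coeff p e

  _≈ₚ_ : Pol → Pol → Set ℓ
  p ≈ₚ q = ∀ e → coeff p e ≈ coeff q e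

  0ₚ : Pol
  0ₚ = []

  _+ₚ_ : Pol → Pol → Pol
  p +ₚ q = p ++ q

  _*ₚ_ : Pol → Pol → Pol
  p *ₚ q = concatMap (λ { (a , e) → map (λ { (b , f) → (a * b , Vec.zipWith ℕ._+_ e f) }) q }) p

  monomial : Subset n → Pol
  monomial A = (1# , Vec.map (λ b → if b then 1 else 0) A) ∷ []

  -- elements of S^m, S-linear maps S^r → S^m (given by m×r matrices)
  Elt : ℕ → Set c
  Elt m = Fin m → Pol

  _≈ᵥ_ : ∀ {m} → Elt m → Elt m → Set ℓ
  u ≈ᵥ v = ∀ i → u i ≈ₚ v i

  0ᵥ : ∀ {m} → Elt m
  0ᵥ i = 0ₚ

  Mat : ℕ → ℕ → Set c
  Mat m r = Fin m → Fin r → Pol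

  sumₚ : ∀ {r} → (Fin r → Pol) → Pol
  sumₚ {zero}  f = 0ₚ
  sumₚ {suc r} f = f Fin.zero +ₚ sumₚ (λ j → f (Fin.suc j))

  apply : ∀ {m r} → Mat m r → Elt r → Elt m
  apply d u i = sumₚ (λ j → d i j *ₚ u j)

  -- a submodule (or any subset) of S^m, given as a predicate
  Sub : ℕ → Set (Level.suc (c ⊔ ℓ))
  Sub m = Elt m → Set (c ⊔ ℓ)

  ImageIs : ∀ {m r} → Mat m r → Sub m → Set (c ⊔ ℓ)
  ImageIs d M = (∀ u → M (apply d u)) × (∀ v → M v → Σ (Elt _) (λ u → apply d u ≈ᵥ v))

  Ker : ∀ {m r} → Mat m r → Sub r
  Ker d u = Level.Lift (c ⊔ ℓ) (apply d u ≈ᵥ 0ᵥ)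

  InjectiveMap : ∀ {m r} → Mat m r → Set (c ⊔ ℓ)
  InjectiveMap {r = r} d = Level.Lift (c ⊔ ℓ) (∀ (u : Elt r) → apply d u ≈ᵥ 0ᵥ → u ≈ᵥ 0ᵥ)

  -- pd(M) ≤ k : M has a finite free resolution of length ≤ k,
  --   0 → S^{r_k} → … → S^{r_0} → M → 0,
  -- i.e. M is the image of a map S^{r_0} → S^m which is injective (k = 0),
  -- or whose kernel has pd ≤ k - 1.
  PdLe : ℕ → (m : ℕ) → Sub m → Set (c ⊔ ℓ)
  PdLe zero    m M = Σ ℕ (λ r → Σ (Mat m r) (λ d → ImageIs d M × InjectiveMap d))
  PdLe (suc k) m M = Σ ℕ (λ r → Σ (Mat m r) (λ d → ImageIs d M × PdLe k r (Ker d)))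

  Ideal : Set (Level.suc (c ⊔ ℓ))
  Ideal = Sub 1

  GenBy : (Subset n → Set) → Ideal
  GenBy P v = Σ (List (Pol × Σ (Subset n) P)) (λ gs →
    Level.Lift (c ⊔ ℓ) (v Fin.zero ≈ₚ foldr (λ { (g , A , _) acc → (g *ₚ monomial A) +ₚ acc }) 0ₚ gs))

  I : SimplicialComplex n → Ideal
  I X = GenBy (NonFace X)

  _∩ᵢ_ : Ideal → Ideal → Ideal
  (I₁ ∩ᵢ I₂) v = I₁ v × I₂ v

  _+ᵢ_ : Ideal → Ideal → Ideal
  (I₁ +ᵢ I₂) v = Σ Pol (λ g → Σ Pol (λ h →
    I₁ (λ _ → g) × I₂ (λ _ → h) × Level.Lift (c ⊔ ℓ) (v Fin.zero ≈ₚ (g +ₚ h))))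

{-# OPTIONS --safe #-}

-- Resolve each ideal by free modules generated in monomial degrees.  Over the coefficient ring the strand
-- of such a complex in multidegree α only involves the generators whose label divides x^α, and the tensor
-- product of two labelled complexes, with labels combined by lcm, has as strands the tensor products of
-- the strands.  Hence tensoring resolutions of S/I and S/J gives a resolution of S/(I + J), and tensoring
-- resolutions of I and J gives one of I ∩ J; the lengths add up.
--
-- The given resolution is neither graded nor minimal, and equality in K is not decidable, so it cannot be
-- minimised.  Instead it is compared with the Taylor complex: the comparison maps yield a homotopy on the
-- Taylor complex that contracts it above the given length, its multidegree-preserving part does the same,
-- and a complex contracted above degree L ≥ 2 can be folded into length L without changing its homology.
-- When I itself is free the folding is impossible, but then I is zero or generated by one monomial.

module Submission where

open import Defs
open import Level using (Level; _⊔_; Lift; lift; lower)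
open import Algebra.Bundles using (CommutativeRing)
open import Data.Bool using (Bool; true; false; _∧_; if_then_else_)
import Data.Bool.Properties as Boolₚ
open import Data.Empty using (⊥; ⊥-elim)
open import Data.Fin using (Fin; zero; suc)
import Data.Fin.Properties as Finₚ
open import Data.Fin.Subset using (Subset)
open import Data.List using (List; []; _∷_; _++_; map; concatMap; length; allFin; cartesianProduct; filter; foldr; tabulate)
import Data.List as List
open import Data.List.Membership.Propositional using (_∈_; find; lose)
open import Data.List.Membership.Propositional.Properties using (∈-allFin; ∈-cartesianProduct⁺; ∈-filter⁺; ∈-filter⁻; ∈-lookup; ∈-map⁺; ∈-map⁻; ∈-++⁺ˡ; ∈-++⁺ʳ)
open import Data.List.Relation.Unary.All using (All; []; _∷_)
import Data.List.Relation.Unary.All as All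
open import Data.List.Relation.Unary.AllPairs using ([]; _∷_)
open import Data.List.Relation.Unary.Any using (Any; here; there; index; any?)
open import Data.List.Relation.Unary.Any.Properties using (lookup-index)
open import Data.List.Relation.Unary.Unique.Propositional using (Unique)
import Data.List.Relation.Unary.Unique.Propositional.Properties as Uniqueₚ
open import Data.Maybe using (Maybe; just; nothing)
open import Data.Nat using (ℕ; zero; suc; pred; z≤n; s≤s)
import Data.Nat as ℕ
import Data.Nat.Properties as ℕₚ
open import Data.Product using (Σ; _×_; _,_; proj₁; proj₂)
open import Data.Product.Properties using () renaming (≡-dec to ×-≡-dec)
open import Data.Sum using (_⊎_; inj₁; inj₂)
open import Data.Vec using (Vec; []; _∷_; lookup; zipWith; replicate)
import Data.Vec as Vec
import Data.Vec.Properties as Vecₚ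
open import Relation.Binary.Definitions using (DecidableEquality)
open import Relation.Binary.PropositionalEquality using (_≡_; refl; cong; cong₂; subst)
import Relation.Binary.PropositionalEquality as ≡
open import Relation.Nullary using (¬_; Dec; yes; no)
open import Relation.Nullary.Decidable using (_×-dec_; _⊎-dec_; _→-dec_; ¬?; map′)

-- Finite sums and linear operators

-- With labels added, the tensor product would be the one over S, and its homology Tor. The lcm
-- turns it instead into tensor products of vector spaces, one for each multidegree. A strand of the
-- complex for S/I is contractible when x^α lies in I and is otherwise spanned by the generator of S
-- alone. So exactness is a contraction in each multidegree, and contractions pass to tensor
-- products by formulas, without testing an element of K for zero. The index shift explains both
-- bounds: pd(I) ≤ a gives a complex of length a + 1 for S/I. Lengths a + 1 and b + 1 add up to a +
-- b + 2 for S/(I + J), hence pd at most a + b + 1. For I ∩ J the generator of S is split off both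
-- factors and one copy is put back, which leaves length a + b + 1, hence pd at most a + b. Folding
-- merges everything above degree L into the degrees L and L - 1. For L = 1 this would create new
-- generators in degree 0, where only S itself may stand; this is why an ideal with a resolution of
-- length 0 is treated apart.

record Index : Set₁ where
  field
    Ix       : Set
    _≟_      : DecidableEquality Ix
    enum     : List Ix
    complete : ∀ b → b ∈ enum
    unique   : Unique enum
open Index public using (Ix; enum)

finIndex : ℕ → Index
finIndex r = record
  { Ix = Fin r ; _≟_ = Finₚ._≟_ ; enum = allFin r ; complete = ∈-allFin ; unique = Uniqueₚ.allFin⁺ r }

_×ᴵ_ : Index → Index → Index
B ×ᴵ C = record
  { Ix       = Ix B × Ix C
  ; _≟_      = ×-≡-dec (Index._≟_ B) (Index._≟_ C)
  ; enum     = cartesianProduct (enum B) (enum C)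
  ; complete = λ (b , c) → ∈-cartesianProduct⁺ (Index.complete B b) (Index.complete C c)
  ; unique   = Uniqueₚ.cartesianProduct⁺ (Index.unique B) (Index.unique C)
  }

-- Ring solver with integer coefficients

module IntegerSolver {r ℓ : Level} (R : CommutativeRing r ℓ) where
  open CommutativeRing R using (Carrier; _≈_; _+_; _*_; -_; 0#; 1#; setoid; ring; semiring; +-abelianGroup; +-commutativeSemigroup; +-cong; +-congˡ; +-congʳ; -‿cong; +-comm; +-assoc; +-identityʳ; -‿inverseʳ; distribˡ; distribʳ) renaming (refl to ≈-refl; sym to ≈-sym; trans to ≈-trans)
  open import Algebra.Properties.Ring ring using (-‿distribˡ-*; -‿distribʳ-*; -‿involutive; -0#≈0#)
  open import Algebra.Properties.AbelianGroup +-abelianGroup using (⁻¹-∙-comm)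
  open import Algebra.Properties.CommutativeSemigroup +-commutativeSemigroup using (interchange)
  open import Algebra.Properties.Semiring.Mult semiring using (×-homo-+; ×1-homo-*) renaming (_×_ to infixr 8 _∗_; ×-congˡ to ×-cong₁)
  open import Algebra.Bundles.Raw using (RawRing)
  import Algebra.Solver.Ring.AlmostCommutativeRing as ACR
  open import Relation.Binary.Reasoning.Setoid setoid

  -- An integer coefficient is a formal difference of two naturals.
  Diff : Set
  Diff = Σ ℕ (λ _ → ℕ)

  diffRing : RawRing _ _
  diffRing = record
    { Carrier = Diff
    ; _≈_ = _≡_
    ; _+_ = λ (a , b) (c , d) → a ℕ.+ c , b ℕ.+ d
    ; _*_ = λ (a , b) (c , d) → a ℕ.* c ℕ.+ b ℕ.* d , a ℕ.* d ℕ.+ b ℕ.* c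
    ; -_  = λ (a , b) → b , a
    ; 0#  = 0 , 0
    ; 1#  = 1 , 0
    }

  value : Diff → Carrier
  value (a , b) = a ∗ 1# + - (b ∗ 1#)

  value-+ : ∀ x y → value (RawRing._+_ diffRing x y) ≈ value x + value y
  value-+ (a , b) (c , d) = begin
    (a ℕ.+ c) ∗ 1# + - ((b ℕ.+ d) ∗ 1#)
      ≈⟨ +-cong (×-homo-+ 1# a c) (-‿cong (×-homo-+ 1# b d)) ⟩
    (a ∗ 1# + c ∗ 1#) + - (b ∗ 1# + d ∗ 1#)
      ≈⟨ +-congˡ (≈-sym (⁻¹-∙-comm _ _)) ⟩
    (a ∗ 1# + c ∗ 1#) + (- (b ∗ 1#) + - (d ∗ 1#))
      ≈⟨ interchange _ _ _ _ ⟩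
    value (a , b) + value (c , d) ∎

  value-* : ∀ x y → value (RawRing._*_ diffRing x y) ≈ value x * value y
  value-* (a , b) (c , d) = begin
    (a ℕ.* c ℕ.+ b ℕ.* d) ∗ 1# + - ((a ℕ.* d ℕ.+ b ℕ.* c) ∗ 1#)
      ≈⟨ +-cong (sum* a c b d) (-‿cong (sum* a d b c)) ⟩
    (A * C + B * D) + - (A * D + B * C)
      ≈⟨ +-congˡ (≈-sym (⁻¹-∙-comm _ _)) ⟩
    (A * C + B * D) + (- (A * D) + - (B * C))
      ≈⟨ +-congʳ (+-congˡ (≈-trans (≈-sym (-‿involutive _)) (≈-trans (-‿cong (-‿distribʳ-* B D)) (-‿distribˡ-* B (- D))))) ⟩
    (A * C + - B * - D) + (- (A * D) + - (B * C))
      ≈⟨ +-congˡ (+-cong (-‿distribʳ-* A D) (-‿distribˡ-* B C)) ⟩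
    (A * C + - B * - D) + (A * - D + - B * C)
      ≈⟨ interchange _ _ _ _ ⟩
    (A * C + A * - D) + (- B * - D + - B * C)
      ≈⟨ +-cong (≈-sym (distribˡ _ _ _)) (≈-trans (+-comm _ _) (≈-sym (distribˡ _ _ _))) ⟩
    A * (C + - D) + - B * (C + - D)
      ≈⟨ ≈-sym (distribʳ _ _ _) ⟩
    (A + - B) * (C + - D) ∎
    where
    A = a ∗ 1#
    B = b ∗ 1#
    C = c ∗ 1#
    D = d ∗ 1#
    sum* : ∀ i j k l → (i ℕ.* j ℕ.+ k ℕ.* l) ∗ 1# ≈ (i ∗ 1#) * (j ∗ 1#) + (k ∗ 1#) * (l ∗ 1#)
    sum* i j k l = ≈-trans (×-homo-+ 1# (i ℕ.* j) (k ℕ.* l)) (+-cong (×1-homo-* i j) (×1-homo-* k l))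

  value-neg : ∀ x → value (RawRing.-_ diffRing x) ≈ - value x
  value-neg (a , b) = begin
    b ∗ 1# + - (a ∗ 1#)         ≈⟨ +-comm _ _ ⟩
    - (a ∗ 1#) + b ∗ 1#         ≈⟨ +-congˡ (≈-sym (-‿involutive _)) ⟩
    - (a ∗ 1#) + - - (b ∗ 1#)   ≈⟨ ⁻¹-∙-comm _ _ ⟩
    - (a ∗ 1# + - (b ∗ 1#))     ∎

  value-homo : ACR._-Raw-AlmostCommutative⟶_ diffRing (ACR.fromCommutativeRing R)
  value-homo = record
    { ⟦_⟧    = value
    ; +-homo = value-+
    ; *-homo = value-*
    ; -‿homo = value-neg
    ; 0-homo = -‿inverseʳ 0#
    ; 1-homo = ≈-trans (+-cong (+-identityʳ 1#) -0#≈0#) (+-identityʳ 1#)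
    }

  value-≈ : ∀ a b c d → a ℕ.+ d ≡ c ℕ.+ b → value (a , b) ≈ value (c , d)
  value-≈ a b c d eq = begin
    A + - B                 ≈⟨ +-congʳ (≈-sym (+-identityʳ A)) ⟩
    (A + 0#) + - B          ≈⟨ +-congʳ (+-congˡ (≈-sym (-‿inverseʳ D))) ⟩
    (A + (D + - D)) + - B   ≈⟨ +-congʳ (≈-sym (+-assoc A D (- D))) ⟩
    ((A + D) + - D) + - B   ≈⟨ +-congʳ (+-congʳ shifted) ⟩
    ((C + B) + - D) + - B   ≈⟨ +-assoc _ _ _ ⟩
    (C + B) + (- D + - B)   ≈⟨ interchange _ _ _ _ ⟩
    (C + - D) + (B + - B)   ≈⟨ +-congˡ (-‿inverseʳ B) ⟩
    (C + - D) + 0#          ≈⟨ +-identityʳ _ ⟩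
    C + - D                 ∎
    where
    A = a ∗ 1#
    B = b ∗ 1#
    C = c ∗ 1#
    D = d ∗ 1#
    shifted : A + D ≈ C + B
    shifted = ≈-trans (≈-sym (×-homo-+ 1# a d)) (≈-trans (×-cong₁ eq) (×-homo-+ 1# c b))

  -- Only equality of integers is tested. Integers that agree in the ring merely because of its
  -- characteristic stay unidentified, which the solver tolerates; equality in the ring itself
  -- cannot be decided.
  value-≟ : ∀ x y → Maybe (value x ≈ value y)
  value-≟ (a , b) (c , d) with (a ℕ.+ d) ℕ.≟ (c ℕ.+ b)
  ... | yes eq = just (value-≈ a b c d eq)
  ... | no _   = nothing

  open import Algebra.Solver.Ring diffRing (ACR.fromCommutativeRing R) value-homo value-≟ public
    using (solve; _:=_; _:+_; :-_)

module LinearAlgebra {r ℓ : Level} (R : CommutativeRing r ℓ) where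
  open CommutativeRing R hiding (zero) renaming (refl to ≈-refl; sym to ≈-sym; trans to ≈-trans)
  open import Algebra.Properties.CommutativeSemigroup +-commutativeSemigroup using (interchange)
  open import Algebra.Properties.Ring ring using (-1*x≈-x; -‿distribˡ-*)
  open import Relation.Binary.Reasoning.Setoid setoid

  ∑ : ∀ {a} {A : Set a} → List A → (A → Carrier) → Carrier
  ∑ []       f = 0#
  ∑ (x ∷ xs) f = f x + ∑ xs f

  module _ {a} {A : Set a} where

    ∑-cong : ∀ (xs : List A) {f g} → (∀ x → f x ≈ g x) → ∑ xs f ≈ ∑ xs g
    ∑-cong []       e = ≈-refl
    ∑-cong (x ∷ xs) e = +-cong (e x) (∑-cong xs e)

    ∑-zero : ∀ (xs : List A) {f} → (∀ x → f x ≈ 0#) → ∑ xs f ≈ 0#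
    ∑-zero []       e = ≈-refl
    ∑-zero (x ∷ xs) e = ≈-trans (+-cong (e x) (∑-zero xs e)) (+-identityʳ 0#)

    ∑-+ : ∀ (xs : List A) f g → ∑ xs (λ x → f x + g x) ≈ ∑ xs f + ∑ xs g
    ∑-+ []       f g = ≈-sym (+-identityʳ 0#)
    ∑-+ (x ∷ xs) f g = ≈-trans (+-congˡ (∑-+ xs f g)) (interchange _ _ _ _)

    ∑-*ˡ : ∀ (xs : List A) a f → ∑ xs (λ x → a * f x) ≈ a * ∑ xs f
    ∑-*ˡ []       a f = ≈-sym (zeroʳ a)
    ∑-*ˡ (x ∷ xs) a f = ≈-trans (+-congˡ (∑-*ˡ xs a f)) (≈-sym (distribˡ _ _ _))

    ∑-*ʳ : ∀ (xs : List A) a f → ∑ xs (λ x → f x * a) ≈ ∑ xs f * a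
    ∑-*ʳ xs a f = ≈-trans (∑-cong xs (λ x → *-comm _ _)) (≈-trans (∑-*ˡ xs a f) (*-comm _ _))

    ∑-++ : ∀ (xs ys : List A) f → ∑ (xs ++ ys) f ≈ ∑ xs f + ∑ ys f
    ∑-++ []       ys f = ≈-sym (+-identityˡ _)
    ∑-++ (x ∷ xs) ys f = ≈-trans (+-congˡ (∑-++ xs ys f)) (≈-sym (+-assoc _ _ _))

  module _ {a b} {A : Set a} {B : Set b} where

    ∑-map : ∀ (g : A → B) xs f → ∑ (map g xs) f ≡ ∑ xs (λ x → f (g x))
    ∑-map g []       f = refl
    ∑-map g (x ∷ xs) f = cong (f (g x) +_) (∑-map g xs f)

    ∑-concatMap : ∀ (g : A → List B) xs f → ∑ (concatMap g xs) f ≈ ∑ xs (λ x → ∑ (g x) f)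
    ∑-concatMap g []       f = ≈-refl
    ∑-concatMap g (x ∷ xs) f = ≈-trans (∑-++ (g x) _ f) (+-congˡ (∑-concatMap g xs f))

    ∑-swap : ∀ (xs : List A) (ys : List B) (f : A → B → Carrier) →
             ∑ xs (λ x → ∑ ys (f x)) ≈ ∑ ys (λ y → ∑ xs (λ x → f x y))
    ∑-swap []       ys f = ≈-sym (∑-zero ys (λ _ → ≈-refl))
    ∑-swap (x ∷ xs) ys f = ≈-trans (+-congˡ (∑-swap xs ys f)) (≈-sym (∑-+ ys _ _))

  bool : ∀ {p} {P : Set p} → Dec P → Carrier
  bool (yes _) = 1#
  bool (no _)  = 0#

  bool-yes : ∀ {p} {P : Set p} (d : Dec P) → P → bool d ≈ 1#
  bool-yes (yes _) p = ≈-refl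
  bool-yes (no ¬p) p = ⊥-elim (¬p p)

  bool-no : ∀ {p} {P : Set p} (d : Dec P) → ¬ P → bool d ≈ 0#
  bool-no (yes p) ¬p = ⊥-elim (¬p p)
  bool-no (no _)  ¬p = ≈-refl

  bool-⇔ : ∀ {p q} {P : Set p} {Q : Set q} (d : Dec P) (e : Dec Q) → (P → Q) → (Q → P) → bool d ≈ bool e
  bool-⇔ (yes p) e f g = ≈-sym (bool-yes e (f p))
  bool-⇔ (no ¬p) e f g = ≈-sym (bool-no e (λ q → ¬p (g q)))

  Vect : Set → Set r
  Vect B = B → Carrier

  infix 4 _≋_
  _≋_ : ∀ {B : Set} → Vect B → Vect B → Set ℓ
  u ≋ v = ∀ b → u b ≈ v b

  infixl 6 _⊹_
  _⊹_ : ∀ {B : Set} → Vect B → Vect B → Vect B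
  (u ⊹ v) b = u b + v b

  infix 8 ⊟_
  ⊟_ : ∀ {B : Set} → Vect B → Vect B
  (⊟ v) b = - v b

  𝟘 : ∀ {B : Set} → Vect B
  𝟘 b = 0#

  -- A linear map is a function on vectors, not a matrix: composition is then definitional, and sums
  -- over a basis appear only where a map is expanded along `δ`.
  record Op (B C : Set) : Set (r ⊔ ℓ) where
    infixr 9 _·_
    field
      _·_    : Vect B → Vect C
      ·-cong : ∀ {u v} → u ≋ v → _·_ u ≋ _·_ v
      ·-+    : ∀ u v → _·_ (u ⊹ v) ≋ _·_ u ⊹ _·_ v
      ·-*    : ∀ a v c → _·_ (λ b → a * v b) c ≈ a * _·_ v c

    ·-𝟘 : ∀ {v} → v ≋ 𝟘 → _·_ v ≋ 𝟘
    ·-𝟘 {v} v≋0 c = begin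
      _·_ v c                  ≈⟨ ·-cong (λ b → ≈-trans (v≋0 b) (≈-sym (zeroˡ (v b)))) c ⟩
      _·_ (λ b → 0# * v b) c   ≈⟨ ·-* 0# v c ⟩
      0# * _·_ v c             ≈⟨ zeroˡ _ ⟩
      0#                       ∎

    ·-⊟ : ∀ v → _·_ (⊟ v) ≋ ⊟ (_·_ v)
    ·-⊟ v c = begin
      _·_ (⊟ v) c                  ≈⟨ ·-cong (λ b → ≈-sym (-1*x≈-x (v b))) c ⟩
      _·_ (λ b → - 1# * v b) c     ≈⟨ ·-* (- 1#) v c ⟩
      - 1# * _·_ v c               ≈⟨ -1*x≈-x _ ⟩
      - _·_ v c                    ∎

    ·-∑ : ∀ {a} {A : Set a} (xs : List A) (f : A → Vect B) c →
          _·_ (λ b → ∑ xs (λ x → f x b)) c ≈ ∑ xs (λ x → _·_ (f x) c)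
    ·-∑ []       f c = ·-𝟘 (λ _ → ≈-refl) c
    ·-∑ (x ∷ xs) f c = ≈-trans (·-+ (f x) _ c) (+-congˡ (·-∑ xs f c))

    ·-∑* : ∀ {a} {A : Set a} (xs : List A) (k : A → Carrier) (f : A → Vect B) c →
           _·_ (λ b → ∑ xs (λ x → k x * f x b)) c ≈ ∑ xs (λ x → k x * _·_ (f x) c)
    ·-∑* xs k f c = ≈-trans (·-∑ xs _ c) (∑-cong xs (λ x → ·-* (k x) (f x) c))

  open Op public

  𝟘ₒ : ∀ {B C} → Op B C
  𝟘ₒ = record
    { _·_ = λ _ → 𝟘 ; ·-cong = λ _ _ → ≈-refl
    ; ·-+ = λ _ _ _ → ≈-sym (+-identityʳ 0#) ; ·-* = λ a _ _ → ≈-sym (zeroʳ a) }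

  idₒ : ∀ {B} → Op B B
  idₒ = record { _·_ = λ v → v ; ·-cong = λ e → e ; ·-+ = λ _ _ _ → ≈-refl ; ·-* = λ _ _ _ → ≈-refl }

  infixr 9 _∘ₒ_
  _∘ₒ_ : ∀ {B C D} → Op C D → Op B C → Op B D
  A ∘ₒ A′ = record
    { _·_    = λ v → A · A′ · v
    ; ·-cong = λ e → ·-cong A (·-cong A′ e)
    ; ·-+    = λ u v c → ≈-trans (·-cong A (·-+ A′ u v) c) (·-+ A _ _ c)
    ; ·-*    = λ a v c → ≈-trans (·-cong A (·-* A′ a v) c) (·-* A a _ c) }

  infixl 6 _+ₒ_
  _+ₒ_ : ∀ {B C} → Op B C → Op B C → Op B C
  A +ₒ A′ = record
    { _·_    = λ v → A · v ⊹ A′ · v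
    ; ·-cong = λ e c → +-cong (·-cong A e c) (·-cong A′ e c)
    ; ·-+    = λ u v c → ≈-trans (+-cong (·-+ A u v c) (·-+ A′ u v c)) (interchange _ _ _ _)
    ; ·-*    = λ a v c → ≈-trans (+-cong (·-* A a v c) (·-* A′ a v c)) (≈-sym (distribˡ _ _ _)) }

  diagₒ : ∀ {B : Set} → Vect B → Op B B
  diagₒ k = record
    { _·_    = λ v b → k b * v b
    ; ·-cong = λ e b → *-congˡ (e b)
    ; ·-+    = λ u v b → distribˡ _ _ _
    ; ·-*    = λ a v b → ≈-trans (≈-sym (*-assoc _ _ _)) (≈-trans (*-congʳ (*-comm _ _)) (*-assoc _ _ _)) }

  negₒ : ∀ {B C} → Op B C → Op B C
  negₒ A = diagₒ (λ _ → - 1#) ∘ₒ A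

  infixl 6 _-ₒ_
  _-ₒ_ : ∀ {B C} → Op B C → Op B C → Op B C
  A -ₒ A′ = A +ₒ negₒ A′

  -ₒ-· : ∀ {B C} (A A′ : Op B C) v → (A -ₒ A′) · v ≋ A · v ⊹ ⊟ (A′ · v)
  -ₒ-· A A′ v c = +-congˡ (-1*x≈-x _)

  module _ (B : Index) where
    open Index B using (_≟_; complete; unique)

    δ : Ix B → Vect (Ix B)
    δ c b = bool (c ≟ b)

    δ-same : ∀ c → δ c c ≈ 1#
    δ-same c = bool-yes (c ≟ c) refl

    δ-diff : ∀ {b c} → ¬ c ≡ b → δ c b ≈ 0#
    δ-diff {b} {c} = bool-no (c ≟ b)

    ∑-select : ∀ (xs : List (Ix B)) f c → (∀ {b} → b ∈ xs → ¬ b ≡ c → f b ≈ 0#) →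
               c ∈ xs → Unique xs → ∑ xs f ≈ f c
    ∑-select (x ∷ xs) f c z (here refl) (x∉ ∷ u) =
      ≈-trans (+-congˡ (vanish xs x∉ (λ i → z (there i)))) (+-identityʳ _)
      where
      vanish : ∀ ys → All (λ y → ¬ x ≡ y) ys → (∀ {b} → b ∈ ys → ¬ b ≡ x → f b ≈ 0#) → ∑ ys f ≈ 0#
      vanish []       []       z = ≈-refl
      vanish (y ∷ ys) (p ∷ ps) z =
        ≈-trans (+-cong (z (here refl) (λ e → p (≡.sym e))) (vanish ys ps (λ i → z (there i)))) (+-identityʳ 0#)
    ∑-select (x ∷ xs) f c z (there i) (x∉ ∷ u) =
      ≈-trans (+-cong (z (here refl) (All.lookup x∉ i)) (∑-select xs f c (λ j → z (there j)) i u)) (+-identityˡ _)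

    ∑-enum : ∀ f c → (∀ b → ¬ b ≡ c → f b ≈ 0#) → ∑ (enum B) f ≈ f c
    ∑-enum f c z = ∑-select (enum B) f c (λ {b} _ → z b) (complete c) unique

    expand-vect : ∀ (v : Vect (Ix B)) b → v b ≈ ∑ (enum B) (λ c → v c * δ c b)
    expand-vect v b = ≈-sym (≈-trans
      (∑-enum (λ c → v c * δ c b) b (λ c c≢b → ≈-trans (*-congˡ (δ-diff c≢b)) (zeroʳ _)))
      (≈-trans (*-congˡ (δ-same b)) (*-identityʳ _)))

    module _ {C : Set} where

      expand : ∀ (A : Op (Ix B) C) v x → (A · v) x ≈ ∑ (enum B) (λ c → v c * (A · δ c) x)
      expand A v x = ≈-trans (·-cong A (expand-vect v) x) (·-∑* A (enum B) v δ x)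

      columns : (Ix B → Vect C) → Op (Ix B) C
      columns col = record
        { _·_    = λ v x → ∑ (enum B) (λ c → v c * col c x)
        ; ·-cong = λ e x → ∑-cong (enum B) (λ c → *-congʳ (e c))
        ; ·-+    = λ u v x → ≈-trans (∑-cong (enum B) (λ c → distribʳ _ _ _)) (∑-+ (enum B) _ _)
        ; ·-*    = λ a v x → ≈-trans (∑-cong (enum B) (λ c → *-assoc _ _ _)) (∑-*ˡ (enum B) a _) }

      columns-δ : ∀ col c → columns col · δ c ≋ col c
      columns-δ col c x = ≈-trans
        (∑-enum (λ b → δ c b * col b x) c (λ b b≢c → ≈-trans (*-congʳ (δ-diff (λ e → b≢c (≡.sym e)))) (zeroˡ _)))
        (≈-trans (*-congʳ (δ-same c)) (*-identityˡ _))

      -- Linear maps are compared on the basis vectors that may occur in `v`. The caller supplies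
      -- the disjunction from degrees or labels, since the vanishing of a coefficient cannot be
      -- decided.
      agree : ∀ (A A′ : Op (Ix B) C) v → (∀ c → (v c ≈ 0#) ⊎ (A · δ c ≋ A′ · δ c)) → A · v ≋ A′ · v
      agree A A′ v h x = ≈-trans (expand A v x) (≈-trans (∑-cong (enum B) same) (≈-sym (expand A′ v x)))
        where
        same : ∀ c → v c * (A · δ c) x ≈ v c * (A′ · δ c) x
        same c with h c
        ... | inj₁ z = ≈-trans (*-congʳ z) (≈-trans (zeroˡ _) (≈-sym (≈-trans (*-congʳ z) (zeroˡ _))))
        ... | inj₂ e = *-congˡ (e x)

  -- The shape of a matrix, nonzero at `(x , b)` only if `R x b`, expressed without entries: the
  -- value at `x` depends only on the coordinates related to `x`. In this form it passes to
  -- composites without any summation.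
  Local : ∀ {B C : Set} → (C → B → Set) → Op B C → Set (r ⊔ ℓ)
  Local R A = ∀ v x → (∀ b → R x b → v b ≈ 0#) → (A · v) x ≈ 0#

  module _ {B C : Set} where

    Local-⊆ : ∀ {Q Q′ : C → B → Set} {A : Op B C} → (∀ x b → Q x b → Q′ x b) → Local Q A → Local Q′ A
    Local-⊆ f l v x z = l v x (λ b q → z b (f x b q))

    Local-+ : ∀ {Q : C → B → Set} {A A′ : Op B C} → Local Q A → Local Q A′ → Local Q (A +ₒ A′)
    Local-+ l l′ v x z = ≈-trans (+-cong (l v x z) (l′ v x z)) (+-identityʳ 0#)

  Local-∘ : ∀ {B C D : Set} {P : D → C → Set} {Q : C → B → Set} {T : D → B → Set} {A : Op C D} {A′ : Op B C} →
            (∀ x y z → P x y → Q y z → T x z) → Local P A → Local Q A′ → Local T (A ∘ₒ A′)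
  Local-∘ t l l′ v x z = l _ x (λ y p → l′ v y (λ b q → z b (t x y b p q)))

  Local-scale : ∀ {B C : Set} {Q : C → B → Set} (k : Vect C) {A : Op B C} → Local Q A → Local Q (diagₒ k ∘ₒ A)
  Local-scale k l v x z = ≈-trans (*-congˡ (l v x z)) (zeroʳ _)

  Local-cong : ∀ {B C : Set} {Q : C → B → Set} {A : Op B C} → Local Q A →
               ∀ {u v} x → (∀ b → Q x b → u b ≈ v b) → (A · u) x ≈ (A · v) x
  Local-cong {A = A} l {u} {v} x e = begin
    (A · u) x                              ≈⟨ solve 2 (λ a y → a := (a :+ :- y) :+ y) ≈-refl _ _ ⟩
    ((A · u) x + - (A · v) x) + (A · v) x  ≈⟨ +-congʳ (+-congˡ (≈-sym (·-⊟ A v x))) ⟩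
    ((A · u) x + (A · (⊟ v)) x) + (A · v) x  ≈⟨ +-congʳ (≈-sym (·-+ A u (⊟ v) x)) ⟩
    (A · (u ⊹ ⊟ v)) x + (A · v) x          ≈⟨ +-congʳ (l _ x (λ b q → ≈-trans (+-congʳ (e b q)) (-‿inverseʳ _))) ⟩
    0# + (A · v) x                         ≈⟨ +-identityˡ _ ⟩
    (A · v) x                              ∎
    where open IntegerSolver R

  commute : ∀ {B : Set} {Q : B → B → Set} {A : Op B B} (k : Vect B) → Local Q A →
            (∀ x b → Q x b → k b ≈ k x) → ∀ v → A · diagₒ k · v ≋ diagₒ k · A · v
  commute {A = A} k l same v x =
    ≈-trans (Local-cong {A = A} l x (λ b q → *-congʳ (same x b q))) (·-* A (k x) v x)

  anticommute : ∀ {B : Set} {Q : B → B → Set} {A : Op B B} (k : Vect B) → Local Q A →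
                (∀ x b → Q x b → k b ≈ - k x) → ∀ v → A · diagₒ k · v ≋ ⊟ (diagₒ k · A · v)
  anticommute {A = A} k l opp v x =
    ≈-trans (Local-cong {A = A} l x (λ b q → *-congʳ (opp x b q)))
      (≈-trans (·-* A (- k x) v x) (≈-sym (-‿distribˡ-* _ _)))

  Local-maskˡ : ∀ {B C : Set} {Q : C → B → Set} {P : C → Set} {k : Vect C} {A : Op B C} →
                (∀ x → P x ⊎ k x ≈ 0#) → Local Q A → Local (λ x b → P x × Q x b) (diagₒ k ∘ₒ A)
  Local-maskˡ P? l v x z with P? x
  ... | inj₁ p = ≈-trans (*-congˡ (l v x (λ b q → z b (p , q)))) (zeroʳ _)
  ... | inj₂ o = ≈-trans (*-congʳ o) (zeroˡ _)

  Local-maskʳ : ∀ {B C : Set} {Q : C → B → Set} {P : B → Set} {k : Vect B} {A : Op B C} →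
                (∀ b → P b ⊎ k b ≈ 0#) → Local Q A → Local (λ x b → P b × Q x b) (A ∘ₒ diagₒ k)
  Local-maskʳ {P = P} {k} P? l v x z = l _ x term
    where
    term : ∀ b → _ → k b * v b ≈ 0#
    term b q with P? b
    ... | inj₁ p = ≈-trans (*-congˡ (z b (p , q))) (zeroʳ _)
    ... | inj₂ o = ≈-trans (*-congʳ o) (zeroˡ _)

  Local-columns : ∀ (B : Index) {C : Set} {Q : C → Ix B → Set} (Q? : ∀ x b → Dec (Q x b)) {col} →
                  (∀ x b → ¬ Q x b → col b x ≈ 0#) → Local Q (columns B {C} col)
  Local-columns B Q? {col} h v x z = ∑-zero (enum B) term
    where
    term : ∀ c → v c * col c x ≈ 0#
    term c with Q? x c
    ... | yes q = ≈-trans (*-congʳ (z c q)) (zeroˡ _)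
    ... | no ¬q = ≈-trans (*-congˡ (h x c ¬q)) (zeroʳ _)

  opaque
    -- `Lₒ A` is A ⊗ 1 and `Rₒ A` is 1 ⊗ A, with tensors realized as functions on pairs.
    Lₒ : ∀ {B B′ : Set} → Op B B → Op (B × B′) (B × B′)
    Lₒ A = record
      { _·_    = λ u (b , b′) → (A · (λ c → u (c , b′))) b
      ; ·-cong = λ e (b , b′) → ·-cong A (λ c → e (c , b′)) b
      ; ·-+    = λ u v (b , b′) → ·-+ A _ _ b
      ; ·-*    = λ a v (b , b′) → ·-* A a _ b }

    Rₒ : ∀ {B B′ : Set} → Op B′ B′ → Op (B × B′) (B × B′)
    Rₒ A = record
      { _·_    = λ u (b , b′) → (A · (λ c → u (b , c))) b′
      ; ·-cong = λ e (b , b′) → ·-cong A (λ c → e (b , c)) b′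
      ; ·-+    = λ u v (b , b′) → ·-+ A _ _ b′
      ; ·-*    = λ a v (b , b′) → ·-* A a _ b′ }

  module _ {B B′ : Set} where
    opaque
      unfolding Lₒ Rₒ

      L-at : ∀ (A : Op B B) (u : Vect (B × B′)) b b′ → (Lₒ A · u) (b , b′) ≡ (A · (λ c → u (c , b′))) b
      L-at A u b b′ = refl

      R-at : ∀ (A : Op B′ B′) (u : Vect (B × B′)) b b′ → (Rₒ A · u) (b , b′) ≡ (A · (λ c → u (b , c))) b′
      R-at A u b b′ = refl

      LL-at : ∀ (A A′ : Op B B) (u : Vect (B × B′)) b b′ →
              (Lₒ A · Lₒ A′ · u) (b , b′) ≡ (A · A′ · (λ c → u (c , b′))) b
      LL-at A A′ u b b′ = refl

      RR-at : ∀ (A A′ : Op B′ B′) (u : Vect (B × B′)) b b′ →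
              (Rₒ A · Rₒ A′ · u) (b , b′) ≡ (A · A′ · (λ c → u (b , c))) b′
      RR-at A A′ u b b′ = refl

      Local-L : ∀ {Q : B → B → Set} {A} → Local Q A → Local {B × B′} (λ x y → Q (proj₁ x) (proj₁ y) × proj₂ x ≡ proj₂ y) (Lₒ A)
      Local-L l u (b , b′) z = l _ b (λ c q → z (c , b′) (q , refl))

      Local-R : ∀ {Q : B′ → B′ → Set} {A} → Local Q A → Local {B × B′} (λ x y → proj₁ x ≡ proj₁ y × Q (proj₂ x) (proj₂ y)) (Rₒ A)
      Local-R l u (b , b′) z = l _ b′ (λ c q → z (b , c) (refl , q))

      anticommute-L : ∀ {Q : B → B → Set} {A : Op B B} (k : Vect B) → Local Q A → (∀ x b → Q x b → k b ≈ - k x) →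
                      ∀ (u : Vect (B × B′)) → Lₒ A · diagₒ (λ x → k (proj₁ x)) · u ≋ ⊟ (diagₒ (λ x → k (proj₁ x)) · Lₒ A · u)
      anticommute-L {A = A} k l opp u (b , b′) = anticommute {A = A} k l opp _ b

      commute-L : ∀ {Q : B → B → Set} {A : Op B B} (k : Vect B) → Local Q A → (∀ x b → Q x b → k b ≈ k x) →
                  ∀ (u : Vect (B × B′)) → Lₒ A · diagₒ (λ x → k (proj₁ x)) · u ≋ diagₒ (λ x → k (proj₁ x)) · Lₒ A · u
      commute-L {A = A} k l same u (b , b′) = commute {A = A} k l same _ b

      commute-R : ∀ (A : Op B′ B′) (k : Vect B) (u : Vect (B × B′)) →
                  Rₒ A · diagₒ (λ x → k (proj₁ x)) · u ≋ diagₒ (λ x → k (proj₁ x)) · Rₒ A · u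
      commute-R A k u (b , b′) = ·-* A _ _ b′

  opaque
    unfolding Lₒ Rₒ
    -- For an arbitrary linear function `A` this is not definitional: `A′` is expanded along the
    -- basis and the finite sum is pulled through `A`.
    LR-comm : ∀ {B : Set} (B′ : Index) (A : Op B B) (A′ : Op (Ix B′) (Ix B′)) u →
              Lₒ A · Rₒ A′ · u ≋ Rₒ A′ · Lₒ A · u
    LR-comm B′ A A′ u (b , b′) = begin
      (A · (λ c → (A′ · (λ c′ → u (c , c′))) b′)) b
        ≈⟨ ·-cong A (λ c → ≈-trans (expand B′ A′ _ b′) (∑-cong (enum B′) (λ c′ → *-comm _ _))) b ⟩
      (A · (λ c → ∑ (enum B′) (λ c′ → (A′ · δ B′ c′) b′ * u (c , c′)))) b
        ≈⟨ ·-∑* A (enum B′) _ _ b ⟩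
      ∑ (enum B′) (λ c′ → (A′ · δ B′ c′) b′ * (A · (λ c → u (c , c′))) b)
        ≈⟨ ∑-cong (enum B′) (λ c′ → *-comm _ _) ⟩
      ∑ (enum B′) (λ c′ → (A · (λ c → u (c , c′))) b * (A′ · δ B′ c′) b′)
        ≈⟨ ≈-sym (expand B′ A′ _ b′) ⟩
      (A′ · (λ c′ → (A · (λ c → u (c , c′))) b)) b′ ∎

-- Labelled complexes

module Exponents (n : ℕ) where

  infix 4 _≤ₑ_ _≤ₑ?_
  infixl 6 _⊔ₑ_

  record _≤ₑ_ (α β : Vec ℕ n) : Set where
    constructor pointwise
    field
      at : ∀ i → lookup α i ℕ.≤ lookup β i
  open _≤ₑ_ public

  _≤ₑ?_ : ∀ α β → Dec (α ≤ₑ β)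
  α ≤ₑ? β = map′ pointwise at (Finₚ.all? (λ i → lookup α i ℕ.≤? lookup β i))

  ≤ₑ-refl : ∀ {α} → α ≤ₑ α
  ≤ₑ-refl .at i = ℕₚ.≤-refl

  ≤ₑ-trans : ∀ {α β γ} → α ≤ₑ β → β ≤ₑ γ → α ≤ₑ γ
  ≤ₑ-trans p q .at i = ℕₚ.≤-trans (at p i) (at q i)

  _⊔ₑ_ : Vec ℕ n → Vec ℕ n → Vec ℕ n
  _⊔ₑ_ = zipWith ℕ._⊔_

  ⊔ₑ-lub : ∀ {α β γ} → α ≤ₑ γ → β ≤ₑ γ → α ⊔ₑ β ≤ₑ γ
  ⊔ₑ-lub {α} {β} {γ} p q .at i =
    subst (ℕ._≤ lookup γ i) (≡.sym (Vecₚ.lookup-zipWith ℕ._⊔_ i α β)) (ℕₚ.⊔-lub (at p i) (at q i))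

  ⊔ₑ-upperˡ : ∀ α β → α ≤ₑ α ⊔ₑ β
  ⊔ₑ-upperˡ α β .at i = subst (lookup α i ℕ.≤_) (≡.sym (Vecₚ.lookup-zipWith ℕ._⊔_ i α β)) (ℕₚ.m≤m⊔n _ _)

  ⊔ₑ-upperʳ : ∀ α β → β ≤ₑ α ⊔ₑ β
  ⊔ₑ-upperʳ α β .at i = subst (lookup β i ℕ.≤_) (≡.sym (Vecₚ.lookup-zipWith ℕ._⊔_ i α β)) (ℕₚ.m≤n⊔m (lookup α i) _)

  0ₑ : Vec ℕ n
  0ₑ = replicate n 0

  0ₑ-least : ∀ {α} → 0ₑ ≤ₑ α
  0ₑ-least {α} .at i = subst (ℕ._≤ lookup α i) (≡.sym (Vecₚ.lookup-replicate i 0)) z≤n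

  infixl 6 _⊕_ _⊖_

  _⊕_ : Vec ℕ n → Vec ℕ n → Vec ℕ n
  _⊕_ = zipWith ℕ._+_

  _⊖_ : Vec ℕ n → Vec ℕ n → Vec ℕ n
  _⊖_ = zipWith ℕ._∸_

  _≟ₑ_ : (α β : Vec ℕ n) → Dec (α ≡ β)
  _≟ₑ_ = Vecₚ.≡-dec ℕ._≟_

  ⊕-identityˡ : ∀ α → 0ₑ ⊕ α ≡ α
  ⊕-identityˡ = Vecₚ.zipWith-identityˡ ℕₚ.+-identityˡ

  ⊕-identityʳ : ∀ α → α ⊕ 0ₑ ≡ α
  ⊕-identityʳ = Vecₚ.zipWith-identityʳ ℕₚ.+-identityʳ

  ⊕-comm : ∀ α β → α ⊕ β ≡ β ⊕ α
  ⊕-comm = Vecₚ.zipWith-comm ℕₚ.+-comm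

  ⊕-assoc : ∀ α β γ → (α ⊕ β) ⊕ γ ≡ α ⊕ (β ⊕ γ)
  ⊕-assoc = Vecₚ.zipWith-assoc ℕₚ.+-assoc

  lookup-⊕ : ∀ α β i → lookup (α ⊕ β) i ≡ lookup α i ℕ.+ lookup β i
  lookup-⊕ α β i = Vecₚ.lookup-zipWith ℕ._+_ i α β

  lookup-ext : ∀ {α β : Vec ℕ n} → (∀ i → lookup α i ≡ lookup β i) → α ≡ β
  lookup-ext {α} {β} e = ≡.trans (≡.sym (Vecₚ.tabulate∘lookup α)) (≡.trans (Vecₚ.tabulate-cong e) (Vecₚ.tabulate∘lookup β))

  ⊖-⊕ : ∀ {α β} → β ≤ₑ α → (α ⊖ β) ⊕ β ≡ α
  ⊖-⊕ {α} {β} le = lookup-ext (λ i → ≡.trans (lookup-⊕ (α ⊖ β) β i)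
    (≡.trans (cong (ℕ._+ lookup β i) (Vecₚ.lookup-zipWith ℕ._∸_ i α β)) (ℕₚ.m∸n+n≡m (at le i))))

  ⊕-cancelʳ : ∀ {α β} γ → α ⊕ γ ≡ β ⊕ γ → α ≡ β
  ⊕-cancelʳ {α} {β} γ e = lookup-ext (λ i → ℕₚ.+-cancelʳ-≡ (lookup γ i) _ _
    (≡.trans (≡.sym (lookup-⊕ α γ i)) (≡.trans (cong (λ δ → lookup δ i) e) (lookup-⊕ β γ i))))

  ≤ₑ-⊕ʳ : ∀ α γ → γ ≤ₑ α ⊕ γ
  ≤ₑ-⊕ʳ α γ .at i = subst (lookup γ i ℕ.≤_) (≡.sym (lookup-⊕ α γ i)) (ℕₚ.m≤n+m _ _)

∧-true : ∀ {x y} → x ∧ y ≡ true → x ≡ true × y ≡ true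
∧-true {true} {true} _ = refl , refl

module Complexes {r ℓ : Level} (R : CommutativeRing r ℓ) (n : ℕ) where
  open CommutativeRing R hiding (zero) renaming (refl to ≈-refl; sym to ≈-sym; trans to ≈-trans)
  open import Relation.Binary.Reasoning.Setoid setoid
  open import Algebra.Properties.Ring ring using (-‿involutive; -‿distribˡ-*; -‿distribʳ-*; -0#≈0#)
  open LinearAlgebra R
  open IntegerSolver R
  open Exponents n

  Exp : Set
  Exp = Vec ℕ n

  -- Generators with act b = false are ignored, so that sub-bases need no new index type.
  record Basis : Set₁ where
    field
      idx : Index
      deg : Ix idx → ℕ
      lab : Ix idx → Exp
      act : Ix idx → Bool

    Gen : Set
    Gen = Ix idx

    infix 4 _⊑_ _≼_
    _⊑_ : Gen → Exp → Set
    b ⊑ α = act b ≡ true × lab b ≤ₑ α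

    _⊑?_ : ∀ b α → Dec (b ⊑ α)
    b ⊑? α = (act b Boolₚ.≟ true) ×-dec (lab b ≤ₑ? α)

    -- An entry from `c` to `b` that respects all strands at once: `lab b` divides `lab c`. Nothing
    -- is asked of an inactive `c`, which lies in no strand.
    _≼_ : Gen → Gen → Set
    b ≼ c = act c ≡ true → b ⊑ lab c

    _≼?_ : ∀ b c → Dec (b ≼ c)
    b ≼? c = (act c Boolₚ.≟ true) →-dec (b ⊑? lab c)

    ≼-⊑ : ∀ {b c α} → b ≼ c → c ⊑ α → b ⊑ α
    ≼-⊑ p (a , l) = proj₁ (p a) , ≤ₑ-trans (proj₂ (p a)) l

    ≼-trans : ∀ {b c d} → b ≼ c → c ≼ d → b ≼ d
    ≼-trans p q a = ≼-⊑ p (q a)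

    Supp : Exp → Vect Gen → Set ℓ
    Supp α v = ∀ b → ¬ b ⊑ α → v b ≈ 0#

    Lower : Gen → Gen → Set
    Lower b c = deg c ≡ suc (deg b) × b ≼ c

    Raise : (Gen → Gen → Set) → Gen → Gen → Set
    Raise Q b c = deg b ≡ suc (deg c) × Q b c

    -- The same requirement for the single strand at α. Contractions satisfy only this one: they may
    -- raise the label, as when `★` is sent to a generator of the ideal.
    _⊑ᶜ[_]_ : Gen → Exp → Gen → Set
    b ⊑ᶜ[ α ] c = c ⊑ α → b ⊑ α

    Supp-local : ∀ {Q A α} → (∀ b c → Q b c → b ⊑ᶜ[ α ] c) → Local Q A → ∀ {v} → Supp α v → Supp α (A · v)
    Supp-local f l sv b ¬b = l _ b (λ c q → sv c (λ c⊑ → ¬b (f b c q c⊑)))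

  -- A complex of free modules on labelled generators, seen over the coefficient ring: the generator b
  -- stands for a free summand S(- lab b), and ∂ for the matrix with entries ∂ b c · x^(lab c - lab b).
  -- Its strand in multidegree α lives on the generators b ⊑ α.  For α in U the strand is contractible,
  -- so the complex resolves S modulo the monomials with exponent in U; ★ generates S itself.
  record LRes (L : ℕ) (U : Exp → Set) : Set (Level.suc Level.zero ⊔ r ⊔ ℓ) where
    field
      basis : Basis
    open Basis basis public
    field
      ★        : Gen
      deg-★    : deg ★ ≡ 0
      lab-★    : lab ★ ≡ 0ₑ
      act-★    : act ★ ≡ true
      ★-unique : ∀ b → act b ≡ true → deg b ≡ 0 → b ≡ ★
      bounded  : ∀ b → act b ≡ true → deg b ℕ.≤ L
      -- Together with `★-unique`, this leaves no active generator but `★` in a strand outside `U`: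
      -- exactly the quotient in that multidegree.
      support  : ∀ {α} b → b ⊑ α → 1 ℕ.≤ deg b → U α
      ∂        : Op Gen Gen
      ∂-local  : Local Lower ∂
      ∂∂       : ∀ v → ∂ · ∂ · v ≋ 𝟘
      s        : ∀ {α} → U α → Op Gen Gen
      s-local  : ∀ {α} (u : U α) → Local (Raise _⊑ᶜ[ α ]_) (s u)
      -- The strand includes `★`, so in degree zero this says that the monomial x^α is a boundary.
      s-htpy   : ∀ {α} (u : U α) {v} → Supp α v → ∂ · s u · v ⊹ s u · ∂ · v ≋ v

    ∂-Supp : ∀ {α v} → Supp α v → Supp α (∂ · v)
    ∂-Supp = Supp-local {A = ∂} (λ b c q → ≼-⊑ (proj₂ q)) ∂-local

  LRes-⇔ : ∀ {L L′} {U V : Exp → Set} → L ℕ.≤ L′ → (∀ {α} → U α → V α) → (∀ {α} → V α → U α) → LRes L U → LRes L′ V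
  LRes-⇔ L≤L′ f g F = record
    { LRes F using (basis; ★; deg-★; lab-★; act-★; ★-unique; ∂; ∂-local; ∂∂)
    ; bounded = λ b a → ℕₚ.≤-trans (LRes.bounded F b a) L≤L′
    ; support = λ b p d → f (LRes.support F b p d)
    ; s       = λ u → LRes.s F (g u)
    ; s-local = λ u → LRes.s-local F (g u)
    ; s-htpy  = λ u → LRes.s-htpy F (g u) }

  unit : LRes 0 (λ _ → ⊥)
  unit = record
    { basis = record { idx = finIndex 1 ; deg = λ _ → 0 ; lab = λ _ → 0ₑ ; act = λ _ → true }
    ; ★ = zero ; deg-★ = refl ; lab-★ = refl ; act-★ = refl
    ; ★-unique = λ { zero _ _ → refl }
    ; bounded = λ _ _ → z≤n
    ; support = λ _ _ ()
    ; ∂ = 𝟘ₒ ; ∂-local = λ _ _ _ → ≈-refl ; ∂∂ = λ _ _ → ≈-refl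
    ; s = λ () ; s-local = λ () ; s-htpy = λ () }

  principal : ∀ A → LRes 1 (A ≤ₑ_)
  principal A = record
    { basis = record { idx = finIndex 2 ; deg = dg ; lab = lb ; act = λ _ → true }
    ; ★ = zero ; deg-★ = refl ; lab-★ = refl ; act-★ = refl
    ; ★-unique = λ { zero _ _ → refl ; (suc zero) _ () }
    ; bounded = λ { zero _ → z≤n ; (suc zero) _ → s≤s z≤n }
    ; support = λ { (suc zero) (_ , l) _ → l }
    ; ∂ = record
        { _·_ = λ { v zero → v (suc zero) ; v (suc zero) → 0# }
        ; ·-cong = λ { e zero → e (suc zero) ; e (suc zero) → ≈-refl }
        ; ·-+ = λ { _ _ zero → ≈-refl ; _ _ (suc zero) → ≈-sym (+-identityʳ 0#) }
        ; ·-* = λ { _ _ zero → ≈-refl ; a _ (suc zero) → ≈-sym (zeroʳ a) } }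
    ; ∂-local = λ { v zero z → z (suc zero) (refl , λ _ → refl , 0ₑ-least) ; v (suc zero) z → ≈-refl }
    ; ∂∂ = λ { v zero → ≈-refl ; v (suc zero) → ≈-refl }
    ; s = λ _ → record
        { _·_ = λ { v zero → 0# ; v (suc zero) → v zero }
        ; ·-cong = λ { e (suc zero) → e zero ; e zero → ≈-refl }
        ; ·-+ = λ { _ _ (suc zero) → ≈-refl ; _ _ zero → ≈-sym (+-identityʳ 0#) }
        ; ·-* = λ { _ _ (suc zero) → ≈-refl ; a _ zero → ≈-sym (zeroʳ a) } }
    ; s-local = λ { u v zero z → ≈-refl ; u v (suc zero) z → z zero (refl , λ _ → refl , u) }
    ; s-htpy = λ { u sv zero → +-identityʳ _ ; u sv (suc zero) → +-identityˡ _ } }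
    where
    dg : Fin 2 → ℕ
    dg zero       = 0
    dg (suc zero) = 1
    lb : Fin 2 → Exp
    lb zero       = 0ₑ
    lb (suc zero) = A

  sgn : ℕ → Carrier
  sgn zero    = 1#
  sgn (suc d) = - sgn d

  sgn² : ∀ d → sgn d * sgn d ≈ 1#
  sgn² zero    = *-identityʳ 1#
  sgn² (suc d) = ≈-trans (≈-sym (-‿distribˡ-* _ _)) (≈-trans (-‿cong (≈-sym (-‿distribʳ-* _ _)))
                   (≈-trans (-‿involutive _) (sgn² d)))

  -- Tensor product of labelled complexes and the sum of ideals

  module Sign (F F′ : Basis) where
    private
      module F  = Basis F
      module F′ = Basis F′

    -- The Koszul sign, determined by the degree of the first factor.
    G : Op (F.Gen × F′.Gen) (F.Gen × F′.Gen)
    G = diagₒ (λ (b , _) → sgn (F.deg b))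

    GG : ∀ u → G · G · u ≋ u
    GG u (b , _) = ≈-trans (≈-sym (*-assoc _ _ _)) (≈-trans (*-congʳ (sgn² (F.deg b))) (*-identityˡ _))

    G-R : ∀ A u → Rₒ A · G · u ≋ G · Rₒ A · u
    G-R A = commute-R A _

    G-lower : ∀ {Q A} → Local Q A → (∀ b c → Q b c → F.deg c ≡ suc (F.deg b)) →
              ∀ u → Lₒ A · G · u ≋ ⊟ (G · Lₒ A · u)
    G-lower {A = A} l f = anticommute-L {A = A} (λ b → sgn (F.deg b)) l
      (λ x y q → reflexive (cong sgn (f x y q)))

    G-raise : ∀ {Q A} → Local Q A → (∀ b c → Q b c → F.deg b ≡ suc (F.deg c)) →
              ∀ u → Lₒ A · G · u ≋ ⊟ (G · Lₒ A · u)
    G-raise {A = A} l f = anticommute-L {A = A} (λ b → sgn (F.deg b)) l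
      (λ x y q → ≈-trans (≈-sym (-‿involutive _)) (-‿cong (reflexive (cong sgn (≡.sym (f x y q))))))

  module Sum {p q : ℕ} {U V : Exp → Set} (F : LRes p U) (F′ : LRes q V) where
    private
      module F  = LRes F
      module F′ = LRes F′
    open Sign F.basis F′.basis

    B : Basis
    B = record
      { idx = F.idx ×ᴵ F′.idx
      ; deg = λ (b , b′) → F.deg b ℕ.+ F′.deg b′
      ; lab = λ (b , b′) → F.lab b ⊔ₑ F′.lab b′
      ; act = λ (b , b′) → F.act b ∧ F′.act b′ }
    open Basis B

    ⊑-fst : ∀ {b b′ α} → (b , b′) ⊑ α → b F.⊑ α
    ⊑-fst (a , l) = proj₁ (∧-true a) , ≤ₑ-trans (⊔ₑ-upperˡ _ _) l

    ⊑-snd : ∀ {b b′ α} → (b , b′) ⊑ α → b′ F′.⊑ α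
    ⊑-snd (a , l) = proj₂ (∧-true a) , ≤ₑ-trans (⊔ₑ-upperʳ _ _) l

    ⊑-pair : ∀ {b b′ α} → b F.⊑ α → b′ F′.⊑ α → (b , b′) ⊑ α
    ⊑-pair (a , l) (a′ , l′) = cong₂ _∧_ a a′ , ⊔ₑ-lub l l′

    ≼-⊑ᶜ : ∀ {x y} → (∀ {α} → x ⊑ᶜ[ α ] y) → x ≼ y
    ≼-⊑ᶜ f a = f (a , ≤ₑ-refl)

    D : Op Gen Gen
    D = Lₒ F.∂ +ₒ G ∘ₒ Rₒ F′.∂

    L-GR : ∀ A u → Lₒ F.∂ · G · Rₒ A · u ≋ ⊟ (G · Rₒ A · Lₒ F.∂ · u)
    L-GR A u x = ≈-trans (G-lower F.∂-local (λ _ _ → proj₁) _ x)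
      (-‿cong (*-congˡ (LR-comm F′.idx F.∂ A u x)))

    GRGR : ∀ A A′ u → G · Rₒ A · G · Rₒ A′ · u ≋ Rₒ A · Rₒ A′ · u
    GRGR A A′ u x = ≈-trans (*-congˡ (G-R A _ x)) (GG (Rₒ A · Rₒ A′ · u) x)

    DD : ∀ u → D · D · u ≋ 𝟘
    DD u x = begin
      (Lₒ F.∂ · D · u) x + (G · Rₒ F′.∂ · D · u) x
        ≈⟨ +-cong (·-+ (Lₒ F.∂) _ _ x) (·-+ (G ∘ₒ Rₒ F′.∂) _ _ x) ⟩
      ((Lₒ F.∂ · Lₒ F.∂ · u) x + (Lₒ F.∂ · G · Rₒ F′.∂ · u) x)
        + ((G · Rₒ F′.∂ · Lₒ F.∂ · u) x + (G · Rₒ F′.∂ · G · Rₒ F′.∂ · u) x)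
        ≈⟨ +-cong (+-cong (≈-trans (reflexive (LL-at F.∂ F.∂ u (proj₁ x) (proj₂ x))) (F.∂∂ _ (proj₁ x))) (L-GR F′.∂ u x)) (+-congˡ (≈-trans (GRGR F′.∂ F′.∂ u x) (≈-trans (reflexive (RR-at F′.∂ F′.∂ u (proj₁ x) (proj₂ x))) (F′.∂∂ _ (proj₂ x))))) ⟩
      (0# + - (G · Rₒ F′.∂ · Lₒ F.∂ · u) x) + ((G · Rₒ F′.∂ · Lₒ F.∂ · u) x + 0#)
        ≈⟨ solve 2 (λ o a → (o :+ :- a) :+ (a :+ o) := o :+ o) ≈-refl 0# _ ⟩
      0# + 0#
        ≈⟨ +-identityʳ 0# ⟩
      0# ∎

    -- A tensor product is contractible as soon as one factor is, so the contraction of that factor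
    -- alone is used, with the Koszul sign when it is the second.
    S : ∀ {α} → U α ⊎ V α → Op Gen Gen
    S (inj₁ u) = Lₒ (F.s u)
    S (inj₂ v) = G ∘ₒ Rₒ (F′.s v)

    S-htpy : ∀ {α} (u : U α ⊎ V α) {v} → Supp α v → D · S u · v ⊹ S u · D · v ≋ v
    S-htpy (inj₁ u) {v} sv x@(b , b′) = begin
      ((Lₒ F.∂ · Ls · v) x + (G · Rₒ F′.∂ · Ls · v) x) + (Ls · D · v) x
        ≈⟨ +-congˡ (·-+ Ls _ _ x) ⟩
      ((Lₒ F.∂ · Ls · v) x + (G · Rₒ F′.∂ · Ls · v) x) + ((Ls · Lₒ F.∂ · v) x + (Ls · G · Rₒ F′.∂ · v) x)
        -- `F.s u` shifts the degree by one and hence anticommutes with `G`; this makes the two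
        -- mixed terms cancel.
        ≈⟨ +-congˡ (+-congˡ (≈-trans (G-raise (F.s-local u) (λ _ _ → proj₁) _ x)
             (-‿cong (*-congˡ (LR-comm F′.idx (F.s u) F′.∂ v x))))) ⟩
      ((Lₒ F.∂ · Ls · v) x + (G · Rₒ F′.∂ · Ls · v) x) + ((Ls · Lₒ F.∂ · v) x + - (G · Rₒ F′.∂ · Ls · v) x)
        ≈⟨ solve 3 (λ a g c → (a :+ g) :+ (c :+ :- g) := a :+ c) ≈-refl _ _ _ ⟩
      (Lₒ F.∂ · Ls · v) x + (Ls · Lₒ F.∂ · v) x
        ≈⟨ +-cong (reflexive (LL-at F.∂ (F.s u) v b b′)) (reflexive (LL-at (F.s u) F.∂ v b b′)) ⟩
      (F.∂ · F.s u · (λ c → v (c , b′))) b + (F.s u · F.∂ · (λ c → v (c , b′))) b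
        ≈⟨ F.s-htpy u (λ c ¬c → sv (c , b′) (λ p → ¬c (⊑-fst p))) b ⟩
      v x ∎
      where
      Ls = Lₒ (F.s u)
    S-htpy (inj₂ u) {v} sv x@(b , b′) = begin
      ((Lₒ F.∂ · G · Rs · v) x + (G · Rₒ F′.∂ · G · Rs · v) x) + (G · Rs · D · v) x
        ≈⟨ +-cong (+-cong (L-GR (F′.s u) v x) (GRGR F′.∂ (F′.s u) v x)) (·-+ (G ∘ₒ Rs) _ _ x) ⟩
      (- (G · Rs · Lₒ F.∂ · v) x + (Rₒ F′.∂ · Rs · v) x) + ((G · Rs · Lₒ F.∂ · v) x + (G · Rs · G · Rₒ F′.∂ · v) x)
        ≈⟨ +-congˡ (+-congˡ (GRGR (F′.s u) F′.∂ v x)) ⟩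
      (- (G · Rs · Lₒ F.∂ · v) x + (Rₒ F′.∂ · Rs · v) x) + ((G · Rs · Lₒ F.∂ · v) x + (Rs · Rₒ F′.∂ · v) x)
        ≈⟨ solve 3 (λ g a c → (:- g :+ a) :+ (g :+ c) := a :+ c) ≈-refl _ _ _ ⟩
      (Rₒ F′.∂ · Rs · v) x + (Rs · Rₒ F′.∂ · v) x
        ≈⟨ +-cong (reflexive (RR-at F′.∂ (F′.s u) v b b′)) (reflexive (RR-at (F′.s u) F′.∂ v b b′)) ⟩
      (F′.∂ · F′.s u · (λ c → v (b , c))) b′ + (F′.s u · F′.∂ · (λ c → v (b , c))) b′
        ≈⟨ F′.s-htpy u (λ c ¬c → sv (b , c) (λ p → ¬c (⊑-snd p))) b′ ⟩
      v x ∎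
      where
      Rs = Rₒ (F′.s u)

    S-local : ∀ {α} (u : U α ⊎ V α) → Local (Raise _⊑ᶜ[ α ]_) (S u)
    S-local (inj₁ u) = Local-⊆ {A = S (inj₁ u)}
      (λ { (b , b′) (c , .b′) ((d , f) , refl) → cong (ℕ._+ F′.deg b′) d , λ p → ⊑-pair (f (⊑-fst p)) (⊑-snd p) })
      (Local-L {A = F.s u} (F.s-local u))
    S-local (inj₂ v) = Local-⊆ {A = S (inj₂ v)}
      (λ { (b , b′) (.b , c′) (refl , (d , f)) →
           ≡.trans (cong (F.deg b ℕ.+_) d) (ℕₚ.+-suc _ _) , λ p → ⊑-pair (⊑-fst p) (f (⊑-snd p)) })
      (Local-scale _ {A = Rₒ (F′.s v)} (Local-R {A = F′.s v} (F′.s-local v)))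

    D-local : Local Lower D
    D-local = Local-+ {A = Lₒ F.∂} {A′ = G ∘ₒ Rₒ F′.∂}
      (Local-⊆ {A = Lₒ F.∂}
        (λ { (b , b′) (c , .b′) ((d , f) , refl) →
             cong (ℕ._+ F′.deg b′) d , ≼-⊑ᶜ (λ p → ⊑-pair (F.≼-⊑ f (⊑-fst p)) (⊑-snd p)) })
        (Local-L {A = F.∂} F.∂-local))
      (Local-⊆ {A = G ∘ₒ Rₒ F′.∂}
        (λ { (b , b′) (.b , c′) (refl , (d , f)) →
             ≡.trans (cong (F.deg b ℕ.+_) d) (ℕₚ.+-suc _ _) , ≼-⊑ᶜ (λ p → ⊑-pair (⊑-fst p) (F′.≼-⊑ f (⊑-snd p))) })
        (Local-scale _ {A = Rₒ F′.∂} (Local-R {A = F′.∂} F′.∂-local)))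

    sumRes : LRes (p ℕ.+ q) (λ α → U α ⊎ V α)
    sumRes = record
      { basis = B
      ; ★ = F.★ , F′.★
      ; deg-★ = cong₂ ℕ._+_ F.deg-★ F′.deg-★
      ; lab-★ = ≡.trans (cong₂ _⊔ₑ_ F.lab-★ F′.lab-★) (Vecₚ.zipWith-replicate ℕ._⊔_ 0 0)
      ; act-★ = cong₂ _∧_ F.act-★ F′.act-★
      ; ★-unique = λ (b , b′) a d → cong₂ _,_
          (F.★-unique b (proj₁ (∧-true a)) (ℕₚ.m+n≡0⇒m≡0 _ d))
          (F′.★-unique b′ (proj₂ (∧-true a)) (ℕₚ.m+n≡0⇒n≡0 (F.deg b) d))
      ; bounded = λ (b , b′) a → ℕₚ.+-mono-≤ (F.bounded b (proj₁ (∧-true a))) (F′.bounded b′ (proj₂ (∧-true a)))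
      ; support = λ (b , b′) → supp b b′
      ; ∂ = D ; ∂-local = D-local ; ∂∂ = DD
      ; s = S ; s-local = S-local ; s-htpy = S-htpy }
      where
      supp : ∀ {α} b b′ → (b , b′) ⊑ α → 1 ℕ.≤ F.deg b ℕ.+ F′.deg b′ → U α ⊎ V α
      supp b b′ p d with F.deg b in eq
      ... | zero  = inj₂ (F′.support b′ (⊑-snd p) d)
      ... | suc _ = inj₁ (F.support b (⊑-fst p) (subst (1 ℕ.≤_) (≡.sym eq) (s≤s z≤n)))

  -- Splitting off the augmentation; the intersection of ideals

  isZero isPos : ℕ → Carrier
  isZero zero    = 1#
  isZero (suc _) = 0#
  isPos zero    = 0#
  isPos (suc _) = 1#

  isZero-mask : ∀ d → d ≡ 0 ⊎ isZero d ≈ 0#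
  isZero-mask zero    = inj₁ refl
  isZero-mask (suc _) = inj₂ ≈-refl

  isPos-mask : ∀ d → 1 ℕ.≤ d ⊎ isPos d ≈ 0#
  isPos-mask zero    = inj₂ ≈-refl
  isPos-mask (suc _) = inj₁ (s≤s z≤n)

  module Augmentation {L : ℕ} {U : Exp → Set} (F : LRes L U) where
    open LRes F

    -- `e` and `q` project to degree zero and to positive degree. Accordingly `∂` splits into the
    -- augmentation `ε` and the differential `d̂` of the resolution of the ideal itself.
    e q d̂ ε : Op Gen Gen
    e = diagₒ (λ b → isZero (deg b))
    q = diagₒ (λ b → isPos (deg b))
    d̂ = q ∘ₒ ∂
    ε = e ∘ₒ ∂

    e+q : ∀ v → v ≋ e · v ⊹ q · v
    e+q v b with deg b
    ... | zero  = ≈-sym (≈-trans (+-cong (*-identityˡ _) (zeroˡ _)) (+-identityʳ _))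
    ... | suc _ = ≈-sym (≈-trans (+-cong (zeroˡ _) (*-identityˡ _)) (+-identityˡ _))

    qq : ∀ v → q · q · v ≋ q · v
    qq v b with deg b
    ... | zero  = ≈-trans (zeroˡ _) (≈-sym (zeroˡ _))
    ... | suc _ = *-identityˡ _

    ee : ∀ v → e · e · v ≋ e · v
    ee v b with deg b
    ... | zero  = *-identityˡ _
    ... | suc _ = ≈-trans (zeroˡ _) (≈-sym (zeroˡ _))

    eq : ∀ v → e · q · v ≋ 𝟘
    eq v b with deg b
    ... | zero  = ≈-trans (*-congˡ (zeroˡ _)) (zeroʳ _)
    ... | suc _ = zeroˡ _

    qe : ∀ v → q · e · v ≋ 𝟘
    qe v b with deg b
    ... | zero  = zeroˡ _
    ... | suc _ = ≈-trans (*-congˡ (zeroˡ _)) (zeroʳ _)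

    ∂e : ∀ v → ∂ · e · v ≋ 𝟘
    ∂e v b = ∂-local _ b (λ c (dc , _) → ≈-trans (*-congʳ (reflexive (cong isZero dc))) (zeroˡ _))

    ∂q : ∀ v → ∂ · q · v ≋ ∂ · v
    ∂q v b = ≈-sym (≈-trans (·-cong ∂ (e+q v) b) (≈-trans (·-+ ∂ _ _ b)
      (≈-trans (+-congʳ (∂e v b)) (+-identityˡ _))))

    ∂e∂ : ∀ v → ∂ · ε · v ≋ 𝟘
    ∂e∂ v = ∂e (∂ · v)

    ∂q∂ : ∀ v → ∂ · d̂ · v ≋ 𝟘
    ∂q∂ v b = ≈-trans (∂q (∂ · v) b) (∂∂ v b)

    d̂-local : Local (λ b c → 1 ℕ.≤ deg b × Lower b c) d̂
    d̂-local = Local-maskˡ {A = ∂} (λ b → isPos-mask (deg b)) ∂-local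

    ε-local : Local (λ b c → deg b ≡ 0 × Lower b c) ε
    ε-local = Local-maskˡ {A = ∂} (λ b → isZero-mask (deg b)) ∂-local

    module Contraction {α} (u : U α) where

      -- The contraction splits in the same way: `ŝ` acts on positive degrees, and `η` is a section
      -- of the augmentation on the strand. Then `P`, which is η ε, projects onto a line that
      -- represents the homology of the unaugmented strand.
      ŝ η P : Op Gen Gen
      ŝ = s u ∘ₒ q
      η = s u ∘ₒ e
      P = η ∘ₒ ∂

      es : ∀ v → e · s u · v ≋ 𝟘
      es v b with deg b in eq
      ... | zero  = ≈-trans (*-congˡ (s-local u v b (λ c (r , _) → ⊥-elim (ℕₚ.0≢1+n (≡.trans (≡.sym eq) r))))) (zeroʳ _)
      ... | suc _ = zeroˡ _

      qs : ∀ v → q · s u · v ≋ s u · v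
      qs v b = ≈-sym (≈-trans (e+q (s u · v) b) (≈-trans (+-congʳ (es v b)) (+-identityˡ _)))

      Supp-e : ∀ {v} → Supp α v → Supp α (e · v)
      Supp-e sv b ¬b = ≈-trans (*-congˡ (sv b ¬b)) (zeroʳ _)

      Supp-q : ∀ {v} → Supp α v → Supp α (q · v)
      Supp-q sv b ¬b = ≈-trans (*-congˡ (sv b ¬b)) (zeroʳ _)

      ∂η : ∀ {v} → Supp α v → ∂ · η · v ≋ e · v
      ∂η {v} sv b = begin
        (∂ · s u · e · v) b                            ≈⟨ ≈-sym (+-identityʳ _) ⟩
        (∂ · s u · e · v) b + 0#                       ≈⟨ +-congˡ (≈-sym (·-𝟘 (s u) (∂e v) b)) ⟩
        (∂ · s u · e · v) b + (s u · ∂ · e · v) b      ≈⟨ s-htpy u (Supp-e sv) b ⟩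
        (e · v) b                                      ∎

      d̂η : ∀ {v} → Supp α v → d̂ · η · v ≋ 𝟘
      d̂η {v} sv b = ≈-trans (*-congˡ (∂η sv b)) (qe v b)

      εη : ∀ {v} → Supp α v → ε · η · v ≋ e · v
      εη {v} sv b = ≈-trans (*-congˡ (∂η sv b)) (ee v b)

      d̂P : ∀ {v} → Supp α v → d̂ · P · v ≋ 𝟘
      d̂P sv = d̂η (∂-Supp sv)

      εŝ : ∀ {v} → Supp α v → ε · ŝ · v ≋ 𝟘
      εŝ {v} sv b = begin
        (e · ∂ · s u · q · v) b
          ≈⟨ ≈-sym (+-identityʳ _) ⟩
        (e · ∂ · s u · q · v) b + 0#
          ≈⟨ +-congˡ (≈-sym (es (∂ · q · v) b)) ⟩
        (e · ∂ · s u · q · v) b + (e · s u · ∂ · q · v) b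
          ≈⟨ ≈-sym (·-+ e (∂ · s u · q · v) (s u · ∂ · q · v) b) ⟩
        (e · (∂ · s u · q · v ⊹ s u · ∂ · q · v)) b
          ≈⟨ ·-cong e (s-htpy u (Supp-q sv)) b ⟩
        (e · q · v) b
          ≈⟨ eq v b ⟩
        0# ∎

      ŝε : ∀ v → ŝ · ε · v ≋ 𝟘
      ŝε v = ·-𝟘 (s u) (qe (∂ · v))

      ηd̂ : ∀ v → η · d̂ · v ≋ 𝟘
      ηd̂ v = ·-𝟘 (s u) (eq (∂ · v))

      Pd̂ : ∀ v → P · d̂ · v ≋ 𝟘
      Pd̂ v = ·-𝟘 η (∂q∂ v)

      Pe : ∀ v → P · e · v ≋ 𝟘
      Pe v = ·-𝟘 η (∂e v)

      ηε : ∀ v → η · ε · v ≋ P · v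
      ηε v = ·-cong (s u) (ee (∂ · v))

      -- Contracting the augmented strand amounts to deforming the identity of the unaugmented one
      -- to `P`: the part of s ∂ that passes through degree zero is exactly `P`.
      ŝ-htpy : ∀ {v} → Supp α v → ∀ b → ((d̂ · ŝ · v) b + (ŝ · d̂ · v) b) + (P · v) b ≈ (q · v) b
      ŝ-htpy {v} sv b = begin
        ((q · ∂ · s u · q · v) b + (s u · q · q · ∂ · v) b) + (s u · e · ∂ · v) b
          ≈⟨ +-assoc _ _ _ ⟩
        (q · ∂ · s u · q · v) b + ((s u · q · q · ∂ · v) b + (s u · e · ∂ · v) b)
          ≈⟨ +-congˡ (≈-trans (+-comm _ _) (≈-trans (+-congˡ (·-cong (s u) (qq (∂ · v)) b)) (≈-sym (·-+ (s u) (e · ∂ · v) (q · ∂ · v) b)))) ⟩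
        (q · ∂ · s u · q · v) b + (s u · (e · ∂ · v ⊹ q · ∂ · v)) b
          ≈⟨ +-congˡ (≈-sym (·-cong (s u) (e+q (∂ · v)) b)) ⟩
        (q · ∂ · s u · q · v) b + (s u · ∂ · v) b
          ≈⟨ +-congˡ (≈-sym (·-cong (s u) (∂q v) b)) ⟩
        (q · ∂ · s u · q · v) b + (s u · ∂ · q · v) b
          ≈⟨ +-congˡ (≈-sym (qs (∂ · q · v) b)) ⟩
        (q · ∂ · s u · q · v) b + (q · s u · ∂ · q · v) b
          ≈⟨ ≈-sym (·-+ q (∂ · s u · q · v) (s u · ∂ · q · v) b) ⟩
        (q · (∂ · s u · q · v ⊹ s u · ∂ · q · v)) b
          ≈⟨ ·-cong q (s-htpy u (Supp-q sv)) b ⟩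
        (q · q · v) b
          ≈⟨ qq v b ⟩
        (q · v) b ∎

      ŝ-local : Local (λ b c → 1 ℕ.≤ deg c × Raise _⊑ᶜ[ α ]_ b c) ŝ
      ŝ-local = Local-maskʳ {A = s u} (λ b → isPos-mask (deg b)) (s-local u)

      η-local : Local (λ b c → deg c ≡ 0 × Raise _⊑ᶜ[ α ]_ b c) η
      η-local = Local-maskʳ {A = s u} (λ b → isZero-mask (deg b)) (s-local u)

      P-local : Local (λ b c → deg b ≡ 1 × deg c ≡ 1 × b ⊑ᶜ[ α ] c) P
      P-local = Local-∘ {A = η} {A′ = ∂}
        (λ b d c (d0 , b1 , f) (c1 , g) → ≡.trans b1 (cong suc d0) , ≡.trans c1 (cong suc d0) , λ p → f (≼-⊑ g p))
        η-local ∂-local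

  same : ℕ → ℕ → Bool
  same zero    zero    = true
  same (suc _) (suc _) = true
  same _       _       = false

  same-pos : ∀ {d d′} → 1 ℕ.≤ d → 1 ℕ.≤ d′ → same d d′ ≡ true
  same-pos (s≤s _) (s≤s _) = refl

  same-posʳ : ∀ {d d′} → same d d′ ≡ true → 1 ℕ.≤ d → 1 ℕ.≤ d′
  same-posʳ {suc _} {suc _} _ _ = s≤s z≤n

  same-posˡ : ∀ {d d′} → same d d′ ≡ true → 1 ℕ.≤ d′ → 1 ℕ.≤ d
  same-posˡ {suc _} {suc _} _ _ = s≤s z≤n

  pred-sucˡ : ∀ {d} d′ → 1 ℕ.≤ d → suc (pred (d ℕ.+ d′)) ≡ d ℕ.+ d′
  pred-sucˡ d′ (s≤s _) = refl

  pred-sucʳ : ∀ d {d′} → 1 ℕ.≤ d′ → suc (pred (d ℕ.+ d′)) ≡ d ℕ.+ d′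
  pred-sucʳ zero    (s≤s _) = refl
  pred-sucʳ (suc d) _       = refl

  -- The tensor product of the two unaugmented complexes, augmented again: its generators are the pairs
  -- of positive degree generators (in degree one less than the total degree) and the pair (★ , ★).
  module Intersection {p q : ℕ} {U V : Exp → Set} (F : LRes p U) (F′ : LRes q V) where
    private
      module F  = LRes F
      module F′ = LRes F′
      module A  = Augmentation F
      module A′ = Augmentation F′
    open Sign F.basis F′.basis

    B : Basis
    B = record
      { idx = F.idx ×ᴵ F′.idx
      ; deg = λ (b , b′) → pred (F.deg b ℕ.+ F′.deg b′)
      ; lab = λ (b , b′) → F.lab b ⊔ₑ F′.lab b′
      ; act = λ (b , b′) → (F.act b ∧ F′.act b′) ∧ same (F.deg b) (F′.deg b′) }
    open Basis B

    ⊑-fst : ∀ {b b′ α} → (b , b′) ⊑ α → b F.⊑ α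
    ⊑-fst (a , l) = proj₁ (∧-true (proj₁ (∧-true a))) , ≤ₑ-trans (⊔ₑ-upperˡ _ _) l

    ⊑-snd : ∀ {b b′ α} → (b , b′) ⊑ α → b′ F′.⊑ α
    ⊑-snd {b} (a , l) = proj₂ (∧-true {F.act b} (proj₁ (∧-true a))) , ≤ₑ-trans (⊔ₑ-upperʳ _ _) l

    act-same : ∀ b b′ → act (b , b′) ≡ true → same (F.deg b) (F′.deg b′) ≡ true
    act-same b b′ a = proj₂ (∧-true {F.act b ∧ F′.act b′} a)

    ⊑-pair : ∀ {b b′ α} → b F.⊑ α → b′ F′.⊑ α → same (F.deg b) (F′.deg b′) ≡ true → (b , b′) ⊑ α
    ⊑-pair (a , l) (a′ , l′) t = cong₂ _∧_ (cong₂ _∧_ a a′) t , ⊔ₑ-lub l l′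

    -- `D₁` and `D₂` form the differential of the tensor product of the unaugmented complexes. `D₃`,
    -- which is ε ⊗ ε′, is the new augmentation, from pairs of degrees (1 , 1) to degrees (0 , 0).
    D₁ D₂ D₃ D : Op Gen Gen
    D₁ = Lₒ A.d̂
    D₂ = G ∘ₒ Rₒ A′.d̂
    D₃ = Lₒ A.ε ∘ₒ Rₒ A′.ε
    D  = (D₁ +ₒ D₂) +ₒ D₃

    comm : ∀ (X : Op F.Gen F.Gen) (X′ : Op F′.Gen F′.Gen) (u : Vect Gen) → Rₒ X′ · Lₒ X · u ≋ Lₒ X · Rₒ X′ · u
    comm X X′ u x = ≈-sym (LR-comm F′.idx X X′ u x)

    LL-zero : ∀ {X Y : Op F.Gen F.Gen} → (∀ v → X · Y · v ≋ 𝟘) → ∀ (u : Vect Gen) → Lₒ X · Lₒ Y · u ≋ 𝟘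
    LL-zero {X} {Y} z u (b , b′) = ≈-trans (reflexive (LL-at X Y u b b′)) (z _ b)

    RR-zero : ∀ {X Y : Op F′.Gen F′.Gen} → (∀ v → X · Y · v ≋ 𝟘) → ∀ (u : Vect Gen) → Rₒ X · Rₒ Y · u ≋ 𝟘
    RR-zero {X} {Y} z u (b , b′) = ≈-trans (reflexive (RR-at X Y u b b′)) (z _ b′)

    d̂d̂ : ∀ v → A.d̂ · A.d̂ · v ≋ 𝟘
    d̂d̂ v = ·-𝟘 A.q (A.∂q∂ v)

    L-d̂G : ∀ u → Lₒ A.d̂ · G · u ≋ ⊟ (G · Lₒ A.d̂ · u)
    L-d̂G = G-lower {A = A.d̂} A.d̂-local (λ _ _ (_ , d , _) → d)

    GRGR : ∀ (X X′ : Op F′.Gen F′.Gen) u → G · Rₒ X · G · Rₒ X′ · u ≋ Rₒ X · Rₒ X′ · u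
    GRGR X X′ u x = ≈-trans (*-congˡ (G-R X _ x)) (GG (Rₒ X · Rₒ X′ · u) x)

    +-zero : ∀ {a b} → a ≈ 0# → b ≈ 0# → a + b ≈ 0#
    +-zero p q = ≈-trans (+-cong p q) (+-identityʳ 0#)

    expand-D : ∀ (X : Op Gen Gen) u x → (X · D · u) x ≈ ((X · D₁ · u) x + (X · D₂ · u) x) + (X · D₃ · u) x
    expand-D X u x = ≈-trans (·-+ X _ _ x) (+-congʳ (·-+ X _ _ x))

    -- Of the nine products only D₁ D₂ and D₂ D₁ survive, and the Koszul sign cancels them. Each of
    -- the others contains, in one factor, two successive parts of `∂` whose composite is zero.
    DD : ∀ u → D · D · u ≋ 𝟘
    DD u x = begin
      ((D₁ · D · u) x + (D₂ · D · u) x) + (D₃ · D · u) x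
        ≈⟨ +-cong (+-cong (expand-D D₁ u x) (expand-D D₂ u x)) (expand-D D₃ u x) ⟩
      ((((D₁ · D₁ · u) x + (D₁ · D₂ · u) x) + (D₁ · D₃ · u) x) + (((D₂ · D₁ · u) x + (D₂ · D₂ · u) x) + (D₂ · D₃ · u) x))
        + (((D₃ · D₁ · u) x + (D₃ · D₂ · u) x) + (D₃ · D₃ · u) x)
        ≈⟨ +-cong (+-cong (+-cong (+-congʳ z₁₁) z₁₃) (+-cong (+-cong z₂₁ z₂₂) z₂₃)) (+-cong (+-cong z₃₁ z₃₂) z₃₃) ⟩
      (((0# + (D₁ · D₂ · u) x) + 0#) + ((- (D₁ · D₂ · u) x + 0#) + 0#)) + ((0# + 0#) + 0#)
        ≈⟨ solve 2 (λ o a → (((o :+ a) :+ o) :+ ((:- a :+ o) :+ o)) :+ ((o :+ o) :+ o) := (((o :+ o) :+ (o :+ o)) :+ (o :+ o)) :+ o) ≈-refl 0# _ ⟩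
      (((0# + 0#) + (0# + 0#)) + (0# + 0#)) + 0#
        ≈⟨ +-zero (+-zero (+-zero (+-zero ≈-refl ≈-refl) (+-zero ≈-refl ≈-refl)) (+-zero ≈-refl ≈-refl)) ≈-refl ⟩
      0# ∎
      where
      z₁₁ : (D₁ · D₁ · u) x ≈ 0#
      z₁₁ = LL-zero {A.d̂} {A.d̂} d̂d̂ u x
      z₁₃ : (D₁ · D₃ · u) x ≈ 0#
      z₁₃ = LL-zero {A.d̂} {A.ε} (λ v → ·-𝟘 A.q (A.∂e∂ v)) _ x
      z₂₁ : (D₂ · D₁ · u) x ≈ - (D₁ · D₂ · u) x
      z₂₁ = ≈-sym (≈-trans (-‿cong (L-d̂G _ x)) (≈-trans (-‿involutive _) (*-congˡ (LR-comm F′.idx A.d̂ A′.d̂ u x))))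
      z₂₂ : (D₂ · D₂ · u) x ≈ 0#
      z₂₂ = ≈-trans (GRGR A′.d̂ A′.d̂ u x) (RR-zero {A′.d̂} {A′.d̂} (λ v → ·-𝟘 A′.q (A′.∂q∂ v)) u x)
      z₂₃ : (D₂ · D₃ · u) x ≈ 0#
      z₂₃ = ≈-trans (*-congˡ (≈-trans (comm A.ε A′.d̂ _ x)
              (·-𝟘 (Lₒ A.ε) (RR-zero {A′.d̂} {A′.ε} (λ v → ·-𝟘 A′.q (A′.∂e∂ v)) u) x))) (zeroʳ _)
      z₃₁ : (D₃ · D₁ · u) x ≈ 0#
      z₃₁ = ≈-trans (·-cong (Lₒ A.ε) (comm A.d̂ A′.ε u) x)
              (LL-zero {A.ε} {A.d̂} (λ v → ·-𝟘 A.e (A.∂q∂ v)) _ x)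
      z₃₂ : (D₃ · D₂ · u) x ≈ 0#
      z₃₂ = ·-𝟘 (Lₒ A.ε) (λ y → ≈-trans (G-R A′.ε _ y)
              (≈-trans (*-congˡ (RR-zero {A′.ε} {A′.d̂} (λ v → ·-𝟘 A′.e (A′.∂q∂ v)) u y)) (zeroʳ _))) x
      z₃₃ : (D₃ · D₃ · u) x ≈ 0#
      z₃₃ = ≈-trans (·-cong (Lₒ A.ε) (comm A.ε A′.ε _) x) (LL-zero {A.ε} {A.ε} (λ v → ·-𝟘 A.e (A.∂e∂ v)) _ x)

    D-local : Local Lower D
    D-local = Local-+ {A = D₁ +ₒ D₂} {A′ = D₃} (Local-+ {A = D₁} {A′ = D₂}
      (Local-⊆ {A = D₁} first (Local-L {A = A.d̂} A.d̂-local))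
      (Local-⊆ {A = D₂} second (Local-scale _ {A = Rₒ A′.d̂} (Local-R {A = A′.d̂} A′.d̂-local))))
      (Local-∘ {A = Lₒ A.ε} {A′ = Rₒ A′.ε} third (Local-L {A = A.ε} A.ε-local) (Local-R {A = A′.ε} A′.ε-local))
      where
      first : ∀ x y → (1 ℕ.≤ F.deg (proj₁ x) × F.Lower (proj₁ x) (proj₁ y)) × proj₂ x ≡ proj₂ y → Lower x y
      first (b , b′) (c , .b′) ((1≤b , d , f) , refl) =
        ≡.trans (cong (λ t → pred (t ℕ.+ F′.deg b′)) d) (≡.sym (pred-sucˡ _ 1≤b)) ,
        λ a → let y⊑ = a , ≤ₑ-refl in
          ⊑-pair (F.≼-⊑ f (⊑-fst y⊑)) (⊑-snd {c} y⊑)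
            (same-pos 1≤b (same-posʳ (act-same c b′ a) (subst (1 ℕ.≤_) (≡.sym d) (s≤s z≤n))))
      second : ∀ x y → proj₁ x ≡ proj₁ y × (1 ℕ.≤ F′.deg (proj₂ x) × F′.Lower (proj₂ x) (proj₂ y)) → Lower x y
      second (b , b′) (.b , c′) (refl , (1≤b′ , d , f)) =
        ≡.trans (cong (λ t → pred (F.deg b ℕ.+ t)) d)
          (≡.trans (cong pred (ℕₚ.+-suc (F.deg b) _)) (≡.sym (pred-sucʳ (F.deg b) 1≤b′))) ,
        λ a → let y⊑ = a , ≤ₑ-refl in
          ⊑-pair (⊑-fst y⊑) (F′.≼-⊑ f (⊑-snd {b} y⊑))
            (same-pos (same-posˡ (act-same b c′ a) (subst (1 ℕ.≤_) (≡.sym d) (s≤s z≤n))) 1≤b′)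
      third : ∀ x y z → (F.deg (proj₁ x) ≡ 0 × F.Lower (proj₁ x) (proj₁ y)) × proj₂ x ≡ proj₂ y →
              proj₁ y ≡ proj₁ z × (F′.deg (proj₂ y) ≡ 0 × F′.Lower (proj₂ y) (proj₂ z)) → Lower x z
      third (b , b′) (c , .b′) (.c , c′) ((b0 , d , f) , refl) (refl , (b′0 , d′ , f′)) =
        ≡.trans (cong₂ (λ t t′ → pred (t ℕ.+ t′)) (≡.trans d (cong suc b0)) (≡.trans d′ (cong suc b′0)))
          (≡.sym (cong₂ (λ t t′ → suc (pred (t ℕ.+ t′))) b0 b′0)) ,
        λ a → let y⊑ = a , ≤ₑ-refl in ⊑-pair (F.≼-⊑ f (⊑-fst y⊑)) (F′.≼-⊑ f′ (⊑-snd {c} y⊑)) (cong₂ same b0 b′0)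

    module Contract {α} (uv : U α × V α) where
      private
        module C  = A.Contraction (proj₁ uv)
        module C′ = A′.Contraction (proj₂ uv)

      -- Deform one factor after the other: ŝ ⊗ 1 takes the identity to P ⊗ 1, then P ⊗ ŝ′ takes
      -- this to P ⊗ P′. The latter factors through degree zero as (η ⊗ η′)(ε ⊗ ε′), so η ⊗ η′
      -- completes the contraction of the augmented complex.
      S₁ S₂ S₃ S : Op Gen Gen
      S₁ = Lₒ C.ŝ
      S₂ = G ∘ₒ Lₒ C.P ∘ₒ Rₒ C′.ŝ
      S₃ = Lₒ C.η ∘ₒ Rₒ C′.η
      S  = (S₁ +ₒ S₂) +ₒ S₃

      S-local : Local (Raise _⊑ᶜ[ α ]_) S
      S-local = Local-+ {A = S₁ +ₒ S₂} {A′ = S₃} (Local-+ {A = S₁} {A′ = S₂}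
        (Local-⊆ {A = S₁} first (Local-L {A = C.ŝ} C.ŝ-local))
        (Local-scale _ {A = Lₒ C.P ∘ₒ Rₒ C′.ŝ} (Local-∘ {A = Lₒ C.P} {A′ = Rₒ C′.ŝ} second
          (Local-L {A = C.P} C.P-local) (Local-R {A = C′.ŝ} C′.ŝ-local))))
        (Local-∘ {A = Lₒ C.η} {A′ = Rₒ C′.η} third (Local-L {A = C.η} C.η-local) (Local-R {A = C′.η} C′.η-local))
        where
        first : ∀ x y → (1 ℕ.≤ F.deg (proj₁ y) × F.Raise F._⊑ᶜ[ α ]_ (proj₁ x) (proj₁ y)) × proj₂ x ≡ proj₂ y →
                Raise _⊑ᶜ[ α ]_ x y
        first (b , b′) (c , .b′) ((1≤c , d , f) , refl) =
          ≡.trans (cong (λ t → pred (t ℕ.+ F′.deg b′)) d) (≡.sym (pred-sucˡ _ 1≤c)) ,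
          λ p → ⊑-pair (f (⊑-fst p)) (⊑-snd {c} p)
            (same-pos (subst (1 ℕ.≤_) (≡.sym d) (s≤s z≤n)) (same-posʳ (act-same c b′ (proj₁ p)) 1≤c))
        second : ∀ x y z → (F.deg (proj₁ x) ≡ 1 × F.deg (proj₁ y) ≡ 1 × proj₁ x F.⊑ᶜ[ α ] proj₁ y) × proj₂ x ≡ proj₂ y →
                 proj₁ y ≡ proj₁ z × (1 ℕ.≤ F′.deg (proj₂ z) × F′.Raise F′._⊑ᶜ[ α ]_ (proj₂ y) (proj₂ z)) →
                 Raise _⊑ᶜ[ α ]_ x z
        second (b , b′) (c , .b′) (.c , c′) ((b1 , c1 , f) , refl) (refl , (1≤c′ , d′ , f′)) =
          ≡.trans (cong₂ (λ t t′ → pred (t ℕ.+ t′)) b1 d′) (cong (λ t → suc (pred (t ℕ.+ F′.deg c′))) (≡.sym c1)) ,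
          λ p → ⊑-pair (f (⊑-fst p)) (f′ (⊑-snd {c} p)) (cong₂ same b1 d′)
        third : ∀ x y z → (F.deg (proj₁ y) ≡ 0 × F.Raise F._⊑ᶜ[ α ]_ (proj₁ x) (proj₁ y)) × proj₂ x ≡ proj₂ y →
                proj₁ y ≡ proj₁ z × (F′.deg (proj₂ z) ≡ 0 × F′.Raise F′._⊑ᶜ[ α ]_ (proj₂ y) (proj₂ z)) →
                Raise _⊑ᶜ[ α ]_ x z
        third (b , b′) (c , .b′) (.c , c′) ((c0 , d , f) , refl) (refl , (c′0 , d′ , f′)) =
          ≡.trans (cong₂ (λ t t′ → pred (t ℕ.+ t′)) (≡.trans d (cong suc c0)) (≡.trans d′ (cong suc c′0)))
            (≡.sym (cong₂ (λ t t′ → suc (pred (t ℕ.+ t′))) c0 c′0)) ,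
          λ p → ⊑-pair (f (⊑-fst p)) (f′ (⊑-snd {c} p)) (cong₂ same d d′)

      SuppL SuppR : Vect Gen → Set ℓ
      SuppL u = ∀ b′ → F.Supp α (λ b → u (b , b′))
      SuppR u = ∀ b → F′.Supp α (λ b′ → u (b , b′))

      SuppL-R : ∀ (X : Op F′.Gen F′.Gen) {u} → SuppL u → SuppL (Rₒ X · u)
      SuppL-R X {u} su b′ b ¬b = ≈-trans (reflexive (R-at X u b b′)) (·-𝟘 X (λ c → su c b ¬b) b′)

      LL-zeroˢ : ∀ {X Y : Op F.Gen F.Gen} → (∀ {v} → F.Supp α v → X · Y · v ≋ 𝟘) → ∀ {u} → SuppL u → Lₒ X · Lₒ Y · u ≋ 𝟘
      LL-zeroˢ {X} {Y} z {u} su (b , b′) = ≈-trans (reflexive (LL-at X Y u b b′)) (z (su b′) b)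

      RR-zeroˢ : ∀ {X Y : Op F′.Gen F′.Gen} → (∀ {v} → F′.Supp α v → X · Y · v ≋ 𝟘) → ∀ {u} → SuppR u → Rₒ X · Rₒ Y · u ≋ 𝟘
      RR-zeroˢ {X} {Y} z {u} su (b , b′) = ≈-trans (reflexive (RR-at X Y u b b′)) (z (su b) b′)

      G-LP : ∀ u → Lₒ C.P · G · u ≋ G · Lₒ C.P · u
      G-LP = commute-L {A = C.P} _ C.P-local (λ x y (x1 , y1 , _) → reflexive (cong sgn (≡.trans y1 (≡.sym x1))))

      expand-S : ∀ (X : Op Gen Gen) u x → (X · S · u) x ≈ ((X · S₁ · u) x + (X · S₂ · u) x) + (X · S₃ · u) x
      expand-S X u x = ≈-trans (·-+ X _ _ x) (+-congʳ (·-+ X _ _ x))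

      S-htpy : ∀ {u} → Supp α u → D · S · u ⊹ S · D · u ≋ u
      S-htpy {u} su x@(b , b′) = begin
        (((D₁ · S · u) x + (D₂ · S · u) x) + (D₃ · S · u) x) + (((S₁ · D · u) x + (S₂ · D · u) x) + (S₃ · D · u) x)
          ≈⟨ +-cong (+-cong (+-cong (expand-S D₁ u x) (expand-S D₂ u x)) (expand-S D₃ u x))
                    (+-cong (+-cong (expand-D S₁ u x) (expand-D S₂ u x)) (expand-D S₃ u x)) ⟩
        (((((D₁ · S₁ · u) x + (D₁ · S₂ · u) x) + (D₁ · S₃ · u) x) + (((D₂ · S₁ · u) x + (D₂ · S₂ · u) x) + (D₂ · S₃ · u) x))
          + (((D₃ · S₁ · u) x + (D₃ · S₂ · u) x) + (D₃ · S₃ · u) x))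
        + (((((S₁ · D₁ · u) x + (S₁ · D₂ · u) x) + (S₁ · D₃ · u) x) + (((S₂ · D₁ · u) x + (S₂ · D₂ · u) x) + (S₂ · D₃ · u) x))
          + (((S₃ · D₁ · u) x + (S₃ · D₂ · u) x) + (S₃ · D₃ · u) x))
          -- The names `t` and `r` with indices i, j refer to Dᵢ Sⱼ and Sᵢ Dⱼ. What survives: `a₁`
          -- and `a₂` give (q - P) ⊗ 1, the `x` terms give P ⊗ 1, `g` cancels, and `w` is e ⊗ e′.
          ≈⟨ +-cong (+-cong (+-cong (+-cong (+-congˡ t₁₂) t₁₃) (+-cong (+-congˡ t₂₂) t₂₃)) (+-cong (+-cong t₃₁ t₃₂) t₃₃))
                    (+-cong (+-cong (+-cong (+-congˡ r₁₂) r₁₃) (+-cong (+-cong r₂₁ r₂₂) r₂₃)) (+-cong (+-cong r₃₁ r₃₂) r₃₃)) ⟩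
        ((((a₁ + 0#) + 0#) + ((g + x₁) + 0#)) + ((0# + 0#) + w)) + ((((a₂ + - g) + 0#) + ((0# + x₂) + 0#)) + ((0# + 0#) + x₃))
          ≈⟨ solve 8 (λ o a₁ a₂ g x₁ x₂ x₃ w →
               ((((a₁ :+ o) :+ o) :+ ((g :+ x₁) :+ o)) :+ ((o :+ o) :+ w)) :+ ((((a₂ :+ :- g) :+ o) :+ ((o :+ x₂) :+ o)) :+ ((o :+ o) :+ x₃))
               := ((a₁ :+ a₂) :+ ((x₁ :+ x₂) :+ x₃)) :+ (w :+ ((((o :+ o) :+ (o :+ o)) :+ ((o :+ o) :+ (o :+ o))) :+ (o :+ o))))
               ≈-refl 0# a₁ a₂ g x₁ x₂ x₃ w ⟩
        ((a₁ + a₂) + ((x₁ + x₂) + x₃)) + (w + ((((0# + 0#) + (0# + 0#)) + ((0# + 0#) + (0# + 0#))) + (0# + 0#)))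
          ≈⟨ +-cong (+-congˡ xsum) (≈-trans (+-congˡ (+-zero (+-zero (+-zero (+-zero ≈-refl ≈-refl) (+-zero ≈-refl ≈-refl))
               (+-zero (+-zero ≈-refl ≈-refl) (+-zero ≈-refl ≈-refl))) (+-zero ≈-refl ≈-refl))) (+-identityʳ _)) ⟩
        ((a₁ + a₂) + (Lₒ C.P · u) x) + w
          ≈⟨ +-congʳ asum ⟩
        (Lₒ A.q · u) x + w
          ≈⟨ +-cong (reflexive (L-at A.q u b b′)) (reflexive (≡.trans (L-at A.e (Rₒ A′.e · u) b b′)
               (cong (isZero (F.deg b) *_) (R-at A′.e u b b′)))) ⟩
        isPos (F.deg b) * u x + isZero (F.deg b) * (isZero (F′.deg b′) * u x)
          ≈⟨ recombine ⟩
        u x ∎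
        where
        suL : SuppL u
        suL b′ b ¬b = su (b , b′) (λ p → ¬b (⊑-fst p))
        suR : SuppR u
        suR b b′ ¬b′ = su (b , b′) (λ p → ¬b′ (⊑-snd {b} p))
        a₁ = (D₁ · S₁ · u) x
        a₂ = (S₁ · D₁ · u) x
        g  = (D₂ · S₁ · u) x
        x₁ = (Lₒ C.P · Rₒ A′.d̂ · Rₒ C′.ŝ · u) x
        x₂ = (Lₒ C.P · Rₒ C′.ŝ · Rₒ A′.d̂ · u) x
        x₃ = (Lₒ C.P · Rₒ C′.P · u) x
        w  = (Lₒ A.e · Rₒ A′.e · u) x
        t₁₂ : (D₁ · S₂ · u) x ≈ 0#
        t₁₂ = ≈-trans (L-d̂G _ x) (≈-trans (-‿cong (≈-trans (*-congˡ
                (LL-zeroˢ {A.d̂} {C.P} C.d̂P (SuppL-R C′.ŝ suL) x)) (zeroʳ _))) -0#≈0#)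
        t₁₃ : (D₁ · S₃ · u) x ≈ 0#
        t₁₃ = LL-zeroˢ {A.d̂} {C.η} C.d̂η (SuppL-R C′.η suL) x
        t₂₂ : (D₂ · S₂ · u) x ≈ x₁
        t₂₂ = ≈-trans (*-congˡ (G-R A′.d̂ _ x)) (≈-trans (GG (Rₒ A′.d̂ · Lₒ C.P · Rₒ C′.ŝ · u) x) (comm C.P A′.d̂ _ x))
        t₂₃ : (D₂ · S₃ · u) x ≈ 0#
        t₂₃ = ≈-trans (*-congˡ (≈-trans (comm C.η A′.d̂ _ x) (·-𝟘 (Lₒ C.η) (RR-zeroˢ {A′.d̂} {C′.η} C′.d̂η suR) x))) (zeroʳ _)
        t₃₁ : (D₃ · S₁ · u) x ≈ 0#
        t₃₁ = ≈-trans (·-cong (Lₒ A.ε) (comm C.ŝ A′.ε u) x) (LL-zeroˢ {A.ε} {C.ŝ} C.εŝ (SuppL-R A′.ε suL) x)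
        t₃₂ : (D₃ · S₂ · u) x ≈ 0#
        t₃₂ = ·-𝟘 (Lₒ A.ε) (λ y → ≈-trans (G-R A′.ε _ y) (≈-trans (*-congˡ (≈-trans (comm C.P A′.ε _ y)
                (·-𝟘 (Lₒ C.P) (RR-zeroˢ {A′.ε} {C′.ŝ} C′.εŝ suR) y))) (zeroʳ _))) x
        t₃₃ : (D₃ · S₃ · u) x ≈ w
        t₃₃ = ≈-trans (·-cong (Lₒ A.ε) (comm C.η A′.ε _) x)
              (≈-trans (reflexive (LL-at A.ε C.η (Rₒ A′.ε · Rₒ C′.η · u) b b′))
              (≈-trans (C.εη (SuppL-R A′.ε (SuppL-R C′.η suL) b′) b)
              (≈-trans (reflexive (≡.sym (L-at A.e (Rₒ A′.ε · Rₒ C′.η · u) b b′)))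
                (·-cong (Lₒ A.e) (λ (c , c′) → ≈-trans (reflexive (RR-at A′.ε C′.η u c c′))
                  (≈-trans (C′.εη (suR c) c′) (reflexive (≡.sym (R-at A′.e u c c′))))) x))))
        r₁₂ : (S₁ · D₂ · u) x ≈ - g
        r₁₂ = ≈-trans (G-raise {A = C.ŝ} C.ŝ-local (λ _ _ (_ , d , _) → d) _ x) (-‿cong (*-congˡ (LR-comm F′.idx C.ŝ A′.d̂ u x)))
        r₁₃ : (S₁ · D₃ · u) x ≈ 0#
        r₁₃ = LL-zero {C.ŝ} {A.ε} C.ŝε _ x
        r₂₁ : (S₂ · D₁ · u) x ≈ 0#
        r₂₁ = ≈-trans (*-congˡ (≈-trans (·-cong (Lₒ C.P) (comm A.d̂ C′.ŝ u) x) (LL-zero {C.P} {A.d̂} C.Pd̂ _ x))) (zeroʳ _)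
        r₂₂ : (S₂ · D₂ · u) x ≈ x₂
        r₂₂ = ≈-trans (*-congˡ (≈-trans (·-cong (Lₒ C.P) (G-R C′.ŝ _) x) (G-LP _ x)))
                (GG (Lₒ C.P · Rₒ C′.ŝ · Rₒ A′.d̂ · u) x)
        r₂₃ : (S₂ · D₃ · u) x ≈ 0#
        r₂₃ = ≈-trans (*-congˡ (≈-trans (·-cong (Lₒ C.P) (comm A.ε C′.ŝ _) x)
                (·-𝟘 (Lₒ C.P) (·-𝟘 (Lₒ A.ε) (RR-zero {C′.ŝ} {A′.ε} C′.ŝε u)) x))) (zeroʳ _)
        r₃₁ : (S₃ · D₁ · u) x ≈ 0#
        r₃₁ = ≈-trans (·-cong (Lₒ C.η) (comm A.d̂ C′.η u) x) (LL-zero {C.η} {A.d̂} C.ηd̂ _ x)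
        r₃₂ : (S₃ · D₂ · u) x ≈ 0#
        r₃₂ = ·-𝟘 (Lₒ C.η) (λ y → ≈-trans (G-R C′.η _ y) (≈-trans (*-congˡ (RR-zero {C′.η} {A′.d̂} C′.ηd̂ u y)) (zeroʳ _))) x
        r₃₃ : (S₃ · D₃ · u) x ≈ x₃
        r₃₃ = ≈-trans (·-cong (Lₒ C.η) (comm A.ε C′.η _) x)
              (≈-trans (reflexive (LL-at C.η A.ε (Rₒ C′.η · Rₒ A′.ε · u) b b′))
              (≈-trans (C.ηε _ b)
              (≈-trans (reflexive (≡.sym (L-at C.P (Rₒ C′.η · Rₒ A′.ε · u) b b′)))
                (·-cong (Lₒ C.P) (λ (c , c′) → ≈-trans (reflexive (RR-at C′.η A′.ε u c c′))
                  (≈-trans (C′.ηε _ c′) (reflexive (≡.sym (R-at C′.P u c c′))))) x))))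
        asum : (a₁ + a₂) + (Lₒ C.P · u) x ≈ (Lₒ A.q · u) x
        asum = ≈-trans (+-cong (+-cong (reflexive (LL-at A.d̂ C.ŝ u b b′)) (reflexive (LL-at C.ŝ A.d̂ u b b′)))
                               (reflexive (L-at C.P u b b′)))
                 (≈-trans (C.ŝ-htpy (suL b′) b) (reflexive (≡.sym (L-at A.q u b b′))))
        -- P kills the part of u on which the second degree vanishes, since there the first degree vanishes too.
        off : Rₒ A′.e · u ≋ Lₒ A.e · Rₒ A′.e · u
        off (c , c′) = ≈-trans (reflexive (R-at A′.e u c c′)) (≈-trans offPoint
                         (≈-sym (≈-trans (reflexive (L-at A.e (Rₒ A′.e · u) c c′)) (*-congˡ (reflexive (R-at A′.e u c c′))))))
          where
          offPoint : isZero (F′.deg c′) * u (c , c′) ≈ isZero (F.deg c) * (isZero (F′.deg c′) * u (c , c′))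
          offPoint with F.deg c in dc | F′.deg c′ in dc′
          ... | zero  | _     = ≈-sym (*-identityˡ _)
          ... | suc _ | suc _ = ≈-trans (zeroˡ _) (≈-sym (zeroˡ _))
          ... | suc _ | zero  = ≈-trans (*-congˡ (su (c , c′) inactive)) (≈-trans (zeroʳ _) (≈-sym (zeroˡ _)))
            where
            inactive : ¬ (c , c′) ⊑ α
            inactive (a , _) with ≡.trans (≡.sym (cong₂ same dc dc′)) (act-same c c′ a)
            ... | ()
        xsum : (x₁ + x₂) + x₃ ≈ (Lₒ C.P · u) x
        xsum = begin
          (x₁ + x₂) + x₃
            ≈⟨ ≈-sym (≈-trans (·-+ (Lₒ C.P) _ _ x) (+-congʳ (·-+ (Lₒ C.P) _ _ x))) ⟩
          (Lₒ C.P · ((Rₒ A′.d̂ · Rₒ C′.ŝ · u ⊹ Rₒ C′.ŝ · Rₒ A′.d̂ · u) ⊹ Rₒ C′.P · u)) x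
            ≈⟨ ·-cong (Lₒ C.P) (λ (c , c′) → ≈-trans
                 (+-cong (+-cong (reflexive (RR-at A′.d̂ C′.ŝ u c c′)) (reflexive (RR-at C′.ŝ A′.d̂ u c c′))) (reflexive (R-at C′.P u c c′)))
                 (≈-trans (C′.ŝ-htpy (suR c) c′) (reflexive (≡.sym (R-at A′.q u c c′))))) x ⟩
          (Lₒ C.P · Rₒ A′.q · u) x
            ≈⟨ ≈-sym (+-identityˡ _) ⟩
          0# + (Lₒ C.P · Rₒ A′.q · u) x
            ≈⟨ +-congʳ (≈-sym (≈-trans (·-cong (Lₒ C.P) off x) (LL-zero {C.P} {A.e} C.Pe _ x))) ⟩
          (Lₒ C.P · Rₒ A′.e · u) x + (Lₒ C.P · Rₒ A′.q · u) x
            ≈⟨ ≈-sym (·-+ (Lₒ C.P) _ _ x) ⟩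
          (Lₒ C.P · (Rₒ A′.e · u ⊹ Rₒ A′.q · u)) x
            ≈⟨ ·-cong (Lₒ C.P) (λ (c , c′) → ≈-trans (+-cong (reflexive (R-at A′.e u c c′)) (reflexive (R-at A′.q u c c′)))
                 (≈-sym (A′.e+q (λ d → u (c , d)) c′))) x ⟩
          (Lₒ C.P · u) x ∎
        -- Pairs with exactly one degree equal to zero are inactive, so `u` vanishes where the two
        -- projections might miss something.
        recombine : isPos (F.deg b) * u x + isZero (F.deg b) * (isZero (F′.deg b′) * u x) ≈ u x
        recombine with F.deg b in db | F′.deg b′ in db′
        ... | zero  | zero  = ≈-trans (+-cong (zeroˡ _) (≈-trans (*-identityˡ _) (*-identityˡ _))) (+-identityˡ _)
        ... | suc _ | _     = ≈-trans (+-cong (*-identityˡ _) (zeroˡ _)) (+-identityʳ _)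
        ... | zero  | suc _ = ≈-trans (+-cong (zeroˡ _) (≈-trans (*-identityˡ _) (zeroˡ _))) (≈-trans (+-identityʳ 0#) (≈-sym (su x inactive)))
          where
          inactive : ¬ x ⊑ α
          inactive (a , _) with ≡.trans (≡.sym (cong₂ same db db′)) (act-same b b′ a)
          ... | ()

    intersectionRes : LRes (pred (p ℕ.+ q)) (λ α → U α × V α)
    intersectionRes = record
      { basis = B
      ; ★ = F.★ , F′.★
      ; deg-★ = cong₂ (λ d d′ → pred (d ℕ.+ d′)) F.deg-★ F′.deg-★
      ; lab-★ = ≡.trans (cong₂ _⊔ₑ_ F.lab-★ F′.lab-★) (Vecₚ.zipWith-replicate ℕ._⊔_ 0 0)
      ; act-★ = cong₂ _∧_ (cong₂ _∧_ F.act-★ F′.act-★) (cong₂ same F.deg-★ F′.deg-★)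
      ; ★-unique = λ (b , b′) → unique b b′
      ; bounded = λ (b , b′) a → ℕₚ.pred-mono-≤ (ℕₚ.+-mono-≤ (F.bounded b (proj₁ (∧-true (proj₁ (∧-true a)))))
                    (F′.bounded b′ (proj₂ (∧-true {F.act b} (proj₁ (∧-true a))))))
      ; support = λ (b , b′) → supp b b′
      ; ∂ = D ; ∂-local = D-local ; ∂∂ = DD
      ; s = Contract.S ; s-local = Contract.S-local ; s-htpy = Contract.S-htpy }
      where
      unique : ∀ b b′ → act (b , b′) ≡ true → deg (b , b′) ≡ 0 → (b , b′) ≡ (F.★ , F′.★)
      unique b b′ a d with F.deg b in db | F′.deg b′ in db′ | act-same b b′ a
      ... | zero  | zero  | _ = cong₂ _,_ (F.★-unique b (proj₁ (∧-true (proj₁ (∧-true a)))) db)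
                                  (F′.★-unique b′ (proj₂ (∧-true {F.act b} (proj₁ (∧-true a)))) db′)
      ... | suc k | suc l | _ = ⊥-elim (ℕₚ.0≢1+n (≡.trans (≡.sym d) (ℕₚ.+-suc k l)))
      supp : ∀ {α} b b′ → (b , b′) ⊑ α → 1 ℕ.≤ deg (b , b′) → U α × V α
      supp b b′ p d with F.deg b in db | F′.deg b′ in db′ | act-same b b′ (proj₁ p)
      ... | suc k | suc l | _ = F.support b (⊑-fst p) (subst (1 ℕ.≤_) (≡.sym db) (s≤s z≤n)) ,
                                F′.support b′ (⊑-snd {b} p) (subst (1 ℕ.≤_) (≡.sym db′) (s≤s z≤n))
      ... | suc _ | zero  | ()
      supp b b′ p () | zero | zero | _

  -- Position of a degree d relative to L = 2 + k: below L - 1 (lo), equal to L - 1 (bd) or L (e₀),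
  -- or above L with d - L odd (od) or even (ev).
  data Cls : Set where
    lo bd e₀ od ev : Cls

  cls : ℕ → ℕ → Cls
  cls (suc k) (suc d) = cls k d
  cls (suc k) zero    = lo
  cls zero 0 = lo
  cls zero 1 = bd
  cls zero 2 = e₀
  cls zero 3 = od
  cls zero 4 = ev
  cls zero (suc (suc (suc (suc (suc d))))) = cls zero (suc (suc (suc d)))

  data Step : Cls → Cls → Set where
    lo-lo : Step lo lo
    lo-bd : Step lo bd
    bd-e₀ : Step bd e₀
    e₀-od : Step e₀ od
    od-ev : Step od ev
    ev-od : Step ev od

  step : ∀ k d → Step (cls k d) (cls k (suc d))
  step (suc k)       (suc d) = step k d
  step (suc zero)    zero    = lo-lo
  step (suc (suc k)) zero    = lo-lo
  step zero 0 = lo-bd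
  step zero 1 = bd-e₀
  step zero 2 = e₀-od
  step zero 3 = od-ev
  step zero 4 = ev-od
  step zero (suc (suc (suc (suc (suc d))))) = step zero (suc (suc (suc d)))

  cls-zero : ∀ k → cls k 0 ≡ lo
  cls-zero zero    = refl
  cls-zero (suc k) = refl

  module _ {k d : ℕ} where

    private
      after : ∀ {c} → cls k d ≡ c → Step c (cls k (suc d))
      after e = subst (λ c → Step c (cls k (suc d))) e (step k d)

      before : ∀ {c} → cls k (suc d) ≡ c → Step (cls k d) c
      before e = subst (Step (cls k d)) e (step k d)

    after-lo : cls k d ≡ lo → cls k (suc d) ≡ lo ⊎ cls k (suc d) ≡ bd
    after-lo e with cls k (suc d) | after e
    ... | lo | lo-lo = inj₁ refl
    ... | bd | lo-bd = inj₂ refl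

    after-bd : cls k d ≡ bd → cls k (suc d) ≡ e₀
    after-bd e with cls k (suc d) | after e
    ... | e₀ | bd-e₀ = refl

    after-e₀ : cls k d ≡ e₀ → cls k (suc d) ≡ od
    after-e₀ e with cls k (suc d) | after e
    ... | od | e₀-od = refl

    after-od : cls k d ≡ od → cls k (suc d) ≡ ev
    after-od e with cls k (suc d) | after e
    ... | ev | od-ev = refl

    after-ev : cls k d ≡ ev → cls k (suc d) ≡ od
    after-ev e with cls k (suc d) | after e
    ... | od | ev-od = refl

    before-lo : cls k (suc d) ≡ lo → cls k d ≡ lo
    before-lo e with cls k d | before e
    ... | lo | lo-lo = refl

    before-bd : cls k (suc d) ≡ bd → cls k d ≡ lo
    before-bd e with cls k d | before e
    ... | lo | lo-bd = refl

    before-e₀ : cls k (suc d) ≡ e₀ → cls k d ≡ bd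
    before-e₀ e with cls k d | before e
    ... | bd | bd-e₀ = refl

    before-od : cls k (suc d) ≡ od → cls k d ≡ e₀ ⊎ cls k d ≡ ev
    before-od e with cls k d | before e
    ... | e₀ | e₀-od = inj₁ refl
    ... | ev | ev-od = inj₂ refl

    before-ev : cls k (suc d) ≡ ev → cls k d ≡ od
    before-ev e with cls k d | before e
    ... | od | od-ev = refl

  Range : ℕ → ℕ → Cls → Set
  Range k d lo = d ℕ.≤ k
  Range k d bd = d ≡ suc k
  Range k d e₀ = d ≡ suc (suc k)
  Range k d od = suc (suc k) ℕ.< d
  Range k d ev = suc (suc k) ℕ.< d

  range : ∀ k d → Range k d (cls k d)
  range (suc k) (suc d) with cls k d | range k d
  ... | lo | p = s≤s p
  ... | bd | p = cong suc p
  ... | e₀ | p = cong suc p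
  ... | od | p = s≤s p
  ... | ev | p = s≤s p
  range (suc k) zero = z≤n
  range zero 0 = z≤n
  range zero 1 = refl
  range zero 2 = refl
  range zero 3 = s≤s (s≤s (s≤s z≤n))
  range zero 4 = s≤s (s≤s (s≤s z≤n))
  range zero (suc (suc (suc (suc (suc d))))) with cls zero (suc (suc (suc d))) | range zero (suc (suc (suc d)))
  ... | od | p = s≤s (s≤s (s≤s z≤n))
  ... | ev | p = s≤s (s≤s (s≤s z≤n))

  fold : ℕ → ℕ → Cls → ℕ
  fold k d lo = d
  fold k d bd = suc k
  fold k d e₀ = suc (suc k)
  fold k d od = suc k
  fold k d ev = suc (suc k)

  fold≤ : ∀ k d → fold k d (cls k d) ℕ.≤ suc (suc k)
  fold≤ k d with cls k d | range k d
  ... | lo | p = ℕₚ.m≤n⇒m≤1+n (ℕₚ.m≤n⇒m≤1+n p)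
  ... | bd | p = ℕₚ.n≤1+n _
  ... | e₀ | p = ℕₚ.≤-refl
  ... | od | p = ℕₚ.n≤1+n _
  ... | ev | p = ℕₚ.≤-refl

  -- Folded generators land in degree `suc k` or above, so degree zero still consists of `★` alone.
  -- Here the target length `suc (suc k)` has to be at least two.
  fold-zero : ∀ k d → fold k d (cls k d) ≡ 0 → d ≡ 0
  fold-zero k d e with cls k d
  ... | lo = e

  fold-pos : ∀ k d → 1 ℕ.≤ fold k d (cls k d) → 1 ℕ.≤ d
  fold-pos k (suc d) _ = s≤s z≤n
  fold-pos k zero    p = ⊥-elim (ℕₚ.n≮n 0 (subst (λ c → 1 ℕ.≤ fold k 0 c) (cls-zero k) p))

  foldDeg : ℕ → ℕ → ℕ
  foldDeg k d = fold k d (cls k d)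

  foldDeg-suc : ∀ k {d d′} → cls k d ≡ lo → d′ ≡ suc d → foldDeg k d′ ≡ suc (foldDeg k d)
  foldDeg-suc k {d} e refl with after-lo {k} {d} e
  ... | inj₁ e′ = ≡.trans (cong (fold k (suc d)) e′) (≡.sym (cong (λ c → suc (fold k d c)) e))
  ... | inj₂ e′ = ≡.trans (cong (fold k (suc d)) e′)
                    (≡.trans (≡.sym (subst (Range k (suc d)) e′ (range k (suc d)))) (≡.sym (cong (λ c → suc (fold k d c)) e)))

  foldDeg-cls : ∀ k {d c} → cls k d ≡ c → foldDeg k d ≡ fold k d c
  foldDeg-cls k {d} e = cong (fold k d) e

  data High : Cls → Set where
    e₀ : High e₀
    ev : High ev

  foldDeg-high : ∀ k {d} → High (cls k d) → foldDeg k d ≡ suc (suc k)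
  foldDeg-high k {d} hi with cls k d | hi
  ... | _ | e₀ = refl
  ... | _ | ev = refl

  foldDeg-adjacent : ∀ k {d d′} → d′ ≡ suc d ⊎ d ≡ suc d′ → High (cls k d) → foldDeg k d ≡ suc (foldDeg k d′)
  foldDeg-adjacent k {d} {d′} adj hi = ≡.trans (foldDeg-high k hi) (cong suc (≡.sym (odd adj hi)))
    where
    odd : d′ ≡ suc d ⊎ d ≡ suc d′ → High (cls k d) → foldDeg k d′ ≡ suc k
    odd adj hi with cls k d in e | hi
    odd (inj₁ refl) hi | _ | e₀ = foldDeg-cls k (after-e₀ {k} e)
    odd (inj₁ refl) hi | _ | ev = foldDeg-cls k (after-ev {k} e)
    odd (inj₂ refl) hi | _ | e₀ = foldDeg-cls k (before-e₀ {k} e)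
    odd (inj₂ refl) hi | _ | ev = foldDeg-cls k (before-ev {k} e)

  od-high : ∀ k {d d′} → d′ ≡ suc d ⊎ d ≡ suc d′ → cls k d ≡ od → High (cls k d′)
  od-high k (inj₁ refl) e = subst High (≡.sym (after-od {k} e)) ev
  od-high k (inj₂ refl) e with before-od {k} e
  ... | inj₁ e′ = subst High (≡.sym e′) e₀
  ... | inj₂ e′ = subst High (≡.sym e′) ev

  high-bd : ∀ k {d d′} → cls k d ≡ bd → d′ ≡ suc d → High (cls k d′)
  high-bd k e refl = subst High (≡.sym (after-bd {k} e)) e₀

  -- A homotopy h with ∂h + h∂ = 1 above degree L = 2 + k makes the part of the complex above L split,
  -- so all of it can be folded into the degrees L and L - 1 (by parity), with differential ∂ + h there.
  module Truncate {L : ℕ} {U : Exp → Set} (F : LRes L U) (k : ℕ) where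
    open LRes F

    Hom : ℕ → Vect Gen → Set ℓ
    Hom d v = ∀ b → ¬ deg b ≡ d → v b ≈ 0#

    δ-Hom : ∀ c → Hom (deg c) (δ idx c)
    δ-Hom c b ¬d = δ-diff idx (λ c≡b → ¬d (cong deg (≡.sym c≡b)))

    lower-Hom : ∀ {Q A} → (∀ b c → Q b c → deg c ≡ suc (deg b)) → Local Q A → ∀ {d v} → Hom (suc d) v → Hom d (A · v)
    lower-Hom f l hv b ¬d = l _ b (λ c q → hv c (λ e → ¬d (ℕₚ.suc-injective (≡.trans (≡.sym (f b c q)) e))))

    raise-Hom : ∀ {Q A} → (∀ b c → Q b c → deg b ≡ suc (deg c)) → Local Q A → ∀ {d v} → Hom d v → Hom (suc d) (A · v)
    raise-Hom f l hv b ¬d = l _ b (λ c q → hv c (λ e → ¬d (≡.trans (f b c q) (cong suc e))))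

    ∂-Hom : ∀ {d v} → Hom (suc d) v → Hom d (∂ · v)
    ∂-Hom = lower-Hom {A = ∂} (λ _ _ → proj₁) ∂-local

    ∂-Hom₀ : ∀ {v} → Hom 0 v → ∂ · v ≋ 𝟘
    ∂-Hom₀ hv b = ∂-local _ b (λ c q → hv c (λ e → ℕₚ.0≢1+n (≡.trans (≡.sym e) (proj₁ q))))

    -- After folding, one new degree holds generators of many old degrees with different formulas;
    -- the old degree of the source selects the formula.
    byDeg : (ℕ → Op Gen Gen) → Op Gen Gen
    byDeg A = columns idx (λ c → A (deg c) · δ idx c)

    byDeg-Hom : ∀ A {d v} → Hom d v → byDeg A · v ≋ A d · v
    byDeg-Hom A {d} {v} hv x = ≈-trans (∑-cong (enum idx) term) (≈-sym (expand idx (A d) v x))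
      where
      term : ∀ c → v c * (A (deg c) · δ idx c) x ≈ v c * (A d · δ idx c) x
      term c with deg c ℕ.≟ d
      ... | yes refl = ≈-refl
      ... | no  c≢d  = ≈-trans (*-congʳ (hv c c≢d)) (≈-trans (zeroˡ _) (≈-sym (≈-trans (*-congʳ (hv c c≢d)) (zeroˡ _))))

    byDeg-local : ∀ {Q : Gen → Gen → Set} {A} (P : ℕ → Gen → Gen → Set) → (∀ d → Local (P d) (A d)) →
                  (∀ b c → P (deg c) b c → Q b c) → (∀ b c → Dec (Q b c)) → Local Q (byDeg A)
    byDeg-local P l f Q? = Local-columns idx Q? (λ b c ¬q → l (deg c) _ b
      (λ c′ p → δ-diff idx (λ { refl → ¬q (f b c p) })))

    deg′ : Gen → ℕ
    deg′ b = fold k (deg b) (cls k (deg b))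

    B : Basis
    B = record { Basis basis hiding (deg) ; deg = deg′ }

    module _ (h : Op Gen Gen) (h-local : Local (Raise _≼_) h)
             (h-htpy : ∀ {d v} → suc (suc k) ℕ.< d → Hom d v → ∂ · h · v ⊹ h · ∂ · v ≋ v) where

      h-Hom : ∀ {d v} → Hom d v → Hom (suc d) (h · v)
      h-Hom = raise-Hom {A = h} (λ _ _ → proj₁) h-local

      ∂h-Hom : ∀ {d v} → Hom d v → Hom d (∂ · h · v)
      ∂h-Hom hv = ∂-Hom (h-Hom hv)

      h∂-Hom : ∀ {d v} → Hom d v → Hom d (h · ∂ · v)
      h∂-Hom {zero}  hv b _ = ·-𝟘 h (∂-Hom₀ hv) b
      h∂-Hom {suc d} hv     = h-Hom (∂-Hom hv)

      -- Apply the homotopy to the cycle ∂ h v; its second term dies by `∂∂`.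
      ∂h∂h : ∀ {d v} → suc (suc k) ℕ.< d → Hom d v → ∂ · h · ∂ · h · v ≋ ∂ · h · v
      ∂h∂h {v = v} lt hv b = ≈-trans (≈-sym (+-identityʳ _))
        (≈-trans (+-congˡ (≈-sym (·-𝟘 h (∂∂ (h · v)) b))) (h-htpy lt (∂h-Hom hv) b))

      h∂h∂ : ∀ {d v} → suc (suc k) ℕ.< d → Hom d v → h · ∂ · h · ∂ · v ≋ h · ∂ · v
      h∂h∂ {v = v} lt hv b = begin
        (h · ∂ · h · ∂ · v) b
          ≈⟨ ≈-sym (+-identityˡ _) ⟩
        0# + (h · ∂ · h · ∂ · v) b
          ≈⟨ +-congʳ (≈-sym (·-𝟘 h (∂∂ (h · v)) b)) ⟩
        (h · ∂ · ∂ · h · v) b + (h · ∂ · h · ∂ · v) b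
          ≈⟨ ≈-sym (·-+ (h ∘ₒ ∂) (∂ · h · v) (h · ∂ · v) b) ⟩
        (h · ∂ · (∂ · h · v ⊹ h · ∂ · v)) b
          ≈⟨ ·-cong (h ∘ₒ ∂) (h-htpy lt hv) b ⟩
        (h · ∂ · v) b ∎

      -- Replacing h by h∂h makes its square vanish.
      h₁ : Op Gen Gen
      h₁ = h ∘ₒ ∂ ∘ₒ h

      h₁-Hom : ∀ {d v} → Hom d v → Hom (suc d) (h₁ · v)
      h₁-Hom hv = h-Hom (∂h-Hom hv)

      h₁-htpy : ∀ {d v} → suc (suc k) ℕ.< d → Hom d v → ∂ · h₁ · v ⊹ h₁ · ∂ · v ≋ v
      h₁-htpy lt hv b = ≈-trans (+-cong (∂h∂h lt hv b) (h∂h∂ lt hv b)) (h-htpy lt hv b)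

      -- The middle of h₁ h₁ is ∂ h h ∂, applied to w = h v. By the homotopy at h ∂ w it equals h ∂
      -- w - h ∂ h ∂ w, and h ∂ is idempotent in that degree. Since `w` lies one degree above `v`,
      -- degree L is already high enough.
      h₁h₁ : ∀ {d v} → suc (suc k) ℕ.≤ d → Hom d v → h₁ · h₁ · v ≋ 𝟘
      h₁h₁ {d} {v} le hv = ·-𝟘 h (λ b → begin
        (∂ · h · h · ∂ · w) b
          ≈⟨ solve 2 (λ x y → x := (x :+ y) :+ :- y) ≈-refl _ _ ⟩
        ((∂ · h · h · ∂ · w) b + (h · ∂ · h · ∂ · w) b) + - (h · ∂ · h · ∂ · w) b
          ≈⟨ +-cong (h-htpy (s≤s le) (h∂-Hom hw) b) (-‿cong (h∂h∂ (s≤s le) hw b)) ⟩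
        (h · ∂ · w) b + - (h · ∂ · w) b
          ≈⟨ -‿inverseʳ _ ⟩
        0# ∎)
        where
        w = h · v
        hw : Hom (suc d) w
        hw = h-Hom hv

      ∂h₁∂ : ∀ {d v} → suc (suc k) ℕ.< d → Hom d v → ∂ · h₁ · ∂ · v ≋ ∂ · v
      ∂h₁∂ {v = v} lt hv b = begin
        (∂ · h₁ · ∂ · v) b
          ≈⟨ ≈-sym (+-identityˡ _) ⟩
        0# + (∂ · h₁ · ∂ · v) b
          ≈⟨ +-congʳ (≈-sym (∂∂ (h₁ · v) b)) ⟩
        (∂ · ∂ · h₁ · v) b + (∂ · h₁ · ∂ · v) b
          ≈⟨ ≈-sym (·-+ ∂ (∂ · h₁ · v) (h₁ · ∂ · v) b) ⟩
        (∂ · (∂ · h₁ · v ⊹ h₁ · ∂ · v)) b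
          ≈⟨ ·-cong ∂ (h₁-htpy lt hv) b ⟩
        (∂ · v) b ∎

      T : Op Gen Gen
      T = ∂ +ₒ h₁

      -- Both squares vanish and the mixed terms are the homotopy: above degree L the map `T` is its
      -- own inverse.
      TT : ∀ {d v} → suc (suc k) ℕ.< d → Hom d v → T · T · v ≋ v
      TT {v = v} lt hv b = begin
        (∂ · T · v) b + (h₁ · T · v) b
          ≈⟨ +-cong (·-+ ∂ _ _ b) (·-+ h₁ _ _ b) ⟩
        ((∂ · ∂ · v) b + (∂ · h₁ · v) b) + ((h₁ · ∂ · v) b + (h₁ · h₁ · v) b)
          ≈⟨ +-cong (+-congʳ (∂∂ v b)) (+-congˡ (h₁h₁ (ℕₚ.<⇒≤ lt) hv b)) ⟩
        (0# + (∂ · h₁ · v) b) + ((h₁ · ∂ · v) b + 0#)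
          ≈⟨ +-cong (+-identityˡ _) (+-identityʳ _) ⟩
        (∂ · h₁ · v) b + (h₁ · ∂ · v) b
          ≈⟨ h₁-htpy lt hv b ⟩
        v b ∎

      -- `T` acts on the new top degree, made of degree L and the even part. The odd part, folded
      -- into degree L - 1, is sent to zero, so that the values of h₁ in it do not disturb D D = 0.
      actD : Cls → Op Gen Gen
      actD lo = ∂
      actD bd = ∂
      actD e₀ = T
      actD od = 𝟘ₒ
      actD ev = T

      D : Op Gen Gen
      D = byDeg (λ d → actD (cls k d))

      D-Hom : ∀ {c d v} → cls k d ≡ c → Hom d v → D · v ≋ actD c · v
      D-Hom refl hv = byDeg-Hom (λ d → actD (cls k d)) hv

      T-od : ∀ {d v} → cls k d ≡ ev → Hom d v → D · T · v ≋ 𝟘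
      T-od {suc d} {v} e hv b = ≈-trans (·-+ D _ _ b) (≈-trans (+-cong (D-Hom prev (∂-Hom hv) b) (D-Hom next (h₁-Hom hv) b)) (+-identityʳ 0#))
        where
        prev : cls k d ≡ od
        prev = before-ev {k} e
        next : cls k (suc (suc d)) ≡ od
        next = after-ev {k} e
      T-od {zero} e hv with ≡.trans (≡.sym e) (cls-zero k)
      ... | ()

      DD-Hom : ∀ {d v} → Hom d v → D · D · v ≋ 𝟘
      DD-Hom {zero} {v} hv = ·-𝟘 D (λ b → ≈-trans (D-Hom (cls-zero k) hv b) (∂-Hom₀ hv b))
      DD-Hom {suc d} {v} hv x with cls k (suc d) in e
      ... | od = ·-𝟘 D (D-Hom e hv) x
      ... | ev = ≈-trans (·-cong D (D-Hom e hv) x) (T-od e hv x)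
      ... | lo = ≈-trans (·-cong D (D-Hom e hv) x) (≈-trans (D-Hom prev (∂-Hom hv) x) (∂∂ v x))
        where
        prev : cls k d ≡ lo
        prev = before-lo {k} e
      ... | bd = ≈-trans (·-cong D (D-Hom e hv) x) (≈-trans (D-Hom prev (∂-Hom hv) x) (∂∂ v x))
        where
        prev : cls k d ≡ lo
        prev = before-bd {k} e
      ... | e₀ = ≈-trans (·-cong D (D-Hom e hv) x) (≈-trans (·-+ D _ _ x)
                   (≈-trans (+-cong (≈-trans (D-Hom prev (∂-Hom hv) x) (∂∂ v x)) (D-Hom next (h₁-Hom hv) x)) (+-identityʳ 0#)))
        where
        prev : cls k d ≡ bd
        prev = before-e₀ {k} e
        next : cls k (suc (suc d)) ≡ od
        next = after-e₀ {k} e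

      DD : ∀ v → D · D · v ≋ 𝟘
      DD v = agree idx (D ∘ₒ D) 𝟘ₒ v (λ c → inj₂ (DD-Hom (δ-Hom c)))

      module _ {α} (u : U α) where

        s-Hom : ∀ {d v} → Hom d v → Hom (suc d) (s u · v)
        s-Hom = raise-Hom {A = s u} (λ _ _ → proj₁) (s-local u)

        -- Nothing lies above the new top degree, hence zero there. On the odd part `T` undoes `T`.
        -- In degree L - 1, `s u` alone would leave the summand h₁ s v in the odd part; `T` takes
        -- the correction ∂ h₁ s v to exactly that summand.
        actS : Cls → Op Gen Gen
        actS lo = s u
        actS bd = s u -ₒ ∂ ∘ₒ h₁ ∘ₒ s u
        actS e₀ = 𝟘ₒ
        actS od = T
        actS ev = 𝟘ₒ

        S : Op Gen Gen
        S = byDeg (λ d → actS (cls k d))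

        S-Hom : ∀ {c d v} → cls k d ≡ c → Hom d v → S · v ≋ actS c · v
        S-Hom refl hv = byDeg-Hom (λ d → actS (cls k d)) hv

        S∂-lo : ∀ {d v} → cls k d ≡ lo ⊎ cls k d ≡ bd → Hom d v → S · ∂ · v ≋ s u · ∂ · v
        S∂-lo {zero} e hv b = ≈-trans (·-𝟘 S (∂-Hom₀ hv) b) (≈-sym (·-𝟘 (s u) (∂-Hom₀ hv) b))
        S∂-lo {suc d} e hv = S-Hom (prev e) (∂-Hom hv)
          where
          prev : cls k (suc d) ≡ lo ⊎ cls k (suc d) ≡ bd → cls k d ≡ lo
          prev (inj₁ e) = before-lo {k} e
          prev (inj₂ e) = before-bd {k} e

        htpy-Hom : ∀ {d v} → Hom d v → Supp α v → D · S · v ⊹ S · D · v ≋ v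
        htpy-Hom {d} {v} hv sv x with cls k d in e | range k d
        ... | lo | _ = begin
          (D · S · v) x + (S · D · v) x
            ≈⟨ +-cong (·-cong D (S-Hom e hv) x) (·-cong S (D-Hom e hv) x) ⟩
          (D · s u · v) x + (S · ∂ · v) x
            ≈⟨ +-cong (next x) (S∂-lo (inj₁ e) hv x) ⟩
          (∂ · s u · v) x + (s u · ∂ · v) x
            ≈⟨ s-htpy u sv x ⟩
          v x ∎
          where
          next : D · s u · v ≋ ∂ · s u · v
          next with after-lo {k} e
          ... | inj₁ e′ = D-Hom e′ (s-Hom hv)
          ... | inj₂ e′ = D-Hom e′ (s-Hom hv)
        ... | bd | refl = begin
          (D · S · v) x + (S · D · v) x
            ≈⟨ +-cong (·-cong D (λ b → ≈-trans (S-Hom e hv b) (-ₒ-· (s u) (∂ ∘ₒ h₁ ∘ₒ s u) v b)) x) (·-cong S (D-Hom e hv) x) ⟩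
          (D · (y ⊹ ⊟ (∂ · h₁ · y))) x + (S · ∂ · v) x
            ≈⟨ +-cong (≈-trans (·-+ D _ _ x) (+-congˡ (·-⊟ D _ x))) (S∂-lo (inj₂ e) hv x) ⟩
          ((D · y) x + - (D · ∂ · h₁ · y) x) + (s u · ∂ · v) x
            ≈⟨ +-congʳ (+-cong (D-Hom next hy x) (-‿cong (D-Hom next (∂-Hom (h₁-Hom hy)) x))) ⟩
          (((∂ · y) x + (h₁ · y) x) + - ((∂ · ∂ · h₁ · y) x + (h₁ · ∂ · h₁ · y) x)) + (s u · ∂ · v) x
            ≈⟨ +-congʳ (+-congˡ (-‿cong (≈-trans (+-cong (∂∂ _ x) fix) (+-identityˡ _)))) ⟩
          (((∂ · y) x + (h₁ · y) x) + - (h₁ · y) x) + (s u · ∂ · v) x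
            ≈⟨ +-congʳ (solve 2 (λ a c → (a :+ c) :+ :- c := a) ≈-refl _ _) ⟩
          (∂ · y) x + (s u · ∂ · v) x
            ≈⟨ s-htpy u sv x ⟩
          v x ∎
          where
          y = s u · v
          hy : Hom (suc d) y
          hy = s-Hom hv
          next : cls k (suc d) ≡ e₀
          next = after-bd {k} e
          fix : (h₁ · ∂ · h₁ · y) x ≈ (h₁ · y) x
          fix = ≈-trans (≈-sym (+-identityˡ _)) (≈-trans (+-congʳ (≈-sym (·-𝟘 ∂ (h₁h₁ ℕₚ.≤-refl hy) x)))
                  (h₁-htpy ℕₚ.≤-refl (h₁-Hom hy) x))
        ... | e₀ | refl = begin
          (D · S · v) x + (S · D · v) x
            ≈⟨ +-cong (·-𝟘 D (S-Hom e hv) x) (≈-trans (·-cong S (D-Hom e hv) x) (·-+ S _ _ x)) ⟩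
          0# + ((S · ∂ · v) x + (S · h₁ · v) x)
            ≈⟨ ≈-trans (+-identityˡ _) (+-cong (≈-trans (S-Hom prev (∂-Hom hv) x) (-ₒ-· (s u) (∂ ∘ₒ h₁ ∘ₒ s u) (∂ · v) x))
                 (S-Hom next (h₁-Hom hv) x)) ⟩
          ((s u · ∂ · v) x + - (∂ · h₁ · s u · ∂ · v) x) + ((∂ · h₁ · v) x + (h₁ · h₁ · v) x)
            ≈⟨ +-cong (+-congˡ (-‿cong ∂h₁s∂)) (+-congˡ (h₁h₁ ℕₚ.≤-refl hv x)) ⟩
          ((s u · ∂ · v) x + - ((∂ · h₁ · v) x + - (∂ · y) x)) + ((∂ · h₁ · v) x + 0#)
            ≈⟨ solve 4 (λ a p q o → (a :+ :- (p :+ :- q)) :+ (p :+ o) := (q :+ a) :+ o) ≈-refl _ _ _ 0# ⟩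
          ((∂ · y) x + (s u · ∂ · v) x) + 0#
            ≈⟨ ≈-trans (+-identityʳ _) (s-htpy u sv x) ⟩
          v x ∎
          where
          y = s u · v
          hy : Hom (suc d) y
          hy = s-Hom hv
          prev : cls k (suc k) ≡ bd
          prev = before-e₀ {k} e
          next : cls k (suc d) ≡ od
          next = after-e₀ {k} e
          s∂ : s u · ∂ · v ≋ v ⊹ ⊟ (∂ · y)
          s∂ b = ≈-trans (solve 2 (λ a c → a := (c :+ a) :+ :- c) ≈-refl _ _) (+-congʳ (s-htpy u sv b))
          -- Replace s ∂ by 1 - ∂ s; then `∂h₁∂` applies to s v, which has degree L + 1.
          ∂h₁s∂ : (∂ · h₁ · s u · ∂ · v) x ≈ (∂ · h₁ · v) x + - (∂ · y) x
          ∂h₁s∂ = ≈-trans (·-cong (∂ ∘ₒ h₁) s∂ x) (≈-trans (·-+ (∂ ∘ₒ h₁) _ _ x)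
                    (+-congˡ (≈-trans (·-⊟ (∂ ∘ₒ h₁) _ x) (-‿cong (∂h₁∂ ℕₚ.≤-refl hy x)))))
        ... | od | lt = begin
          (D · S · v) x + (S · D · v) x
            ≈⟨ +-cong (≈-trans (·-cong D (S-Hom e hv) x) (·-+ D _ _ x)) (·-𝟘 S (D-Hom e hv) x) ⟩
          ((D · ∂ · v) x + (D · h₁ · v) x) + 0#
            ≈⟨ ≈-trans (+-identityʳ _) (+-cong (below {d} e hv x) (D-Hom next (h₁-Hom hv) x)) ⟩
          (T · ∂ · v) x + (T · h₁ · v) x
            ≈⟨ ≈-sym (·-+ T _ _ x) ⟩
          (T · T · v) x
            ≈⟨ TT lt hv x ⟩
          v x ∎
          where
          next : cls k (suc d) ≡ ev
          next = after-od {k} e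
          below : ∀ {d} → cls k d ≡ od → Hom d v → D · ∂ · v ≋ T · ∂ · v
          below {zero} e hv with ≡.trans (≡.sym e) (cls-zero k)
          ... | ()
          below {suc d} e hv with before-od {k} e
          ... | inj₁ e′ = D-Hom e′ (∂-Hom hv)
          ... | inj₂ e′ = D-Hom e′ (∂-Hom hv)
        ... | ev | lt = begin
          (D · S · v) x + (S · D · v) x
            ≈⟨ +-cong (·-𝟘 D (S-Hom e hv) x) (≈-trans (·-cong S (D-Hom e hv) x) (·-+ S _ _ x)) ⟩
          0# + ((S · ∂ · v) x + (S · h₁ · v) x)
            ≈⟨ ≈-trans (+-identityˡ _) (+-cong (below {d} e hv x) (S-Hom next (h₁-Hom hv) x)) ⟩
          (T · ∂ · v) x + (T · h₁ · v) x
            ≈⟨ ≈-sym (·-+ T _ _ x) ⟩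
          (T · T · v) x
            ≈⟨ TT lt hv x ⟩
          v x ∎
          where
          next : cls k (suc d) ≡ od
          next = after-ev {k} e
          below : ∀ {d} → cls k d ≡ ev → Hom d v → S · ∂ · v ≋ T · ∂ · v
          below {zero} e hv with ≡.trans (≡.sym e) (cls-zero k)
          ... | ()
          below {suc d} e hv = S-Hom (before-ev {k} e) (∂-Hom hv)

        S-htpy : ∀ {v} → Supp α v → D · S · v ⊹ S · D · v ≋ v
        S-htpy {v} sv = agree idx (D ∘ₒ S +ₒ S ∘ₒ D) idₒ v pick
          where
          pick : ∀ c → (v c ≈ 0#) ⊎ (D · S · δ idx c ⊹ S · D · δ idx c ≋ δ idx c)
          pick c with c ⊑? α
          ... | no ¬c  = inj₁ (sv c ¬c)
          ... | yes c⊑ = inj₂ (htpy-Hom (δ-Hom c) (λ b ¬b → δ-diff idx (λ { refl → ¬b c⊑ })))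

      Adjacent : Gen → Gen → Set
      Adjacent b c = (deg b ≡ suc (deg c) ⊎ deg c ≡ suc (deg b)) × b ≼ c

      h₁-local : Local (Raise _≼_) h₁
      h₁-local = Local-∘ {A = h} {A′ = ∂ ∘ₒ h}
        (λ b c d (p , f) (q , g) → ≡.trans p (cong suc q) , ≼-trans f g) h-local
        (Local-∘ {T = λ b c → deg b ≡ deg c × b ≼ c} {A = ∂} {A′ = h}
          (λ b c d (p , f) (q , g) → ℕₚ.suc-injective (≡.trans (≡.sym p) q) , ≼-trans f g) ∂-local h-local)

      T-local : Local Adjacent T
      T-local = Local-+ {A = ∂} {A′ = h₁}
        (Local-⊆ {A = ∂} (λ b c (p , f) → inj₂ p , f) ∂-local)
        (Local-⊆ {A = h₁} (λ b c (p , f) → inj₁ p , f) h₁-local)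

      open Basis B using () renaming (Lower to Lower′; Raise to Raise′)

      D-local : Local Lower′ D
      D-local = byDeg-local {A = λ d → actD (cls k d)} (λ d → Rel (cls k d)) (λ d → loc (cls k d)) f
        (λ b c → (deg′ c ℕ.≟ suc (deg′ b)) ×-dec (b ≼? c))
        where
        Rel : Cls → Gen → Gen → Set
        Rel lo = Lower
        Rel bd = Lower
        Rel e₀ = Adjacent
        Rel od = λ _ _ → ⊥
        Rel ev = Adjacent
        loc : ∀ c → Local (Rel c) (actD c)
        loc lo = ∂-local
        loc bd = ∂-local
        loc e₀ = T-local
        loc od = λ _ _ _ → ≈-refl
        loc ev = T-local
        f : ∀ b c → Rel (cls k (deg c)) b c → Lower′ b c
        f b c r with cls k (deg c) in e | r
        ... | lo | p , o = ≡.trans (≡.sym (foldDeg-cls k e))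
                             (foldDeg-suc k (before-lo {k} (≡.trans (cong (cls k) (≡.sym p)) e)) p) , o
        ... | bd | p , o = ≡.trans (≡.sym (foldDeg-cls k e))
                             (foldDeg-suc k (before-bd {k} (≡.trans (cong (cls k) (≡.sym p)) e)) p) , o
        ... | e₀ | p , o = ≡.trans (≡.sym (foldDeg-cls k e)) (foldDeg-adjacent k p (subst High (≡.sym e) e₀)) , o
        ... | ev | p , o = ≡.trans (≡.sym (foldDeg-cls k e)) (foldDeg-adjacent k p (subst High (≡.sym e) ev)) , o

      S-local : ∀ {α} (u : U α) → Local (Raise′ _⊑ᶜ[ α ]_) (S u)
      S-local {α} u = byDeg-local {A = λ d → actS u (cls k d)} (λ d → Rel (cls k d)) (λ d → loc (cls k d)) f
        (λ b c → (deg′ b ℕ.≟ suc (deg′ c)) ×-dec ((c ⊑? α) →-dec (b ⊑? α)))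
        where
        Rel : Cls → Gen → Gen → Set
        Rel lo = Raise _⊑ᶜ[ α ]_
        Rel bd = Raise _⊑ᶜ[ α ]_
        Rel e₀ = λ _ _ → ⊥
        Rel od = Adjacent
        Rel ev = λ _ _ → ⊥
        loc : ∀ c → Local (Rel c) (actS u c)
        loc lo = s-local u
        loc bd = Local-+ {A = s u} {A′ = negₒ (∂ ∘ₒ h₁ ∘ₒ s u)} (s-local u) (Local-scale _ {A = ∂ ∘ₒ h₁ ∘ₒ s u}
          (Local-∘ {A = ∂} {A′ = h₁ ∘ₒ s u}
            (λ b c d (p , f) (q , g) → ℕₚ.suc-injective (≡.trans (≡.sym p) q) , λ x → ≼-⊑ f (g x)) ∂-local
            (Local-∘ {T = λ b c → deg b ≡ suc (suc (deg c)) × b ⊑ᶜ[ α ] c} {A = h₁} {A′ = s u}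
              (λ b c d (p , f) (q , g) → ≡.trans p (cong suc q) , λ x → ≼-⊑ f (g x)) h₁-local (s-local u))))
        loc e₀ = λ _ _ _ → ≈-refl
        loc od = T-local
        loc ev = λ _ _ _ → ≈-refl
        f : ∀ b c → Rel (cls k (deg c)) b c → Raise′ _⊑ᶜ[ α ]_ b c
        f b c r with cls k (deg c) in e | r
        ... | lo | p , o = ≡.trans (foldDeg-suc k e p) (cong suc (foldDeg-cls k e)) , o
        ... | bd | p , o = ≡.trans (foldDeg-adjacent k (inj₂ p) (high-bd k e p)) (cong suc (foldDeg-cls k e)) , o
        ... | od | p , o = ≡.trans (foldDeg-adjacent k (flip p) (od-high k p e)) (cong suc (foldDeg-cls k e)) , ≼-⊑ o
          where
          flip : ∀ {i j : ℕ} → i ≡ suc j ⊎ j ≡ suc i → j ≡ suc i ⊎ i ≡ suc j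
          flip (inj₁ x) = inj₂ x
          flip (inj₂ x) = inj₁ x

      truncated : LRes (suc (suc k)) U
      truncated = record
        { basis = B
        ; ★ = ★
        ; deg-★ = ≡.trans (cong (foldDeg k) deg-★) (foldDeg-cls k (cls-zero k))
        ; lab-★ = lab-★
        ; act-★ = act-★
        ; ★-unique = λ b a d → ★-unique b a (fold-zero k (deg b) d)
        ; bounded = λ b _ → fold≤ k (deg b)
        ; support = λ b p d → support b p (fold-pos k (deg b) d)
        ; ∂ = D ; ∂-local = D-local ; ∂∂ = DD
        ; s = S ; s-local = S-local ; s-htpy = S-htpy }

-- Comparison of resolutions

module Comparison {r ℓ : Level} (R : CommutativeRing r ℓ) where
  open CommutativeRing R hiding (zero) renaming (refl to ≈-refl; sym to ≈-sym; trans to ≈-trans)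
  open import Relation.Binary.Reasoning.Setoid setoid
  open LinearAlgebra R
  open IntegerSolver R

  -- `rank 0` belongs to the ambient free module, so the resolved module is the image of `d 0`, and
  -- no exactness is asked at index 0. Exactness provides actual preimages, from which maps can be
  -- built.
  record ExactSeq : Set (r ⊔ ℓ) where
    field
      rank    : ℕ → ℕ
      d       : ∀ i → Op (Fin (rank (suc i))) (Fin (rank i))
      complex : ∀ i v → d i · d (suc i) · v ≋ 𝟘
      exact   : ∀ i v → d i · v ≋ 𝟘 → Σ (Vect _) (λ w → d (suc i) · w ≋ v)

  -- Preimages need not depend linearly on their arguments: only those of the basis vectors are
  -- used, and extended linearly.
  lift-columns : ∀ {a b c} (D : Op (Fin b) (Fin c)) (X : Op (Fin a) (Fin c)) →
                 (∀ x → Σ (Vect (Fin b)) (λ y → D · y ≋ X · x)) →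
                 Σ (Op (Fin a) (Fin b)) (λ Y → ∀ x → D · Y · x ≋ X · x)
  lift-columns {a} {b} D X pre = Y , λ x → agree I (D ∘ₒ Y) X x (λ j → inj₂ (λ c →
      ≈-trans (·-cong D (columns-δ I (λ j → proj₁ (pre (δ I j))) j) c) (proj₂ (pre (δ I j)) c)))
    where
    I = finIndex a
    Y : Op (Fin a) (Fin b)
    Y = columns I (λ j → proj₁ (pre (δ I j)))

  module _ (E F : ExactSeq) where
    private
      module E = ExactSeq E
      module F = ExactSeq F

    -- `f` and `g` compare the two resolutions, and `h` is the homotopy between g f and the
    -- identity. The other fields keep just what one more step needs: both maps after a differential
    -- can be lifted, and the homotopy relation holds on the image of `E.d i`.
    record Stage (i : ℕ) : Set (r ⊔ ℓ) where
      field
        f     : Op (Fin (E.rank i)) (Fin (F.rank i))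
        g     : Op (Fin (F.rank i)) (Fin (E.rank i))
        h     : Op (Fin (E.rank i)) (Fin (E.rank (suc i)))
        f-lift : ∀ x → Σ (Vect _) (λ y → F.d i · y ≋ f · E.d i · x)
        g-lift : ∀ y → Σ (Vect _) (λ x → E.d i · x ≋ g · F.d i · y)
        h-htpy : ∀ x → E.d i · h · E.d i · x ⊹ g · f · E.d i · x ≋ E.d i · x

    module Next {i : ℕ} (S : Stage i) where
      open Stage S

      f′ : Σ (Op _ _) (λ Y → ∀ x → F.d i · Y · x ≋ f · E.d i · x)
      f′ = lift-columns (F.d i) (f ∘ₒ E.d i) f-lift

      g′ : Σ (Op _ _) (λ Y → ∀ y → E.d i · Y · y ≋ g · F.d i · y)
      g′ = lift-columns (E.d i) (g ∘ₒ F.d i) g-lift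

      -- What the next homotopy has to bound. It is a cycle because of the homotopy relation one
      -- degree lower.
      defect : Op (Fin (E.rank (suc i))) (Fin (E.rank (suc i)))
      defect = idₒ -ₒ (proj₁ g′ ∘ₒ proj₁ f′ +ₒ h ∘ₒ E.d i)

      defect-cycle : ∀ x → E.d i · defect · x ≋ 𝟘
      defect-cycle x c = begin
        (E.d i · defect · x) c
          ≈⟨ ·-cong (E.d i) (-ₒ-· idₒ (proj₁ g′ ∘ₒ proj₁ f′ +ₒ h ∘ₒ E.d i) x) c ⟩
        (E.d i · (x ⊹ ⊟ (proj₁ g′ · proj₁ f′ · x ⊹ h · E.d i · x))) c
          ≈⟨ ≈-trans (·-+ (E.d i) _ _ c) (+-congˡ (≈-trans (·-⊟ (E.d i) _ c) (-‿cong (·-+ (E.d i) _ _ c)))) ⟩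
        (E.d i · x) c + - ((E.d i · proj₁ g′ · proj₁ f′ · x) c + (E.d i · h · E.d i · x) c)
          ≈⟨ +-congˡ (-‿cong (≈-trans (+-congʳ (≈-trans (proj₂ g′ _ c) (·-cong g (proj₂ f′ x) c)))
               (≈-trans (+-comm _ _) (h-htpy x c)))) ⟩
        (E.d i · x) c + - (E.d i · x) c
          ≈⟨ -‿inverseʳ _ ⟩
        0# ∎

      h′ : Σ (Op _ _) (λ Y → ∀ x → E.d (suc i) · Y · x ≋ defect · x)
      h′ = lift-columns (E.d (suc i)) defect (λ x → E.exact i _ (defect-cycle x))

      homotopy : ∀ x → (E.d (suc i) · proj₁ h′ · x ⊹ h · E.d i · x) ⊹ proj₁ g′ · proj₁ f′ · x ≋ x
      homotopy x c = ≈-trans (+-congʳ (+-congʳ (≈-trans (proj₂ h′ x c) (-ₒ-· idₒ (proj₁ g′ ∘ₒ proj₁ f′ +ₒ h ∘ₒ E.d i) x c))))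
        (solve 3 (λ x a b → ((x :+ :- (a :+ b)) :+ b) :+ a := x) ≈-refl _ _ _)

      next : Stage (suc i)
      next = record
        { f = proj₁ f′ ; g = proj₁ g′ ; h = proj₁ h′
        ; f-lift = λ x → F.exact i _ (λ c → ≈-trans (proj₂ f′ _ c) (·-𝟘 f (E.complex i x) c))
        ; g-lift = λ y → E.exact i _ (λ c → ≈-trans (proj₂ g′ _ c) (·-𝟘 g (F.complex i y) c))
        ; h-htpy = λ x c → ≈-trans
            (≈-sym (≈-trans (+-congʳ (+-congˡ (·-𝟘 h (E.complex i x) c))) (+-congʳ (+-identityʳ _))))
            (homotopy (E.d (suc i) · x) c) }

    module _ (S₀ : Stage 0) where

      stage : ∀ i → Stage i
      stage zero    = S₀
      stage (suc i) = Next.next (stage i)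

      contraction : ∀ i → Op (Fin (E.rank i)) (Fin (E.rank (suc i)))
      contraction i = Stage.h (stage i)

      -- Where `F` has rank zero, g f factors through zero, and a homotopy between g f and the
      -- identity is a contraction.
      contraction-htpy : ∀ i → ¬ Fin (F.rank (suc i)) → ∀ x →
                         E.d (suc i) · contraction (suc i) · x ⊹ contraction i · E.d i · x ≋ x
      contraction-htpy i empty x c = ≈-trans (≈-sym (≈-trans
          (+-congˡ (·-𝟘 (Stage.g (stage (suc i))) (λ b → ⊥-elim (empty b)) c)) (+-identityʳ _)))
        (Next.homotopy (stage i) x c)

-- Polynomials

module PolynomialRing {c ℓ : Level} (K : Field c ℓ) (n : ℕ) where
  open Poly K n
  open Field K hiding (zero) renaming (refl to ≈-refl; sym to ≈-sym; trans to ≈-trans)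
  open import Relation.Binary.Reasoning.Setoid setoid
  open import Algebra.Properties.Ring ring using (-‿distribˡ-*; -0#≈0#)
  open import Algebra.Properties.CommutativeSemigroup *-commutativeSemigroup using (x∙yz≈y∙xz)
  open LinearAlgebra commutativeRing
  open IntegerSolver commutativeRing
  open Exponents n

  -- The linear extension of a function on monomials, evaluated at a polynomial; `coeff` is the case
  -- of an indicator function.
  ⟨_,_⟩ : Pol → (Exp → Carrier) → Carrier
  ⟨ p , φ ⟩ = ∑ p (λ (a , f) → a * φ f)

  ⟨⟩-cong : ∀ p {φ ψ} → (∀ f → φ f ≈ ψ f) → ⟨ p , φ ⟩ ≈ ⟨ p , ψ ⟩
  ⟨⟩-cong p e = ∑-cong p (λ (a , f) → *-congˡ (e f))

  ⟨⟩-zero : ∀ p {φ} → (∀ f → φ f ≈ 0#) → ⟨ p , φ ⟩ ≈ 0#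
  ⟨⟩-zero p e = ∑-zero p (λ (a , f) → ≈-trans (*-congˡ (e f)) (zeroʳ a))

  ⟨⟩-* : ∀ p a φ → ⟨ p , (λ f → a * φ f) ⟩ ≈ a * ⟨ p , φ ⟩
  ⟨⟩-* p a φ = ≈-trans (∑-cong p (λ (b , f) → x∙yz≈y∙xz b a (φ f))) (∑-*ˡ p a _)

  ⟨⟩-swap : ∀ p q (φ : Exp → Exp → Carrier) →
            ⟨ p , (λ f → ⟨ q , φ f ⟩) ⟩ ≈ ⟨ q , (λ g → ⟨ p , (λ f → φ f g) ⟩) ⟩
  ⟨⟩-swap p q φ = begin
    ∑ p (λ (a , f) → a * ∑ q (λ (b , g) → b * φ f g))
      ≈⟨ ∑-cong p (λ (a , f) → ≈-sym (∑-*ˡ q a _)) ⟩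
    ∑ p (λ (a , f) → ∑ q (λ (b , g) → a * (b * φ f g)))
      ≈⟨ ∑-swap p q (λ (a , f) (b , g) → a * (b * φ f g)) ⟩
    ∑ q (λ (b , g) → ∑ p (λ (a , f) → a * (b * φ f g)))
      ≈⟨ ∑-cong q (λ (b , g) → ⟨⟩-* p b (λ f → φ f g)) ⟩
    ∑ q (λ (b , g) → b * ∑ p (λ (a , f) → a * φ f g)) ∎

  coeff-⟨⟩ : ∀ p e → coeff p e ≈ ⟨ p , (λ f → bool (f ≟ₑ e)) ⟩
  coeff-⟨⟩ []            e = ≈-refl
  coeff-⟨⟩ ((a , f) ∷ p) e with f ≟ₑ e
  ... | yes _ = +-cong (≈-sym (*-identityʳ a)) (coeff-⟨⟩ p e)
  ... | no  _ = ≈-trans (coeff-⟨⟩ p e) (≈-sym (≈-trans (+-congʳ (zeroʳ a)) (+-identityˡ _)))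

  remove : Exp → Pol → Pol
  remove e []            = []
  remove e ((a , f) ∷ p) with f ≟ₑ e
  ... | yes _ = remove e p
  ... | no  _ = (a , f) ∷ remove e p

  remove-length : ∀ e p → length (remove e p) ℕ.≤ length p
  remove-length e []            = z≤n
  remove-length e ((a , f) ∷ p) with f ≟ₑ e
  ... | yes _ = ℕₚ.m≤n⇒m≤1+n (remove-length e p)
  ... | no  _ = s≤s (remove-length e p)

  remove-⟨⟩ : ∀ e p φ → ⟨ p , φ ⟩ ≈ coeff p e * φ e + ⟨ remove e p , φ ⟩
  remove-⟨⟩ e []            φ = ≈-sym (≈-trans (+-identityʳ _) (zeroˡ _))
  remove-⟨⟩ e ((a , f) ∷ p) φ with f ≟ₑ e
  ... | yes refl = ≈-trans (+-congˡ (remove-⟨⟩ e p φ)) (≈-trans (≈-sym (+-assoc _ _ _)) (+-congʳ (≈-sym (distribʳ _ _ _))))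
  ... | no  _    = ≈-trans (+-congˡ (remove-⟨⟩ e p φ))
                     (solve 3 (λ x y z → x :+ (y :+ z) := y :+ (x :+ z)) ≈-refl _ _ _)

  remove-same : ∀ e p → coeff (remove e p) e ≈ 0#
  remove-same e []            = ≈-refl
  remove-same e ((a , f) ∷ p) with f ≟ₑ e
  ... | yes _ = remove-same e p
  ... | no f≢e with f ≟ₑ e
  ...   | yes f≡e = ⊥-elim (f≢e f≡e)
  ...   | no _    = remove-same e p

  remove-other : ∀ e p e′ → ¬ e ≡ e′ → coeff (remove e p) e′ ≈ coeff p e′
  remove-other e []            e′ ne = ≈-refl
  remove-other e ((a , f) ∷ p) e′ ne with f ≟ₑ e
  remove-other e ((a , f) ∷ p) e′ ne | yes refl with f ≟ₑ e′
  ... | yes f≡e′ = ⊥-elim (ne f≡e′)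
  ... | no _     = remove-other e p e′ ne
  remove-other e ((a , f) ∷ p) e′ ne | no _ with f ≟ₑ e′
  ... | yes _ = +-congˡ (remove-other e p e′ ne)
  ... | no _  = remove-other e p e′ ne

  -- An exponent may occur several times, with coefficients that cancel only in total. All its
  -- occurrences are gathered into `coeff p e` and removed at once; `m` bounds the shrinking length,
  -- since the recursion is not structural in `p`.
  ⟨⟩-vanish : ∀ m p φ → length p ℕ.≤ m → (∀ e → coeff p e ≈ 0#) → ⟨ p , φ ⟩ ≈ 0#
  ⟨⟩-vanish m       []              φ _       z = ≈-refl
  ⟨⟩-vanish (suc m) p@((a , e) ∷ p′) φ (s≤s l) z = begin
    ⟨ p , φ ⟩                                    ≈⟨ remove-⟨⟩ e p φ ⟩
    coeff p e * φ e + ⟨ remove e p , φ ⟩         ≈⟨ +-cong (≈-trans (*-congʳ (z e)) (zeroˡ _)) (⟨⟩-vanish m (remove e p) φ shorter z′) ⟩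
    0# + 0#                                      ≈⟨ +-identityʳ 0# ⟩
    0#                                           ∎
    where
    shorter : length (remove e p) ℕ.≤ m
    shorter with e ≟ₑ e
    ... | yes _  = ℕₚ.≤-trans (remove-length e p′) l
    ... | no e≢e = ⊥-elim (e≢e refl)
    z′ : ∀ f → coeff (remove e p) f ≈ 0#
    z′ f with e ≟ₑ f
    ... | yes refl = remove-same e p
    ... | no  ne   = ≈-trans (remove-other e p f ne) (z f)

  infix 21 -ₚ_
  -ₚ_ : Pol → Pol
  -ₚ_ = map (λ (a , f) → - a , f)

  ⟨⟩-neg : ∀ p φ → ⟨ -ₚ p , φ ⟩ ≈ - ⟨ p , φ ⟩
  ⟨⟩-neg []            φ = ≈-sym -0#≈0#
  ⟨⟩-neg ((a , f) ∷ p) φ = ≈-trans (+-cong (≈-sym (-‿distribˡ-* _ _)) (⟨⟩-neg p φ))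
    (solve 2 (λ x y → :- x :+ :- y := :- (x :+ y)) ≈-refl _ _)

  ⟨⟩-+ : ∀ p q φ → ⟨ p +ₚ q , φ ⟩ ≈ ⟨ p , φ ⟩ + ⟨ q , φ ⟩
  ⟨⟩-+ p q φ = ∑-++ p q _

  coeff-+ : ∀ p q e → coeff (p +ₚ q) e ≈ coeff p e + coeff q e
  coeff-+ p q e = ≈-trans (coeff-⟨⟩ (p +ₚ q) e) (≈-trans (⟨⟩-+ p q _)
    (+-cong (≈-sym (coeff-⟨⟩ p e)) (≈-sym (coeff-⟨⟩ q e))))

  ⟨⟩-*ₚ : ∀ p q φ → ⟨ p *ₚ q , φ ⟩ ≈ ⟨ p , (λ f → ⟨ q , (λ g → φ (f ⊕ g)) ⟩) ⟩
  ⟨⟩-*ₚ p q φ = ≈-trans (∑-concatMap _ p _) (∑-cong p (λ (a , f) →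
    ≈-trans (reflexive (∑-map _ q _)) (≈-trans (∑-cong q (λ (b , g) → *-assoc a b _)) (∑-*ˡ q a _))))

  -- Polynomials act as linear functionals on functions of the exponent; all ring laws are checked there.
  ⟨⟩-respects : ∀ {p q} → p ≈ₚ q → ∀ φ → ⟨ p , φ ⟩ ≈ ⟨ q , φ ⟩
  ⟨⟩-respects {p} {q} e φ = begin
    ⟨ p , φ ⟩                               ≈⟨ solve 2 (λ x y → x := (x :+ :- y) :+ y) ≈-refl _ _ ⟩
    (⟨ p , φ ⟩ + - ⟨ q , φ ⟩) + ⟨ q , φ ⟩   ≈⟨ +-congʳ (≈-sym (difference φ)) ⟩
    ⟨ p +ₚ -ₚ q , φ ⟩ + ⟨ q , φ ⟩           ≈⟨ +-congʳ (⟨⟩-vanish _ (p +ₚ -ₚ q) φ ℕₚ.≤-refl zeros) ⟩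
    0# + ⟨ q , φ ⟩                          ≈⟨ +-identityˡ _ ⟩
    ⟨ q , φ ⟩                               ∎
    where
    difference : ∀ φ → ⟨ p +ₚ -ₚ q , φ ⟩ ≈ ⟨ p , φ ⟩ + - ⟨ q , φ ⟩
    difference φ = ≈-trans (⟨⟩-+ p (-ₚ q) φ) (+-congˡ (⟨⟩-neg q φ))
    zeros : ∀ f → coeff (p +ₚ -ₚ q) f ≈ 0#
    zeros f = begin
      coeff (p +ₚ -ₚ q) f          ≈⟨ coeff-⟨⟩ (p +ₚ -ₚ q) f ⟩
      ⟨ p +ₚ -ₚ q , _ ⟩            ≈⟨ difference _ ⟩
      ⟨ p , _ ⟩ + - ⟨ q , _ ⟩      ≈⟨ +-cong (≈-sym (coeff-⟨⟩ p f)) (-‿cong (≈-sym (coeff-⟨⟩ q f))) ⟩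
      coeff p f + - coeff q f      ≈⟨ +-congʳ (e f) ⟩
      coeff q f + - coeff q f      ≈⟨ -‿inverseʳ _ ⟩
      0#                           ∎

  ⟨⟩-ext : ∀ p q → (∀ φ → ⟨ p , φ ⟩ ≈ ⟨ q , φ ⟩) → p ≈ₚ q
  ⟨⟩-ext p q e f = ≈-trans (coeff-⟨⟩ p f) (≈-trans (e _) (≈-sym (coeff-⟨⟩ q f)))

  1ₚ : Pol
  1ₚ = (1# , 0ₑ) ∷ []

  +ₚ-cong : ∀ {p q p′ q′} → p ≈ₚ p′ → q ≈ₚ q′ → (p +ₚ q) ≈ₚ (p′ +ₚ q′)
  +ₚ-cong {p} {q} {p′} {q′} e e′ = ⟨⟩-ext (p +ₚ q) (p′ +ₚ q′) (λ φ → ≈-trans (⟨⟩-+ p q φ)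
    (≈-trans (+-cong (⟨⟩-respects {p} {p′} e φ) (⟨⟩-respects {q} {q′} e′ φ)) (≈-sym (⟨⟩-+ p′ q′ φ))))

  *ₚ-cong : ∀ {p q p′ q′} → p ≈ₚ p′ → q ≈ₚ q′ → (p *ₚ q) ≈ₚ (p′ *ₚ q′)
  *ₚ-cong {p} {q} {p′} {q′} e e′ = ⟨⟩-ext (p *ₚ q) (p′ *ₚ q′) (λ φ → ≈-trans (⟨⟩-*ₚ p q φ)
    (≈-trans (⟨⟩-respects {p} {p′} e _) (≈-trans (⟨⟩-cong p′ (λ f → ⟨⟩-respects {q} {q′} e′ _)) (≈-sym (⟨⟩-*ₚ p′ q′ φ)))))

  *ₚ-comm : ∀ p q → (p *ₚ q) ≈ₚ (q *ₚ p)
  *ₚ-comm p q = ⟨⟩-ext (p *ₚ q) (q *ₚ p) (λ φ → ≈-trans (⟨⟩-*ₚ p q φ) (≈-trans (⟨⟩-swap p q _)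
    (≈-trans (⟨⟩-cong q (λ g → ⟨⟩-cong p (λ f → reflexive (cong φ (⊕-comm f g))))) (≈-sym (⟨⟩-*ₚ q p φ)))))

  *ₚ-assoc : ∀ p q r → ((p *ₚ q) *ₚ r) ≈ₚ (p *ₚ (q *ₚ r))
  *ₚ-assoc p q r = ⟨⟩-ext ((p *ₚ q) *ₚ r) (p *ₚ (q *ₚ r)) (λ φ → begin
    ⟨ (p *ₚ q) *ₚ r , φ ⟩
      ≈⟨ ≈-trans (⟨⟩-*ₚ (p *ₚ q) r φ) (⟨⟩-*ₚ p q _) ⟩
    ⟨ p , (λ f → ⟨ q , (λ g → ⟨ r , (λ h → φ ((f ⊕ g) ⊕ h)) ⟩) ⟩) ⟩
      ≈⟨ ⟨⟩-cong p (λ f → ⟨⟩-cong q (λ g → ⟨⟩-cong r (λ h → reflexive (cong φ (⊕-assoc f g h))))) ⟩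
    ⟨ p , (λ f → ⟨ q , (λ g → ⟨ r , (λ h → φ (f ⊕ (g ⊕ h))) ⟩) ⟩) ⟩
      ≈⟨ ⟨⟩-cong p (λ f → ≈-sym (⟨⟩-*ₚ q r _)) ⟩
    ⟨ p , (λ f → ⟨ q *ₚ r , (λ g → φ (f ⊕ g)) ⟩) ⟩
      ≈⟨ ≈-sym (⟨⟩-*ₚ p (q *ₚ r) φ) ⟩
    ⟨ p *ₚ (q *ₚ r) , φ ⟩ ∎)

  *ₚ-identityˡ : ∀ p → (1ₚ *ₚ p) ≈ₚ p
  *ₚ-identityˡ p = ⟨⟩-ext (1ₚ *ₚ p) p (λ φ → ≈-trans (⟨⟩-*ₚ 1ₚ p φ) (≈-trans (+-identityʳ _)
    (≈-trans (*-identityˡ _) (⟨⟩-cong p (λ f → reflexive (cong φ (⊕-identityˡ f)))))))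

  distribʳₚ : ∀ r p q → ((p +ₚ q) *ₚ r) ≈ₚ ((p *ₚ r) +ₚ (q *ₚ r))
  distribʳₚ r p q = ⟨⟩-ext ((p +ₚ q) *ₚ r) ((p *ₚ r) +ₚ (q *ₚ r)) (λ φ → ≈-trans (⟨⟩-*ₚ (p +ₚ q) r φ)
    (≈-trans (⟨⟩-+ p q _) (≈-sym (≈-trans (⟨⟩-+ (p *ₚ r) (q *ₚ r) φ) (+-cong (⟨⟩-*ₚ p r φ) (⟨⟩-*ₚ q r φ))))))

  ≈ₚ-trans : ∀ {p q r} → p ≈ₚ q → q ≈ₚ r → p ≈ₚ r
  ≈ₚ-trans e e′ f = ≈-trans (e f) (e′ f)

  polynomialRing : CommutativeRing c ℓ
  polynomialRing = record
    { Carrier = Pol ; _≈_ = _≈ₚ_ ; _+_ = _+ₚ_ ; _*_ = _*ₚ_ ; -_ = -ₚ_ ; 0# = 0ₚ ; 1# = 1ₚ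
    ; isCommutativeRing = record
      { isRing = record
        { +-isAbelianGroup = record
          { isGroup = record
            { isMonoid = record
              { isSemigroup = record
                { isMagma = record
                  { isEquivalence = record { refl = λ _ → ≈-refl ; sym = λ e f → ≈-sym (e f) ; trans = λ e e′ f → ≈-trans (e f) (e′ f) }
                  ; ∙-cong = λ {p} {p′} {q} {q′} → +ₚ-cong {p} {q} {p′} {q′} }
                ; assoc = λ p q r → ⟨⟩-ext ((p +ₚ q) +ₚ r) (p +ₚ (q +ₚ r)) (λ φ → ≈-trans (≈-trans (⟨⟩-+ (p +ₚ q) r φ) (+-congʳ (⟨⟩-+ p q φ)))
                    (≈-trans (+-assoc _ _ _) (≈-sym (≈-trans (⟨⟩-+ p (q +ₚ r) φ) (+-congˡ (⟨⟩-+ q r φ)))))) }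
              ; identity = (λ p _ → ≈-refl) , λ p → ⟨⟩-ext (p +ₚ 0ₚ) p (λ φ → ≈-trans (⟨⟩-+ p 0ₚ φ) (+-identityʳ _)) }
            ; inverse = (λ p → ⟨⟩-ext (-ₚ p +ₚ p) 0ₚ (λ φ → ≈-trans (⟨⟩-+ (-ₚ p) p φ) (≈-trans (+-congʳ (⟨⟩-neg p φ)) (-‿inverseˡ _))))
                      , (λ p → ⟨⟩-ext (p +ₚ -ₚ p) 0ₚ (λ φ → ≈-trans (⟨⟩-+ p (-ₚ p) φ) (≈-trans (+-congˡ (⟨⟩-neg p φ)) (-‿inverseʳ _))))
            ; ⁻¹-cong = λ {p} {q} e → ⟨⟩-ext (-ₚ p) (-ₚ q) (λ φ → ≈-trans (⟨⟩-neg p φ)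
                (≈-trans (-‿cong (⟨⟩-respects {p} {q} e φ)) (≈-sym (⟨⟩-neg q φ)))) }
          ; comm = λ p q → ⟨⟩-ext (p +ₚ q) (q +ₚ p) (λ φ → ≈-trans (⟨⟩-+ p q φ) (≈-trans (+-comm _ _) (≈-sym (⟨⟩-+ q p φ)))) }
        ; *-cong = λ {p} {p′} {q} {q′} → *ₚ-cong {p} {q} {p′} {q′}
        ; *-assoc = *ₚ-assoc
        ; *-identity = *ₚ-identityˡ , λ p → ≈ₚ-trans {p *ₚ 1ₚ} {1ₚ *ₚ p} {p} (*ₚ-comm p 1ₚ) (*ₚ-identityˡ p)
        ; distrib = (λ r p q → ≈ₚ-trans {r *ₚ (p +ₚ q)} {(p +ₚ q) *ₚ r} {(r *ₚ p) +ₚ (r *ₚ q)} (*ₚ-comm r (p +ₚ q))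
              (≈ₚ-trans {(p +ₚ q) *ₚ r} {(p *ₚ r) +ₚ (q *ₚ r)} {(r *ₚ p) +ₚ (r *ₚ q)} (distribʳₚ r p q)
                (+ₚ-cong {p *ₚ r} {q *ₚ r} {r *ₚ p} {r *ₚ q} (*ₚ-comm p r) (*ₚ-comm q r))))
            , distribʳₚ }
      ; *-comm = *ₚ-comm } }

  ⟨⟩-sumₚ : ∀ {r} (f : Fin r → Pol) φ → ⟨ sumₚ f , φ ⟩ ≈ ∑ (allFin r) (λ j → ⟨ f j , φ ⟩)
  ⟨⟩-sumₚ f φ = go f (λ j → j)
    where
    go : ∀ {r r′} (f : Fin r′ → Pol) (ι : Fin r → Fin r′) → ⟨ sumₚ (λ j → f (ι j)) , φ ⟩ ≈ ∑ (tabulate ι) (λ j → ⟨ f j , φ ⟩)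
    go {zero}  f ι = ≈-refl
    go {suc r} f ι = ≈-trans (⟨⟩-+ (f (ι zero)) _ φ) (+-congˡ (go f (λ j → ι (suc j))))

  ⟨⟩-apply : ∀ {m r} (d : Mat m r) u i φ →
             ⟨ apply d u i , φ ⟩ ≈ ∑ (allFin r) (λ j → ⟨ d i j , (λ f → ⟨ u j , (λ g → φ (f ⊕ g)) ⟩) ⟩)
  ⟨⟩-apply {r = r} d u i φ = ≈-trans (⟨⟩-sumₚ (λ j → d i j *ₚ u j) φ) (∑-cong (allFin r) (λ j → ⟨⟩-*ₚ (d i j) (u j) φ))

  private module P = LinearAlgebra polynomialRing

  matrixOp : ∀ {m r} → Mat m r → P.Op (Fin r) (Fin m)
  matrixOp {m} {r} d = record
    { _·_ = apply d
    ; ·-cong = λ {u} {v} e i → ⟨⟩-ext (apply d u i) (apply d v i) (λ φ → ≈-trans (⟨⟩-apply d u i φ)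
        (≈-trans (∑-cong (allFin r) (λ j → ⟨⟩-cong (d i j) (λ f → ⟨⟩-respects {u j} {v j} (e j) _))) (≈-sym (⟨⟩-apply d v i φ))))
    ; ·-+ = λ u v i → ⟨⟩-ext (apply d (λ j → u j +ₚ v j) i) (apply d u i +ₚ apply d v i) (λ φ → ≈-trans (⟨⟩-apply d _ i φ)
        (≈-trans (∑-cong (allFin r) (λ j → ≈-trans (⟨⟩-cong (d i j) (λ f → ⟨⟩-+ (u j) (v j) _)) (⟨⟩-add (d i j) _ _)))
        (≈-trans (∑-+ (allFin r) _ _)
        (≈-sym (≈-trans (⟨⟩-+ (apply d u i) (apply d v i) φ) (+-cong (⟨⟩-apply d u i φ) (⟨⟩-apply d v i φ)))))))
    ; ·-* = λ p v i → ⟨⟩-ext (apply d (λ j → p *ₚ v j) i) (p *ₚ apply d v i) (λ φ → begin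
        ⟨ apply d (λ j → p *ₚ v j) i , φ ⟩
          ≈⟨ ⟨⟩-apply d _ i φ ⟩
        ∑ (allFin r) (λ j → ⟨ d i j , (λ f → ⟨ p *ₚ v j , (λ g → φ (f ⊕ g)) ⟩) ⟩)
          ≈⟨ ∑-cong (allFin r) (λ j → ≈-trans (⟨⟩-cong (d i j) (λ f → ⟨⟩-*ₚ p (v j) _)) (⟨⟩-swap (d i j) p _)) ⟩
        ∑ (allFin r) (λ j → ⟨ p , (λ h → ⟨ d i j , (λ f → ⟨ v j , (λ g → φ (f ⊕ (h ⊕ g))) ⟩) ⟩) ⟩)
          ≈⟨ ∑-cong (allFin r) (λ j → ⟨⟩-cong p (λ h → ⟨⟩-cong (d i j) (λ f → ⟨⟩-cong (v j) (λ g → reflexive (cong φ (exchange f h g)))))) ⟩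
        ∑ (allFin r) (λ j → ⟨ p , (λ h → ⟨ d i j , (λ f → ⟨ v j , (λ g → φ (h ⊕ (f ⊕ g))) ⟩) ⟩) ⟩)
          ≈⟨ ∑-swap (allFin r) p (λ j (a , h) → a * ⟨ d i j , (λ f → ⟨ v j , (λ g → φ (h ⊕ (f ⊕ g))) ⟩) ⟩) ⟩
        ∑ p (λ (a , h) → ∑ (allFin r) (λ j → a * ⟨ d i j , (λ f → ⟨ v j , (λ g → φ (h ⊕ (f ⊕ g))) ⟩) ⟩))
          ≈⟨ ∑-cong p (λ (a , h) → ∑-*ˡ (allFin r) a _) ⟩
        ⟨ p , (λ h → ∑ (allFin r) (λ j → ⟨ d i j , (λ f → ⟨ v j , (λ g → φ (h ⊕ (f ⊕ g))) ⟩) ⟩)) ⟩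
          ≈⟨ ⟨⟩-cong p (λ h → ≈-sym (⟨⟩-apply d v i _)) ⟩
        ⟨ p , (λ h → ⟨ apply d v i , (λ f → φ (h ⊕ f)) ⟩) ⟩
          ≈⟨ ≈-sym (⟨⟩-*ₚ p (apply d v i) φ) ⟩
        ⟨ p *ₚ apply d v i , φ ⟩ ∎) }
    where
    ⟨⟩-add : ∀ p φ ψ → ⟨ p , (λ f → φ f + ψ f) ⟩ ≈ ⟨ p , φ ⟩ + ⟨ p , ψ ⟩
    ⟨⟩-add p φ ψ = ≈-trans (∑-cong p (λ (a , f) → distribˡ a _ _)) (∑-+ p _ _)
    exchange : ∀ f h g → f ⊕ (h ⊕ g) ≡ h ⊕ (f ⊕ g)
    exchange f h g = ≡.trans (≡.sym (⊕-assoc f h g)) (≡.trans (cong (_⊕ g) (⊕-comm f h)) (⊕-assoc h f g))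

-- From labelled complexes to free resolutions

lookup-injective : ∀ {A : Set} {xs : List A} → Unique xs → ∀ {i j} → List.lookup xs i ≡ List.lookup xs j → i ≡ j
lookup-injective (_  ∷ _)  {zero}  {zero}  _ = refl
lookup-injective (px ∷ _)  {zero}  {suc j} e = ⊥-elim (All.lookup px (∈-lookup j) e)
lookup-injective (px ∷ _)  {suc i} {zero}  e = ⊥-elim (All.lookup px (∈-lookup i) (≡.sym e))
lookup-injective (_  ∷ ux) {suc i} {suc j} e = cong suc (lookup-injective ux e)

module Realization {c ℓ : Level} (K : Field c ℓ) (n : ℕ) where
  open Poly K n
  open Field K hiding (zero) renaming (refl to ≈-refl; sym to ≈-sym; trans to ≈-trans)
  open import Relation.Binary.Reasoning.Setoid setoid
  open LinearAlgebra commutativeRing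
  open Exponents n
  open Complexes commutativeRing n hiding (Exp)
  open PolynomialRing K n

  -- For an upward closed `U`, the monomial ideal spanned by the monomials with exponent in `U`,
  -- described by coefficients so that no generators need to be named.
  Supported : (Exp → Set) → Ideal
  Supported U v = Lift (c ⊔ ℓ) (∀ α → ¬ U α → coeff (v zero) α ≈ 0#)

  module _ {L : ℕ} {U : Exp → Set} (U? : ∀ α → Dec (U α)) (F : LRes L U) where
    open LRes F

    InDegree : ℕ → Gen → Set
    InDegree i b = act b ≡ true × deg b ≡ i

    inDegree? : ∀ i b → Dec (InDegree i b)
    inDegree? i b = (act b Boolₚ.≟ true) ×-dec (deg b ℕ.≟ i)

    -- Degree zero is listed by hand, so that `rank 0` computes to 1 and the image of `d 0` is a
    -- subset of S, as an `Ideal` must be.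
    gens : ℕ → List Gen
    gens zero    = ★ ∷ []
    gens (suc i) = filter (inDegree? (suc i)) (enum idx)

    rank : ℕ → ℕ
    rank i = length (gens i)

    gen : ∀ i → Fin (rank i) → Gen
    gen i = List.lookup (gens i)

    gen-inDegree : ∀ i j → InDegree i (gen i j)
    gen-inDegree zero    zero = act-★ , deg-★
    gen-inDegree (suc i) j    = proj₂ (∈-filter⁻ (inDegree? (suc i)) {xs = enum idx} (∈-lookup j))

    gen-injective : ∀ i {j j′} → gen i j ≡ gen i j′ → j ≡ j′
    gen-injective zero    = lookup-injective ([] ∷ [])
    gen-injective (suc i) = lookup-injective (Uniqueₚ.filter⁺ (inDegree? (suc i)) (Index.unique idx))

    gen-surjective : ∀ i b → InDegree i b → Σ (Fin (rank i)) (λ j → gen i j ≡ b)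
    gen-surjective zero    b (a , d) = zero , ≡.sym (★-unique b a d)
    gen-surjective (suc i) b p       = index b∈ , ≡.sym (lookup-index b∈)
      where
      b∈ : b ∈ gens (suc i)
      b∈ = ∈-filter⁺ (inDegree? (suc i)) (Index.complete idx b) p

    rank-empty : ∀ {i} → L ℕ.< i → ¬ Fin (rank i)
    rank-empty {i} lt j = ℕₚ.<⇒≱ lt (subst (ℕ._≤ L) (proj₂ (gen-inDegree i j)) (bounded _ (proj₁ (gen-inDegree i j))))

    labᵍ : ∀ i → Fin (rank i) → Exp
    labᵍ i j = lab (gen i j)

    δᵍ : ∀ i → Fin (rank i) → Vect Gen
    δᵍ i j = δ idx (gen i j)

    -- The coefficient of x^(α - labᵍ i j) in `u j`. Adding the label to the exponent avoids the
    -- subtraction and gives zero when the label does not divide α.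
    coef : ∀ i → Elt (rank i) → Exp → Fin (rank i) → Carrier
    coef i u α j = ⟨ u j , (λ f → bool ((f ⊕ labᵍ i j) ≟ₑ α)) ⟩

    strand : ∀ i → Elt (rank i) → Exp → Vect Gen
    strand i u α b = ∑ (allFin (rank i)) (λ j → coef i u α j * δᵍ i j b)

    strand-cong : ∀ i {u v} → u ≈ᵥ v → ∀ α → strand i u α ≋ strand i v α
    strand-cong i {u} {v} e α b = ∑-cong (allFin (rank i)) (λ j → *-congʳ (⟨⟩-respects {u j} {v j} (e j) _))

    strand-+ : ∀ i u v α → strand i (λ j → u j +ₚ v j) α ≋ strand i u α ⊹ strand i v α
    strand-+ i u v α b = ≈-trans (∑-cong (allFin (rank i)) (λ j → ≈-trans (*-congʳ (⟨⟩-+ (u j) (v j) _)) (distribʳ _ _ _)))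
      (∑-+ (allFin (rank i)) _ _)

    strand-𝟘 : ∀ i {u} → u ≈ᵥ 0ᵥ → ∀ α → strand i u α ≋ 𝟘
    strand-𝟘 i {u} e α b = ∑-zero (allFin (rank i)) (λ j → ≈-trans (*-congʳ (⟨⟩-respects {u j} {0ₚ} (e j) _)) (zeroˡ _))

    strand-gen : ∀ i u α j → strand i u α (gen i j) ≈ coef i u α j
    strand-gen i u α j = ≈-trans
      (∑-enum (finIndex (rank i)) (λ j′ → coef i u α j′ * δᵍ i j′ (gen i j)) j
        (λ j′ j′≢j → ≈-trans (*-congˡ (δ-diff idx (λ e → j′≢j (gen-injective i e)))) (zeroʳ _)))
      (≈-trans (*-congˡ (δ-same idx (gen i j))) (*-identityʳ _))

    strand-off : ∀ i u α b → ¬ InDegree i b → strand i u α b ≈ 0#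
    strand-off i u α b ¬b = ∑-zero (allFin (rank i)) (λ j →
      ≈-trans (*-congˡ (δ-diff idx (λ e → ¬b (subst (InDegree i) e (gen-inDegree i j))))) (zeroʳ _))

    strand-Supp : ∀ i u α → Supp α (strand i u α)
    strand-Supp i u α b ¬b with inDegree? i b
    ... | no ¬p = strand-off i u α b ¬p
    ... | yes p with gen-surjective i b p
    ...   | j , refl = ≈-trans (strand-gen i u α j) (⟨⟩-zero (u j) (λ f →
              bool-no ((f ⊕ labᵍ i j) ≟ₑ α) (λ e → ¬b (proj₁ p , subst (labᵍ i j ≤ₑ_) e (≤ₑ-⊕ʳ f _)))))

    strand-outside : ∀ i u α → ¬ U α → strand (suc i) u α ≋ 𝟘
    strand-outside i u α ¬U b with inDegree? (suc i) b | b ⊑? α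
    ... | no ¬p | _      = strand-off (suc i) u α b ¬p
    ... | yes p | no ¬b  = strand-Supp (suc i) u α b ¬b
    ... | yes p | yes b⊑ = ⊥-elim (¬U (support b b⊑ (subst (1 ℕ.≤_) (≡.sym (proj₂ p)) (s≤s z≤n))))

    -- The exponent `f` in component `j` is seen in multidegree `f ⊕ labᵍ i j`, and adding the label
    -- is injective.
    strand-ext : ∀ i u v → (∀ α → strand i u α ≋ strand i v α) → u ≈ᵥ v
    strand-ext i u v e j f = begin
      coeff (u j) f                     ≈⟨ unshift u ⟩
      coef i u (f ⊕ labᵍ i j) j         ≈⟨ ≈-sym (strand-gen i u _ j) ⟩
      strand i u (f ⊕ labᵍ i j) (gen i j) ≈⟨ e _ _ ⟩
      strand i v (f ⊕ labᵍ i j) (gen i j) ≈⟨ strand-gen i v _ j ⟩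
      coef i v (f ⊕ labᵍ i j) j         ≈⟨ ≈-sym (unshift v) ⟩
      coeff (v j) f                     ∎
      where
      unshift : ∀ u → coeff (u j) f ≈ coef i u (f ⊕ labᵍ i j) j
      unshift u = ≈-trans (coeff-⟨⟩ (u j) f) (⟨⟩-cong (u j) (λ g →
        bool-⇔ (g ≟ₑ f) ((g ⊕ labᵍ i j) ≟ₑ (f ⊕ labᵍ i j)) (cong (_⊕ labᵍ i j)) (⊕-cancelʳ (labᵍ i j))))

    entry : ∀ i → Fin (rank i) → Fin (rank (suc i)) → Carrier
    entry i j k = (∂ · δᵍ (suc i) k) (gen i j)

    -- Where one label does not divide the other, the truncated difference is meaningless, but there
    -- the coefficient vanishes by `entry-zero`.
    d : ∀ i → Mat (rank i) (rank (suc i))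
    d i j k = (entry i j k , labᵍ (suc i) k ⊖ labᵍ i j) ∷ []

    entry-zero : ∀ i j k → ¬ labᵍ i j ≤ₑ labᵍ (suc i) k → entry i j k ≈ 0#
    entry-zero i j k ¬le = ∂-local _ (gen i j) (λ c (_ , le) →
      δ-diff idx (λ { refl → ¬le (proj₂ (le (proj₁ (gen-inDegree (suc i) k)))) }))

    -- The matrices are homogeneous and act on each strand as `∂`. With `strand-ext`, identities
    -- over S thereby reduce to identities over K.
    strand-d : ∀ i u α → strand i (apply (d i) u) α ≋ ∂ · strand (suc i) u α
    strand-d i u α b with inDegree? i b
    ... | no ¬p = ≈-trans (strand-off i (apply (d i) u) α b ¬p) (≈-sym (∂-local _ b (λ c (dc , le) →
                    strand-off (suc i) u α c (λ (ac , ic) → ¬p (proj₁ (le ac) , ℕₚ.suc-injective (≡.trans (≡.sym dc) ic))))))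
    ... | yes p with gen-surjective i b p
    ...   | j , refl = begin
      strand i (apply (d i) u) α (gen i j)
        ≈⟨ strand-gen i (apply (d i) u) α j ⟩
      ⟨ apply (d i) u j , (λ f → bool ((f ⊕ labᵍ i j) ≟ₑ α)) ⟩
        ≈⟨ ⟨⟩-apply (d i) u j _ ⟩
      ∑ (allFin (rank (suc i))) (λ k → entry i j k * ⟨ u k , (λ g → bool ((((labᵍ (suc i) k ⊖ labᵍ i j) ⊕ g) ⊕ labᵍ i j) ≟ₑ α)) ⟩ + 0#)
        ≈⟨ ∑-cong (allFin (rank (suc i))) (λ k → ≈-trans (+-identityʳ _) (term k)) ⟩
      ∑ (allFin (rank (suc i))) (λ k → coef (suc i) u α k * entry i j k)
        ≈⟨ ≈-sym (·-∑* ∂ (allFin (rank (suc i))) (coef (suc i) u α) (δᵍ (suc i)) (gen i j)) ⟩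
      (∂ · strand (suc i) u α) (gen i j) ∎
      where
      rearrange : ∀ {x y} g → x ≤ₑ y → ((y ⊖ x) ⊕ g) ⊕ x ≡ g ⊕ y
      rearrange {x} {y} g le = ≡.trans (cong (_⊕ x) (⊕-comm (y ⊖ x) g)) (≡.trans (⊕-assoc g (y ⊖ x) x) (cong (g ⊕_) (⊖-⊕ le)))
      term : ∀ k → entry i j k * ⟨ u k , (λ g → bool ((((labᵍ (suc i) k ⊖ labᵍ i j) ⊕ g) ⊕ labᵍ i j) ≟ₑ α)) ⟩
                 ≈ coef (suc i) u α k * entry i j k
      term k with labᵍ i j ≤ₑ? labᵍ (suc i) k
      ... | yes le = ≈-trans (*-comm _ _) (*-congʳ (⟨⟩-cong (u k) (λ g → reflexive (cong (λ β → bool (β ≟ₑ α)) (rearrange g le)))))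
      ... | no ¬le = ≈-trans (*-congʳ (entry-zero i j k ¬le)) (≈-trans (zeroˡ _)
                       (≈-sym (≈-trans (*-congˡ (entry-zero i j k ¬le)) (zeroʳ _))))

    σ : Exp → Op Gen Gen
    σ α with U? α
    ... | yes u = s u
    ... | no  _ = 𝟘ₒ

    σ-local : ∀ α → Local (Raise _⊑ᶜ[ α ]_) (σ α)
    σ-local α with U? α
    ... | yes u = s-local u
    ... | no  _ = λ _ _ _ → ≈-refl

    σ-htpy : ∀ α → U α → ∀ {v} → Supp α v → ∂ · σ α · v ⊹ σ α · ∂ · v ≋ v
    σ-htpy α u sv with U? α
    ... | yes u′ = s-htpy u′ sv
    ... | no ¬u  = ⊥-elim (¬u u)

    σ-entry : ∀ i → Exp → Fin (rank (suc i)) → Fin (rank i) → Carrier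
    σ-entry i α j k = (σ α · δᵍ i k) (gen (suc i) j)

    σ-entry-zero : ∀ i α j k → labᵍ i k ≤ₑ α → ¬ labᵍ (suc i) j ≤ₑ α → σ-entry i α j k ≈ 0#
    σ-entry-zero i α j k k≤ ¬j≤ = σ-local α _ (gen (suc i) j) (λ c (_ , f) →
      δ-diff idx (λ { refl → ¬j≤ (proj₂ (f (proj₁ (gen-inDegree i k) , k≤))) }))

    -- Applies the contraction of each strand, term by term; this is K-linear but not S-linear.
    lift-σ : ∀ i → Elt (rank i) → Elt (rank (suc i))
    lift-σ i u j = concatMap (λ k → map (λ (a , f) → a * σ-entry i (f ⊕ labᵍ i k) j k , (f ⊕ labᵍ i k) ⊖ labᵍ (suc i) j) (u k))
                     (allFin (rank i))

    strand-lift : ∀ i u α → strand (suc i) (lift-σ i u) α ≋ σ α · strand i u α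
    strand-lift i u α b with inDegree? (suc i) b
    ... | no ¬p = ≈-trans (strand-off (suc i) (lift-σ i u) α b ¬p) (≈-sym (σ-local α _ b (λ c q → outside c q)))
      where
      outside : ∀ c → Raise _⊑ᶜ[ α ]_ b c → strand i u α c ≈ 0#
      outside c (db , f) with inDegree? i c | c ⊑? α
      ... | no ¬q | _      = strand-off i u α c ¬q
      ... | yes _ | no ¬c  = strand-Supp i u α c ¬c
      ... | yes q | yes c⊑ = ⊥-elim (¬p (proj₁ (f c⊑) , ≡.trans db (cong suc (proj₂ q))))
    ... | yes p with gen-surjective (suc i) b p
    ...   | j , refl = begin
      strand (suc i) (lift-σ i u) α (gen (suc i) j)
        ≈⟨ strand-gen (suc i) (lift-σ i u) α j ⟩
      ⟨ lift-σ i u j , ψ ⟩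
        ≈⟨ ∑-concatMap _ (allFin (rank i)) _ ⟩
      ∑ (allFin (rank i)) (λ k → ⟨ map (λ (a , f) → a * σ-entry i (f ⊕ labᵍ i k) j k , (f ⊕ labᵍ i k) ⊖ labᵍ (suc i) j) (u k) , ψ ⟩)
        ≈⟨ ∑-cong (allFin (rank i)) (λ k → ≈-trans (reflexive (∑-map _ (u k) _))
             (≈-trans (∑-cong (u k) (λ (a , f) → term k a f)) (∑-*ʳ (u k) (σ-entry i α j k) _))) ⟩
      ∑ (allFin (rank i)) (λ k → coef i u α k * σ-entry i α j k)
        ≈⟨ ≈-sym (·-∑* (σ α) (allFin (rank i)) (coef i u α) (δᵍ i) (gen (suc i) j)) ⟩
      (σ α · strand i u α) (gen (suc i) j) ∎
      where
      ψ : Exp → Carrier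
      ψ f = bool ((f ⊕ labᵍ (suc i) j) ≟ₑ α)
      term : ∀ k a f → (a * σ-entry i (f ⊕ labᵍ i k) j k) * ψ ((f ⊕ labᵍ i k) ⊖ labᵍ (suc i) j)
                     ≈ (a * bool ((f ⊕ labᵍ i k) ≟ₑ α)) * σ-entry i α j k
      term k a f with labᵍ (suc i) j ≤ₑ? (f ⊕ labᵍ i k)
      ... | yes le = ≈-trans (*-congˡ (reflexive (cong (λ β → bool (β ≟ₑ α)) (⊖-⊕ le)))) (swapped ((f ⊕ labᵍ i k) ≟ₑ α))
        where
        swapped : (eq : Dec (f ⊕ labᵍ i k ≡ α)) → (a * σ-entry i (f ⊕ labᵍ i k) j k) * bool eq ≈ (a * bool eq) * σ-entry i α j k
        swapped (yes e) = ≈-trans (*-identityʳ _) (≈-trans (*-congˡ (reflexive (cong (λ β → σ-entry i β j k) e)))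
                            (*-congʳ (≈-sym (*-identityʳ a))))
        swapped (no _)  = ≈-trans (zeroʳ _) (≈-sym (≈-trans (*-congʳ (zeroʳ a)) (zeroˡ _)))
      ... | no ¬le = ≈-trans (*-congʳ (≈-trans (*-congˡ (σ-entry-zero i _ j k (≤ₑ-⊕ʳ f _) ¬le)) (zeroʳ a)))
                       (≈-trans (zeroˡ _) (≈-sym (vanish ((f ⊕ labᵍ i k) ≟ₑ α))))
        where
        vanish : (eq : Dec (f ⊕ labᵍ i k ≡ α)) → (a * bool eq) * σ-entry i α j k ≈ 0#
        vanish (yes refl) = ≈-trans (*-congˡ (σ-entry-zero i _ j k (≤ₑ-⊕ʳ f _) ¬le)) (zeroʳ _)
        vanish (no _)     = ≈-trans (*-congʳ (zeroʳ a)) (zeroˡ _)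

    d-complex : ∀ i w → apply (d i) (apply (d (suc i)) w) ≈ᵥ 0ᵥ
    d-complex i w = strand-ext i (apply (d i) (apply (d (suc i)) w)) 0ᵥ (λ α b → begin
      strand i (apply (d i) (apply (d (suc i)) w)) α b   ≈⟨ strand-d i _ α b ⟩
      (∂ · strand (suc i) (apply (d (suc i)) w) α) b     ≈⟨ ·-cong ∂ (strand-d (suc i) w α) b ⟩
      (∂ · ∂ · strand (suc (suc i)) w α) b               ≈⟨ ∂∂ _ b ⟩
      0#                                                 ≈⟨ ≈-sym (strand-𝟘 i {0ᵥ} (λ _ _ → ≈-refl) α b) ⟩
      strand i 0ᵥ α b                                    ∎)

    -- Strand by strand: inside `U` the contraction exhibits a cycle as a boundary, and outside `U`
    -- the strand of `v` is zero.
    preimage : ∀ i v → (∀ α → ¬ U α → strand i v α ≋ 𝟘) → (∀ α → ∂ · strand i v α ≋ 𝟘) → apply (d i) (lift-σ i v) ≈ᵥ v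
    preimage i v out cyc = strand-ext i (apply (d i) (lift-σ i v)) v (λ α b → ≈-trans (strand-d i _ α b)
      (≈-trans (·-cong ∂ (strand-lift i v α) b) (fill α b (U? α))))
      where
      fill : ∀ α b → Dec (U α) → (∂ · σ α · strand i v α) b ≈ strand i v α b
      fill α b (yes u) = ≈-trans (≈-sym (≈-trans (+-congˡ (·-𝟘 (σ α) (cyc α) b)) (+-identityʳ _)))
                           (σ-htpy α u (strand-Supp i v α) b)
      fill α b (no ¬u) = ≈-trans (·-𝟘 ∂ (·-𝟘 (σ α) (out α ¬u)) b) (≈-sym (out α ¬u b))

    d-exact : ∀ i v → apply (d i) v ≈ᵥ 0ᵥ → apply (d (suc i)) (lift-σ (suc i) v) ≈ᵥ v
    d-exact i v e = preimage (suc i) v (strand-outside i v)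
      (λ α b → ≈-trans (≈-sym (strand-d i v α b)) (strand-𝟘 i {apply (d i) v} e α b))

    d-image : ∀ i → ImageIs (d (suc i)) (Ker (d i))
    d-image i = (λ w → lift (d-complex i w)) , λ v (lift e) → lift-σ (suc i) v , d-exact i v e

    strand-★ : ∀ v α → strand 0 v α ★ ≈ coeff (v zero) α
    strand-★ v α = ≈-trans (strand-gen 0 v α zero) (≈-trans (⟨⟩-cong (v zero) (λ f →
      reflexive (cong (λ β → bool (β ≟ₑ α)) (≡.trans (cong (f ⊕_) lab-★) (⊕-identityʳ f))))) (≈-sym (coeff-⟨⟩ (v zero) α)))

    augmentation-image : ImageIs (d 0) (Supported U)
    augmentation-image =
      (λ u → lift (λ α ¬u → ≈-trans (≈-sym (strand-★ (apply (d 0) u) α))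
        (≈-trans (strand-d 0 u α ★) (·-𝟘 ∂ (strand-outside 0 u α ¬u) ★)))) ,
      (λ v (lift out) → lift-σ 0 v , preimage 0 v (outside v out) (λ α b → ∂-local _ b (λ c (dc , _) →
        strand-off 0 v α c (λ (_ , c0) → ℕₚ.0≢1+n (≡.trans (≡.sym c0) dc)))))
      where
      outside : ∀ v → (∀ α → ¬ U α → coeff (v zero) α ≈ 0#) → ∀ α → ¬ U α → strand 0 v α ≋ 𝟘
      outside v out α ¬u b with inDegree? 0 b
      ... | no ¬p = strand-off 0 v α b ¬p
      ... | yes (a , d0) with ★-unique b a d0
      ...   | refl = ≈-trans (strand-★ v α) (out α ¬u)

    -- The free modules used have indices i + 2 to k + i + 2. Beyond these the bound on `L` leaves
    -- rank zero, which makes the last map injective.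
    pd-syzygy : ∀ k i → L ℕ.≤ suc (suc (k ℕ.+ i)) → PdLe k (rank (suc i)) (Ker (d i))
    pd-syzygy zero    i le = rank (suc (suc i)) , d (suc i) , d-image i , lift injective
      where
      injective : ∀ u → apply (d (suc i)) u ≈ᵥ 0ᵥ → u ≈ᵥ 0ᵥ
      injective u e j = ⟨⟩-ext (u j) 0ₚ (λ φ → ≈-trans (≈-sym (⟨⟩-respects {apply (d (suc (suc i))) w j} {u j} (d-exact (suc i) u e j) φ))
        (≈-trans (⟨⟩-apply (d (suc (suc i))) w j φ) (∑-zero (allFin (rank (suc (suc (suc i))))) (λ k → ⊥-elim (rank-empty (s≤s le) k)))))
        where w = lift-σ (suc (suc i)) u
    pd-syzygy (suc k) i le = rank (suc (suc i)) , d (suc i) , d-image i ,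
      pd-syzygy k (suc i) (subst (λ m → L ℕ.≤ suc (suc m)) (≡.sym (ℕₚ.+-suc k i)) le)

  -- A complex for the quotient also counts S itself in degree zero, whence `suc k` against `k`.
  pd-Supported : ∀ {k U} → (∀ α → Dec (U α)) → LRes (suc k) U → PdLe k 1 (Supported U)
  pd-Supported {zero} U? F = rank U? F 1 , d U? F 0 , augmentation-image U? F , lift injective
    where
    injective : ∀ u → apply (d U? F 0) u ≈ᵥ 0ᵥ → u ≈ᵥ 0ᵥ
    injective u e j = ⟨⟩-ext (u j) 0ₚ (λ φ → ≈-trans (≈-sym (⟨⟩-respects {apply (d U? F 1) w j} {u j} (d-exact U? F 0 u e j) φ))
      (≈-trans (⟨⟩-apply (d U? F 1) w j φ) (∑-zero (allFin (rank U? F 2)) (λ k → ⊥-elim (rank-empty U? F ℕₚ.≤-refl k)))))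
      where w = lift-σ U? F 1 u
  pd-Supported {suc k} U? F = rank U? F 1 , d U? F 0 , augmentation-image U? F ,
    pd-syzygy U? F k 0 (ℕₚ.≤-reflexive (cong (λ m → suc (suc m)) (≡.sym (ℕₚ.+-identityʳ k))))

-- From free resolutions to labelled complexes

module Multigrading {c ℓ : Level} (K : Field c ℓ) (n : ℕ) where
  open Poly K n
  open Field K hiding (zero) renaming (refl to ≈-refl; sym to ≈-sym; trans to ≈-trans)
  open import Relation.Binary.Reasoning.Setoid setoid
  open LinearAlgebra commutativeRing
  open Exponents n
  open Complexes commutativeRing n hiding (Exp)
  open PolynomialRing K n
  open Realization K n
  open Comparison polynomialRing
  private module P = LinearAlgebra polynomialRing

  Cover : List Exp → Exp → Set
  Cover As α = Any (_≤ₑ α) As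

  cover? : ∀ As α → Dec (Cover As α)
  cover? As α = any? (_≤ₑ? α) As

  -- Tensoring the two-term complexes of the single monomials, with lcm labels, gives the Taylor
  -- resolution: a multigraded partner with which the given resolution can be compared.
  taylor : ∀ As → LRes (length As) (Cover As)
  taylor []       = LRes-⇔ z≤n (λ ()) (λ ()) unit
  taylor (A ∷ As) = LRes-⇔ ℕₚ.≤-refl
    (λ { (inj₁ p) → here p ; (inj₂ q) → there q }) (λ { (here p) → inj₁ p ; (there q) → inj₂ q })
    (Sum.sumRes (principal A) (taylor As))

  taylor-act : ∀ As b → LRes.act (taylor As) b ≡ true
  taylor-act []       b       = refl
  taylor-act (A ∷ As) (b , b′) = taylor-act As b′

  apply-δ : ∀ {m r} (d : Mat m r) j i → apply d (P.δ (finIndex r) j) i ≈ₚ d i j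
  apply-δ {r = r} d j i = ⟨⟩-ext (apply d (P.δ (finIndex r) j) i) (d i j) (λ φ → begin
    ⟨ apply d (P.δ (finIndex r) j) i , φ ⟩
      ≈⟨ ⟨⟩-apply d (P.δ (finIndex r) j) i φ ⟩
    ∑ (allFin r) (λ k → ⟨ d i k , (λ f → ⟨ P.δ (finIndex r) j k , (λ g → φ (f ⊕ g)) ⟩) ⟩)
      ≈⟨ ∑-enum (finIndex r) _ j (λ k k≢j → ⟨⟩-zero (d i k) (λ f →
           ⟨⟩-respects {P.δ (finIndex r) j k} {0ₚ} (P.δ-diff (finIndex r) (λ e → k≢j (≡.sym e))) _)) ⟩
    ⟨ d i j , (λ f → ⟨ P.δ (finIndex r) j j , (λ g → φ (f ⊕ g)) ⟩) ⟩
      ≈⟨ ⟨⟩-cong (d i j) (λ f → ≈-trans (⟨⟩-respects {P.δ (finIndex r) j j} {1ₚ} (P.δ-same (finIndex r) j) _)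
           (≈-trans (+-identityʳ _) (≈-trans (*-identityˡ _) (reflexive (cong φ (⊕-identityʳ f)))))) ⟩
    ⟨ d i j , φ ⟩ ∎)

  -- The given resolution as an exact sequence

  module PdSequence where

    -- The ambient module takes index 0 and zero modules continue the resolution, so its last free
    -- module, of homological degree k, sits at index `suc k`.
    pdRank : ∀ k m (M : Sub m) → PdLe k m M → ℕ → ℕ
    pdRank k       m M pd               zero          = m
    pdRank zero    m M (r , _)          (suc zero)    = r
    pdRank zero    m M _                (suc (suc i)) = 0
    pdRank (suc k) m M (r , d , _ , pd) (suc i)       = pdRank k r (Ker d) pd i

    pdMat : ∀ k m M pd i → Mat (pdRank k m M pd i) (pdRank k m M pd (suc i))
    pdMat zero    m M (r , d , _)      zero          = d
    pdMat zero    m M (r , d , _)      (suc zero)    = λ _ ()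
    pdMat zero    m M (r , d , _)      (suc (suc i)) = λ ()
    pdMat (suc k) m M (r , d , _ , pd) zero          = d
    pdMat (suc k) m M (r , d , _ , pd) (suc i)       = pdMat k r (Ker d) pd i

    pdImage₀ : ∀ k m M pd → ImageIs (pdMat k m M pd 0) M
    pdImage₀ zero    m M (r , d , im , _) = im
    pdImage₀ (suc k) m M (r , d , im , _) = im

    pdImage : ∀ k m M pd i → ImageIs (pdMat k m M pd (suc i)) (Ker (pdMat k m M pd i))
    pdImage zero    m M (r , d , _ , lift inj) zero =
      (λ u → lift (P.·-𝟘 (matrixOp d) (λ _ _ → ≈-refl))) , (λ v (lift e) → (λ ()) , λ i f → ≈-sym (inj v e i f))
    pdImage zero    m M (r , d , _)      (suc zero)    = (λ u → lift (λ i f → ≈-refl)) , (λ v _ → (λ ()) , λ ())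
    pdImage zero    m M (r , d , _)      (suc (suc i)) = (λ u → lift (λ ())) , (λ v _ → (λ ()) , λ ())
    pdImage (suc k) m M (r , d , _ , pd) zero          = pdImage₀ k r (Ker d) pd
    pdImage (suc k) m M (r , d , _ , pd) (suc i)       = pdImage k r (Ker d) pd i

    pdRank-empty : ∀ k m M pd i → suc k ℕ.< i → ¬ Fin (pdRank k m M pd i)
    pdRank-empty zero    m M pd               (suc (suc i)) _        ()
    pdRank-empty zero    m M pd               (suc zero)    (s≤s ()) _
    pdRank-empty (suc k) m M (r , d , _ , pd) (suc i)       (s≤s lt) j = pdRank-empty k r (Ker d) pd i lt j

    pdSeq : ∀ k m M → PdLe k m M → ExactSeq
    pdSeq k m M pd = record
      { rank    = pdRank k m M pd
      ; d       = λ i → matrixOp (pdMat k m M pd i)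
      ; complex = λ i w → lower (proj₁ (pdImage k m M pd i) w)
      ; exact   = λ i v e → proj₂ (pdImage k m M pd i) v (lift e) }

  -- The multigraded part of the comparison homotopy

  module Extraction {L : ℕ} {U : Exp → Set} (U? : ∀ α → Dec (U α)) (F : LRes L U)
                    (all-act : ∀ b → LRes.act F b ≡ true) where
    open LRes F
    private
      rk : ℕ → ℕ
      rk = rank U? F
      str : ∀ i → Elt (rk i) → Exp → Vect Gen
      str = strand U? F
      D : ∀ i → Mat (rk i) (rk (suc i))
      D = d U? F
      g : ∀ i → Fin (rk i) → Gen
      g = gen U? F
      e[_] : ∀ {r} → Fin r → Elt r
      e[_] {r} j = P.δ (finIndex r) j

    realSeq : ExactSeq
    realSeq = record
      { rank    = rk
      ; d       = λ i → matrixOp (D i)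
      ; complex = d-complex U? F
      ; exact   = λ i v e → lift-σ U? F (suc i) v , d-exact U? F i v e }

    strand-unit : ∀ i j → str i e[ j ] (lab (g i j)) ≋ δ idx (g i j)
    strand-unit i j b = ≈-trans
      (∑-enum (finIndex (rk i)) (λ k → coef U? F i e[ j ] (lab (g i j)) k * δ idx (g i k) b) j
        (λ k k≢j → ≈-trans (*-congʳ (⟨⟩-respects {e[ j ] k} {0ₚ} (P.δ-diff (finIndex (rk i)) (λ e → k≢j (≡.sym e))) _)) (zeroˡ _)))
      (≈-trans (*-congʳ (≈-trans (⟨⟩-respects {e[ j ] j} {1ₚ} (P.δ-same (finIndex (rk i)) j) _)
        (≈-trans (+-identityʳ _) (≈-trans (*-identityˡ _) (bool-yes ((0ₑ ⊕ lab (g i j)) ≟ₑ lab (g i j)) (⊕-identityˡ _))))))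
        (*-identityˡ _))

    module _ (H : ∀ i → P.Op (Fin (rk i)) (Fin (rk (suc i)))) where

      position : ∀ c → Σ (Fin (rk (deg c))) (λ j → g (deg c) j ≡ c)
      position c = gen-surjective U? F (deg c) c (all-act c , refl)

      -- The part of the S-linear map H that preserves the multidegree.
      column : Gen → Vect Gen
      column c = str (suc (deg c)) (H (deg c) P.· e[ proj₁ (position c) ]) (lab c)

      h : Op Gen Gen
      h = columns idx column

      column-gen : ∀ i j → column (g i j) ≋ str (suc i) (H i P.· e[ j ]) (lab (g i j))
      column-gen i j = at-degree (g i j) i (proj₂ (gen-inDegree U? F i j)) j refl
        where
        at-degree : ∀ c i → deg c ≡ i → ∀ j → g i j ≡ c → column c ≋ str (suc i) (H i P.· e[ j ]) (lab c)
        at-degree c .(deg c) refl j e b = reflexive (cong (λ j → str (suc (deg c)) (H (deg c) P.· e[ j ]) (lab c) b)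
          (gen-injective U? F (deg c) (≡.trans (proj₂ (position c)) (≡.sym e))))

      h-local : Local (Raise _≼_) h
      h-local = Local-columns idx (λ b c → (deg b ℕ.≟ suc (deg c)) ×-dec (b ≼? c)) zero-off
        where
        zero-off : ∀ b c → ¬ Raise _≼_ b c → column c b ≈ 0#
        zero-off b c ¬q with deg b ℕ.≟ suc (deg c)
        ... | no ¬d = strand-off U? F (suc (deg c)) (H (deg c) P.· e[ proj₁ (position c) ]) (lab c) b (λ p → ¬d (proj₂ p))
        ... | yes d = strand-Supp U? F (suc (deg c)) (H (deg c) P.· e[ proj₁ (position c) ]) (lab c) b (λ b⊑ → ¬q (d , λ _ → b⊑))

      expand-degree : ∀ i v → (∀ b → ¬ InDegree U? F i b → v b ≈ 0#) →
                      v ≋ λ b → ∑ (allFin (rk i)) (λ k → v (g i k) * δ idx (g i k) b)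
      expand-degree i v off b with inDegree? U? F i b
      ... | no ¬p = ≈-trans (off b ¬p) (≈-sym (∑-zero (allFin (rk i)) (λ k → ≈-trans (*-congˡ (δ-diff idx
                      (λ e → ¬p (subst (InDegree U? F i) e (gen-inDegree U? F i k))))) (zeroʳ _))))
      ... | yes p with gen-surjective U? F i b p
      ...   | j , refl = ≈-sym (≈-trans (∑-enum (finIndex (rk i)) (λ k → v (g i k) * δ idx (g i k) (g i j)) j
                (λ k k≢j → ≈-trans (*-congˡ (δ-diff idx (λ e → k≢j (gen-injective U? F i e)))) (zeroʳ _)))
                (≈-trans (*-congˡ (δ-same idx (g i j))) (*-identityʳ _)))

      ⟨⟩-∑ : ∀ {A : Set} (xs : List A) (p : A → Pol) φ → ⟨ P.∑ xs p , φ ⟩ ≈ ∑ xs (λ x → ⟨ p x , φ ⟩)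
      ⟨⟩-∑ []       p φ = ≈-refl
      ⟨⟩-∑ (x ∷ xs) p φ = ≈-trans (⟨⟩-+ (p x) _ φ) (+-congˡ (⟨⟩-∑ xs p φ))

      -- Since `D i` is homogeneous, taking the multigraded part of H after `D i` gives `h` after
      -- `∂`: the monomial in an entry of `D i` shifts the multidegree `lab (g i k)` to that of the
      -- source. For the opposite composite, `strand-d` suffices.
      strand-H : ∀ i j → str (suc i) (H i P.· apply (D i) e[ j ]) (lab (g (suc i) j)) ≋ h · ∂ · δ idx (g (suc i) j)
      strand-H i j b = begin
        ∑ (allFin (rk (suc i))) (λ l → ⟨ (H i P.· apply (D i) e[ j ]) l , ψ l ⟩ * δ idx (g (suc i) l) b)
          ≈⟨ ∑-cong (allFin (rk (suc i))) (λ l → ≈-trans (*-congʳ (coefficient l)) (≈-sym (∑-*ʳ (allFin (rk i)) _ _))) ⟩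
        ∑ (allFin (rk (suc i))) (λ l → ∑ (allFin (rk i)) (λ k → (entry U? F i k j * coef U? F (suc i) (y k) (lab (g i k)) l) * δ idx (g (suc i) l) b))
          ≈⟨ ∑-swap (allFin (rk (suc i))) (allFin (rk i)) _ ⟩
        ∑ (allFin (rk i)) (λ k → ∑ (allFin (rk (suc i))) (λ l → (entry U? F i k j * coef U? F (suc i) (y k) (lab (g i k)) l) * δ idx (g (suc i) l) b))
          ≈⟨ ∑-cong (allFin (rk i)) (λ k → ≈-trans (∑-cong (allFin (rk (suc i))) (λ l → *-assoc _ _ _)) (∑-*ˡ (allFin (rk (suc i))) _ _)) ⟩
        ∑ (allFin (rk i)) (λ k → entry U? F i k j * str (suc i) (y k) (lab (g i k)) b)
          ≈⟨ ∑-cong (allFin (rk i)) (λ k → *-congˡ (≈-sym (≈-trans (columns-δ idx column (g i k) b) (column-gen i k b)))) ⟩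
        ∑ (allFin (rk i)) (λ k → entry U? F i k j * (h · δ idx (g i k)) b)
          ≈⟨ ≈-sym (·-∑* h (allFin (rk i)) (λ k → entry U? F i k j) (λ k → δ idx (g i k)) b) ⟩
        (h · (λ b → ∑ (allFin (rk i)) (λ k → entry U? F i k j * δ idx (g i k) b))) b
          ≈⟨ ≈-sym (·-cong h (expand-degree i (∂ · δ idx c′) ∂δ-off) b) ⟩
        (h · ∂ · δ idx c′) b ∎
        where
        c′ = g (suc i) j
        y : Fin (rk i) → Elt (rk (suc i))
        y k = H i P.· e[ k ]
        ψ : Fin (rk (suc i)) → Exp → Carrier
        ψ l f = bool ((f ⊕ lab (g (suc i) l)) ≟ₑ lab c′)
        ∂δ-off : ∀ b → ¬ InDegree U? F i b → (∂ · δ idx c′) b ≈ 0#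
        ∂δ-off b ¬b = ∂-local _ b (λ c (dc , le) → δ-diff idx (λ { refl → ¬b (all-act b ,
          ℕₚ.suc-injective (≡.trans (≡.sym dc) (proj₂ (gen-inDegree U? F (suc i) j)))) }))
        term : ∀ l k → ⟨ D i k j *ₚ y k l , ψ l ⟩ ≈ entry U? F i k j * coef U? F (suc i) (y k) (lab (g i k)) l
        term l k = ≈-trans (⟨⟩-*ₚ (D i k j) (y k l) (ψ l)) (≈-trans (+-identityʳ _) (compare (lab (g i k) ≤ₑ? lab c′)))
          where
          shift : ∀ f → lab (g i k) ≤ₑ lab c′ →
                  bool ((((lab c′ ⊖ lab (g i k)) ⊕ f) ⊕ lab (g (suc i) l)) ≟ₑ lab c′) ≈ bool ((f ⊕ lab (g (suc i) l)) ≟ₑ lab (g i k))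
          shift f le = bool-⇔ ((((lab c′ ⊖ lab (g i k)) ⊕ f) ⊕ lab (g (suc i) l)) ≟ₑ lab c′) ((f ⊕ lab (g (suc i) l)) ≟ₑ lab (g i k))
            (λ e → ⊕-cancelʳ β (≡.trans (⊕-comm _ β) (≡.trans (≡.sym (⊕-assoc β f _)) (≡.trans e
              (≡.trans (≡.sym (⊖-⊕ le)) (⊕-comm β _))))))
            (λ e → ≡.trans (⊕-assoc β f _) (≡.trans (cong (β ⊕_) e) (⊖-⊕ le)))
            where β = lab c′ ⊖ lab (g i k)
          compare : Dec (lab (g i k) ≤ₑ lab c′) →
            entry U? F i k j * ⟨ y k l , (λ f → ψ l ((lab c′ ⊖ lab (g i k)) ⊕ f)) ⟩ ≈ entry U? F i k j * coef U? F (suc i) (y k) (lab (g i k)) l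
          compare (yes le) = *-congˡ (⟨⟩-cong (y k l) (λ f → shift f le))
          compare (no ¬le) = ≈-trans (≈-trans (*-congʳ z) (zeroˡ _)) (≈-sym (≈-trans (*-congʳ z) (zeroˡ _)))
            where z = entry-zero U? F i k j ¬le
        coefficient : ∀ l → ⟨ (H i P.· apply (D i) e[ j ]) l , ψ l ⟩
                          ≈ ∑ (allFin (rk i)) (λ k → entry U? F i k j * coef U? F (suc i) (y k) (lab (g i k)) l)
        coefficient l = begin
          ⟨ (H i P.· apply (D i) e[ j ]) l , ψ l ⟩
            ≈⟨ ⟨⟩-respects {(H i P.· apply (D i) e[ j ]) l} {P.∑ (allFin (rk i)) (λ k → apply (D i) e[ j ] k *ₚ y k l)}
                 (P.expand (finIndex (rk i)) (H i) (apply (D i) e[ j ]) l) (ψ l) ⟩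
          ⟨ P.∑ (allFin (rk i)) (λ k → apply (D i) e[ j ] k *ₚ y k l) , ψ l ⟩
            ≈⟨ ⟨⟩-∑ (allFin (rk i)) _ (ψ l) ⟩
          ∑ (allFin (rk i)) (λ k → ⟨ apply (D i) e[ j ] k *ₚ y k l , ψ l ⟩)
            ≈⟨ ∑-cong (allFin (rk i)) (λ k → ≈-trans (⟨⟩-respects {apply (D i) e[ j ] k *ₚ y k l} {D i k j *ₚ y k l}
                 (*ₚ-cong {apply (D i) e[ j ] k} {y k l} {D i k j} {y k l} (apply-δ (D i) j k) (λ _ → ≈-refl)) (ψ l)) (term l k)) ⟩
          ∑ (allFin (rk i)) (λ k → entry U? F i k j * coef U? F (suc i) (y k) (lab (g i k)) l) ∎

      -- The S-linear homotopy identity at a basis vector, read in the multidegree of the label of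
      -- that vector.
      h-htpy-δ : ∀ i → (∀ x → (λ l → apply (D (suc i)) (H (suc i) P.· x) l +ₚ (H i P.· apply (D i) x) l) ≈ᵥ x) →
                 ∀ c → deg c ≡ suc i → ∂ · h · δ idx c ⊹ h · ∂ · δ idx c ≋ δ idx c
      h-htpy-δ i htpy c dc b with gen-surjective U? F (suc i) c (all-act c , dc)
      ... | j , refl = begin
        (∂ · h · δ idx c′) b + (h · ∂ · δ idx c′) b
          ≈⟨ +-cong (·-cong ∂ (λ b → ≈-trans (columns-δ idx column c′ b) (column-gen (suc i) j b)) b) (≈-sym (strand-H i j b)) ⟩
        (∂ · str (suc (suc i)) (H (suc i) P.· e[ j ]) (lab c′)) b + str (suc i) (H i P.· apply (D i) e[ j ]) (lab c′) b
          ≈⟨ +-congʳ (≈-sym (strand-d U? F (suc i) (H (suc i) P.· e[ j ]) (lab c′) b)) ⟩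
        str (suc i) (apply (D (suc i)) (H (suc i) P.· e[ j ])) (lab c′) b + str (suc i) (H i P.· apply (D i) e[ j ]) (lab c′) b
          ≈⟨ ≈-sym (strand-+ U? F (suc i) (apply (D (suc i)) (H (suc i) P.· e[ j ])) (H i P.· apply (D i) e[ j ]) (lab c′) b) ⟩
        str (suc i) (λ l → apply (D (suc i)) (H (suc i) P.· e[ j ]) l +ₚ (H i P.· apply (D i) e[ j ]) l) (lab c′) b
          ≈⟨ strand-cong U? F (suc i) {λ l → apply (D (suc i)) (H (suc i) P.· e[ j ]) l +ₚ (H i P.· apply (D i) e[ j ]) l} {e[ j ]} (htpy e[ j ]) (lab c′) b ⟩
        str (suc i) e[ j ] (lab c′) b
          ≈⟨ strand-unit (suc i) j b ⟩
        δ idx c′ b ∎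
        where c′ = g (suc i) j

    module _ (k : ℕ) (pd : PdLe (suc k) 1 (Supported U)) where
      open PdSequence

      givenSeq : ExactSeq
      givenSeq = pdSeq (suc k) 1 (Supported U) pd

      -- Both sequences begin with S and have the same image there, so the comparison starts from
      -- identities and the zero homotopy.
      firstStage : Stage realSeq givenSeq 0
      firstStage = record
        { f = P.idₒ ; g = P.idₒ ; h = P.𝟘ₒ
        ; f-lift = λ x → proj₂ (pdImage₀ (suc k) 1 (Supported U) pd) (apply (D 0) x) (proj₁ (augmentation-image U? F) x)
        ; g-lift = λ y → proj₂ (augmentation-image U? F) (apply (pdMat (suc k) 1 (Supported U) pd 0) y)
                           (proj₁ (pdImage₀ (suc k) 1 (Supported U) pd) y)
        ; h-htpy = λ x i f → ≈-trans (coeff-+ (apply (D 0) 0ᵥ i) (apply (D 0) x i) f)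
            (≈-trans (+-congʳ (P.·-𝟘 (matrixOp (D 0)) {0ᵥ} (λ _ _ → ≈-refl) i f)) (+-identityˡ _)) }

      H : ∀ i → P.Op (Fin (rk i)) (Fin (rk (suc i)))
      H = contraction realSeq givenSeq firstStage

      H-htpy : ∀ i → suc (suc k) ℕ.< suc i → ∀ x →
               (λ l → apply (D (suc i)) (H (suc i) P.· x) l +ₚ (H i P.· apply (D i) x) l) ≈ᵥ x
      H-htpy i lt = contraction-htpy realSeq givenSeq firstStage i (pdRank-empty (suc k) 1 (Supported U) pd (suc i) lt)

      h-htpy : ∀ {d v} → suc (suc k) ℕ.< d → Truncate.Hom F k d v → ∂ · h H · v ⊹ h H · ∂ · v ≋ v
      h-htpy {suc i} {v} lt hv = agree idx (∂ ∘ₒ h H +ₒ h H ∘ₒ ∂) idₒ v pick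
        where
        pick : ∀ c → (v c ≈ 0#) ⊎ (∂ · h H · δ idx c ⊹ h H · ∂ · δ idx c ≋ δ idx c)
        pick c with deg c ℕ.≟ suc i
        ... | no ¬d = inj₁ (hv c ¬d)
        ... | yes d = inj₂ (h-htpy-δ H i (H-htpy i lt) c d)

      -- `givenSeq` has rank zero above index `suc (suc k)`, and this is the degree above which
      -- `h H` contracts.
      multigraded : LRes (suc (suc k)) U
      multigraded = Truncate.truncated F k (h H) (h-local H) h-htpy

-- Monomial ideals

open import Data.Nat using (_+_)

module MonomialIdeals {c ℓ : Level} (K : Field c ℓ) (n : ℕ) where
  open Poly K n
  open Field K hiding (zero) renaming (_+_ to _+ᴷ_; refl to ≈-refl; sym to ≈-sym; trans to ≈-trans)
  open import Relation.Binary.Reasoning.Setoid setoid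
  open LinearAlgebra commutativeRing
  open IntegerSolver commutativeRing
  open Exponents n
  open Complexes commutativeRing n hiding (Exp)
  open PolynomialRing K n
  open Realization K n
  open Multigrading K n
  private module P = LinearAlgebra polynomialRing

  mono : Exp → Pol
  mono α = (1# , α) ∷ []

  ⟨⟩-mono : ∀ α φ → ⟨ mono α , φ ⟩ ≈ φ α
  ⟨⟩-mono α φ = ≈-trans (+-identityʳ _) (*-identityˡ _)

  ⟨⟩-mono* : ∀ α p φ → ⟨ mono α *ₚ p , φ ⟩ ≈ ⟨ p , (λ g → φ (α ⊕ g)) ⟩
  ⟨⟩-mono* α p φ = ≈-trans (⟨⟩-*ₚ (mono α) p φ) (⟨⟩-mono α (λ f → ⟨ p , (λ g → φ (f ⊕ g)) ⟩))

  mono-Supported : ∀ {U α} → U α → Supported U (λ _ → mono α)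
  mono-Supported {U} {α} u = lift (λ β ¬u → ≈-trans (coeff-⟨⟩ (mono α) β)
    (≈-trans (⟨⟩-mono α (λ f → bool (f ≟ₑ β))) (bool-no (α ≟ₑ β) (λ { refl → ¬u u }))))

  module _ {U : Exp → Set} (U? : ∀ α → Dec (U α)) where

    restrict : Pol → Pol
    restrict = map (λ (a , f) → a * bool (U? f) , f)

    ⟨⟩-restrict : ∀ p φ → ⟨ restrict p , φ ⟩ ≈ ⟨ p , (λ f → bool (U? f) * φ f) ⟩
    ⟨⟩-restrict p φ = ≈-trans (reflexive (∑-map _ p _)) (∑-cong p (λ (a , f) → *-assoc a _ _))

    ⟨⟩-mask : ∀ p α → ⟨ p , (λ f → bool (U? f) * bool (f ≟ₑ α)) ⟩ ≈ bool (U? α) * coeff p α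
    ⟨⟩-mask p α = ≈-trans (⟨⟩-cong p (λ f → move f (f ≟ₑ α))) (≈-trans (⟨⟩-* p _ _) (*-congˡ (≈-sym (coeff-⟨⟩ p α))))
      where
      move : ∀ f (eq : Dec (f ≡ α)) → bool (U? f) * bool eq ≈ bool (U? α) * bool eq
      move f (yes refl) = ≈-refl
      move f (no _)     = ≈-trans (zeroʳ _) (≈-sym (zeroʳ _))

    mask-supported : ∀ p α → (¬ U α → coeff p α ≈ 0#) → bool (U? α) * coeff p α ≈ coeff p α
    mask-supported p α out with U? α
    ... | yes _ = *-identityˡ _
    ... | no ¬u = ≈-trans (zeroˡ _) (≈-sym (out ¬u))

    coeff-restrict : ∀ p α → coeff (restrict p) α ≈ bool (U? α) * coeff p α
    coeff-restrict p α = ≈-trans (coeff-⟨⟩ (restrict p) α) (≈-trans (⟨⟩-restrict p _) (⟨⟩-mask p α))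

    restrict-supported : ∀ p → (∀ α → ¬ U α → coeff p α ≈ 0#) → p ≈ₚ restrict p
    restrict-supported p out α = ≈-sym (≈-trans (coeff-restrict p α) (mask-supported p α (out α)))

  ≤ₑ-antisym : ∀ {α β} → α ≤ₑ β → β ≤ₑ α → α ≡ β
  ≤ₑ-antisym p q = lookup-ext (λ i → ℕₚ.≤-antisym (at p i) (at q i))

  minimal : ∀ A As → Σ Exp (λ M → M ∈ A ∷ As × (∀ {C} → C ∈ A ∷ As → C ≤ₑ M → M ≤ₑ C))
  minimal A [] = A , here refl , λ { (here refl) p → p }
  minimal A (B ∷ As) with minimal B As
  ... | M , M∈ , min with A ≤ₑ? M
  ...   | yes A≤M = A , here refl , λ { (here refl) p → p ; (there C∈) p → ≤ₑ-trans A≤M (min C∈ (≤ₑ-trans p A≤M)) }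
  ...   | no  A≰M = M , there M∈ , λ { (here refl) p → ⊥-elim (A≰M p) ; (there C∈) p → min C∈ p }

  -- If the ideal is free and generated by at least two monomials, the relation x^B u = x^M v between
  -- preimages u, v of x^M, x^B forces the constant terms of u to vanish, but then x^M = d u does not
  -- contain the minimal monomial x^M.
  module Principal (As : List Exp) {r : ℕ} (d : Mat 1 r) (im : ImageIs d (Supported (Cover As)))
                   (inj : ∀ u → apply d u ≈ᵥ 0ᵥ → u ≈ᵥ 0ᵥ)
                   {M : Exp} (M∈ : M ∈ As) (min : ∀ {C} → C ∈ As → C ≤ₑ M → M ≤ₑ C) where

    preimage-of : ∀ {C} → C ∈ As → Σ (Elt r) (λ u → apply d u ≈ᵥ (λ _ → mono C))
    preimage-of {C} C∈ = proj₂ im (λ _ → mono C) (mono-Supported (lose C∈ ≤ₑ-refl))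

    -- An entry of `d` is the image of a basis vector and so lies in the ideal; test functions may
    -- be cut off outside it.
    entry-supported : ∀ j ξ → ⟨ d zero j , ξ ⟩ ≈ ⟨ d zero j , (λ f → bool (cover? As f) * ξ f) ⟩
    entry-supported j ξ = ≈-trans (⟨⟩-respects {d zero j} {restrict (cover? As) (d zero j)}
        (restrict-supported (cover? As) (d zero j) (λ α ¬u →
          ≈-trans (≈-sym (apply-δ d j zero α)) (lower (proj₁ im (P.δ (finIndex r) j)) α ¬u))) ξ)
      (⟨⟩-restrict (cover? As) (d zero j) ξ)

    divides-all : ∀ {B} → B ∈ As → M ≤ₑ B
    divides-all {B} B∈ with M ≤ₑ? B
    ... | yes le = le
    ... | no ¬le = ⊥-elim (1≉0 contradiction)
      where
      u v : Elt r
      u = proj₁ (preimage-of M∈)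
      v = proj₁ (preimage-of B∈)
      w : Elt r
      w j = (mono B *ₚ u j) +ₚ (-ₚ (mono M *ₚ v j))

      image : ∀ {C} (x : Elt r) (e : apply d x ≈ᵥ (λ _ → mono C)) A φ →
              ⟨ apply d (λ j → mono A *ₚ x j) zero , φ ⟩ ≈ φ (A ⊕ C)
      image {C} x e A φ = begin
        ⟨ apply d (λ j → mono A *ₚ x j) zero , φ ⟩
          ≈⟨ ⟨⟩-respects {apply d (λ j → mono A *ₚ x j) zero} {mono A *ₚ apply d x zero} (P.·-* (matrixOp d) (mono A) x zero) φ ⟩
        ⟨ mono A *ₚ apply d x zero , φ ⟩
          ≈⟨ ⟨⟩-mono* A (apply d x zero) φ ⟩
        ⟨ apply d x zero , (λ g → φ (A ⊕ g)) ⟩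
          ≈⟨ ⟨⟩-respects {apply d x zero} {mono C} (e zero) _ ⟩
        ⟨ mono C , (λ g → φ (A ⊕ g)) ⟩
          ≈⟨ ⟨⟩-mono C (λ g → φ (A ⊕ g)) ⟩
        φ (A ⊕ C) ∎

      w-cycle : apply d w ≈ᵥ 0ᵥ
      w-cycle zero = ⟨⟩-ext (apply d w zero) 0ₚ (λ φ → begin
        ⟨ apply d w zero , φ ⟩
          ≈⟨ ⟨⟩-respects {apply d w zero} {apply d x zero +ₚ apply d (λ j → -ₚ y j) zero} (P.·-+ (matrixOp d) x (λ j → -ₚ y j) zero) φ ⟩
        ⟨ apply d x zero +ₚ apply d (λ j → -ₚ y j) zero , φ ⟩
          ≈⟨ ⟨⟩-+ (apply d x zero) (apply d (λ j → -ₚ y j) zero) φ ⟩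
        ⟨ apply d x zero , φ ⟩ +ᴷ ⟨ apply d (λ j → -ₚ y j) zero , φ ⟩
          ≈⟨ +-congˡ (≈-trans (⟨⟩-respects {apply d (λ j → -ₚ y j) zero} { -ₚ apply d y zero} (P.·-⊟ (matrixOp d) y zero) φ)
               (⟨⟩-neg (apply d y zero) φ)) ⟩
        ⟨ apply d x zero , φ ⟩ +ᴷ - ⟨ apply d y zero , φ ⟩
          ≈⟨ +-cong (image u (proj₂ (preimage-of M∈)) B φ) (-‿cong (image v (proj₂ (preimage-of B∈)) M φ)) ⟩
        φ (B ⊕ M) +ᴷ - φ (M ⊕ B)
          ≈⟨ +-congˡ (-‿cong (reflexive (cong φ (⊕-comm M B)))) ⟩
        φ (B ⊕ M) +ᴷ - φ (B ⊕ M)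
          ≈⟨ -‿inverseʳ _ ⟩
        0# ∎)
        where
        x y : Elt r
        x j = mono B *ₚ u j
        y j = mono M *ₚ v j

      relation : ∀ j φ → ⟨ u j , (λ g → φ (B ⊕ g)) ⟩ ≈ ⟨ v j , (λ g → φ (M ⊕ g)) ⟩
      relation j φ = begin
        X                    ≈⟨ solve 2 (λ a b → a := (a :+ :- b) :+ b) ≈-refl X Y ⟩
        (X +ᴷ - Y) +ᴷ Y      ≈⟨ +-congʳ (≈-sym (≈-trans (⟨⟩-+ (mono B *ₚ u j) (-ₚ (mono M *ₚ v j)) φ) (+-cong (⟨⟩-mono* B (u j) φ)
                                  (≈-trans (⟨⟩-neg (mono M *ₚ v j) φ) (-‿cong (⟨⟩-mono* M (v j) φ)))))) ⟩
        ⟨ w j , φ ⟩ +ᴷ Y     ≈⟨ +-congʳ (⟨⟩-respects {w j} {0ₚ} (inj w w-cycle j) φ) ⟩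
        0# +ᴷ Y              ≈⟨ +-identityˡ Y ⟩
        Y                    ∎
        where
        X = ⟨ u j , (λ g → φ (B ⊕ g)) ⟩
        Y = ⟨ v j , (λ g → φ (M ⊕ g)) ⟩

      -- Test the relation on x^B: on the left only the constant term of `u j` contributes, on the
      -- right nothing does, since x^M does not divide x^B.
      constant-term : ∀ j → ⟨ u j , (λ g → bool ((B ⊕ g) ≟ₑ B)) ⟩ ≈ 0#
      constant-term j = ≈-trans (relation j (λ f → bool (f ≟ₑ B))) (⟨⟩-zero (v j) (λ g →
        bool-no ((M ⊕ g) ≟ₑ B) (λ e → ¬le (subst (M ≤ₑ_) (≡.trans (⊕-comm g M) e) (≤ₑ-⊕ʳ g M)))))

      ⊕-fix : ∀ {α g} → α ⊕ g ≡ α → ∀ β → β ⊕ g ≡ β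
      ⊕-fix {α} {g} e β = ≡.trans (cong (β ⊕_) (⊕-cancelʳ {g} {0ₑ} α
        (≡.trans (⊕-comm g α) (≡.trans e (≡.sym (⊕-identityˡ α)))))) (⊕-identityʳ β)

      -- If f ⊕ g = M with x^f in the ideal, then f = M by minimality and g = 0, so only the
      -- constant term of `u j` could contribute.
      inner : ∀ j f → (u? : Dec (Cover As f)) → bool u? * ⟨ u j , (λ g → bool ((f ⊕ g) ≟ₑ M)) ⟩ ≈ 0#
      inner j f (no _)  = zeroˡ _
      inner j f (yes p) = ≈-trans (*-identityˡ _) (by-cases (f ≟ₑ M))
        where
        by-cases : Dec (f ≡ M) → ⟨ u j , (λ g → bool ((f ⊕ g) ≟ₑ M)) ⟩ ≈ 0#
        by-cases (yes refl) = ≈-trans (⟨⟩-cong (u j) (λ g →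
          bool-⇔ ((M ⊕ g) ≟ₑ M) ((B ⊕ g) ≟ₑ B) (λ e → ⊕-fix e B) (λ e → ⊕-fix e M))) (constant-term j)
        by-cases (no f≢M) = ⟨⟩-zero (u j) (λ g → bool-no ((f ⊕ g) ≟ₑ M) (λ e → too-small g e (find p)))
          where
          too-small : ∀ g → f ⊕ g ≡ M → Σ Exp (λ C → C ∈ As × C ≤ₑ f) → ⊥
          too-small g e (C , C∈ , C≤f) = f≢M (≤ₑ-antisym f≤M (≤ₑ-trans (min C∈ (≤ₑ-trans C≤f f≤M)) C≤f))
            where
            f≤M : f ≤ₑ M
            f≤M = subst (f ≤ₑ_) (≡.trans (⊕-comm g f) e) (≤ₑ-⊕ʳ g f)

      contradiction : 1# ≈ 0#
      contradiction = begin
        1#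
          ≈⟨ ≈-sym (≈-trans (⟨⟩-mono M χ) (bool-yes (M ≟ₑ M) refl)) ⟩
        ⟨ mono M , χ ⟩
          ≈⟨ ≈-sym (⟨⟩-respects {apply d u zero} {mono M} (proj₂ (preimage-of M∈) zero) χ) ⟩
        ⟨ apply d u zero , χ ⟩
          ≈⟨ ⟨⟩-apply d u zero χ ⟩
        ∑ (allFin r) (λ j → ⟨ d zero j , (λ f → ⟨ u j , (λ g → χ (f ⊕ g)) ⟩) ⟩)
          ≈⟨ ∑-zero (allFin r) (λ j → ≈-trans (entry-supported j _) (⟨⟩-zero (d zero j) (λ f → inner j f (cover? As f)))) ⟩
        0# ∎
        where
        χ : Exp → Carrier
        χ f = bool (f ≟ₑ M)

  multigraded-zero : ∀ As → PdLe 0 1 (Supported (Cover As)) → LRes 1 (Cover As)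
  multigraded-zero []       _ = LRes-⇔ z≤n (λ ()) (λ ()) unit
  multigraded-zero (A ∷ As) (r , d , im , lift inj) with minimal A As
  ... | M , M∈ , min = LRes-⇔ ℕₚ.≤-refl (λ p → lose M∈ p)
          (λ p → let (B , B∈ , B≤) = find p in ≤ₑ-trans (divides-all B∈) B≤) (principal M)
    where open Principal (A ∷ As) d im inj M∈ min

  multigraded-resolution : ∀ a As → PdLe a 1 (Supported (Cover As)) → LRes (suc a) (Cover As)
  multigraded-resolution zero    As pd = multigraded-zero As pd
  multigraded-resolution (suc k) As pd = Extraction.multigraded (cover? As) (taylor As) (taylor-act As) k pd

  PdLe-⇔ : ∀ k {m} {M N : Sub m} → (∀ v → M v → N v) → (∀ v → N v → M v) → PdLe k m M → PdLe k m N
  PdLe-⇔ zero    f g (r , d , (i , o) , x) = r , d , ((λ u → f _ (i u)) , λ v p → o v (g v p)) , x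
  PdLe-⇔ (suc k) f g (r , d , (i , o) , x) = r , d , ((λ u → f _ (i u)) , λ v p → o v (g v p)) , x

  -- Stanley-Reisner ideals as monomial ideals

  expo : Subset n → Exp
  expo = Vec.map (λ b → if b then 1 else 0)

  subsets : ∀ m → List (Vec Bool m)
  subsets zero    = [] ∷ []
  subsets (suc m) = map (true ∷_) (subsets m) ++ map (false ∷_) (subsets m)

  ∈-subsets : ∀ {m} (A : Vec Bool m) → A ∈ subsets m
  ∈-subsets []                = here refl
  ∈-subsets {suc m} (true ∷ A)  = ∈-++⁺ˡ (∈-map⁺ (true ∷_) (∈-subsets A))
  ∈-subsets {suc m} (false ∷ A) = ∈-++⁺ʳ (map (true ∷_) (subsets m)) (∈-map⁺ (false ∷_) (∈-subsets A))

  module _ (X : SimplicialComplex n) where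

    nonfaces : List (Subset n)
    nonfaces = filter (λ A → face X A Boolₚ.≟ false) (subsets n)

    generators : List Exp
    generators = map expo nonfaces

    cover-nonface : ∀ {α} → Cover generators α → Σ (Subset n) (λ A → NonFace X A × expo A ≤ₑ α)
    cover-nonface p with find p
    ... | C , C∈ , C≤ with ∈-map⁻ expo C∈
    ...   | A , A∈ , refl = A , proj₂ (∈-filter⁻ (λ A → face X A Boolₚ.≟ false) {xs = subsets n} A∈) , C≤

    nonface-cover : ∀ {α} A → NonFace X A → expo A ≤ₑ α → Cover generators α
    nonface-cover A nf le = lose (∈-map⁺ expo (∈-filter⁺ (λ A → face X A Boolₚ.≟ false) (∈-subsets A) nf)) le

    Generator : Set c
    Generator = Pol × Σ (Subset n) (NonFace X)

    combination : List Generator → Pol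
    combination = foldr (λ (g , A , _) acc → (g *ₚ monomial A) +ₚ acc) 0ₚ

    ⟨⟩-combination : ∀ g A nf gs φ → ⟨ combination ((g , A , nf) ∷ gs) , φ ⟩ ≈ ⟨ g , (λ f → φ (f ⊕ expo A)) ⟩ +ᴷ ⟨ combination gs , φ ⟩
    ⟨⟩-combination g A nf gs φ = ≈-trans (⟨⟩-+ (g *ₚ monomial A) (combination gs) φ)
      (+-congʳ (≈-trans (⟨⟩-*ₚ g (monomial A) φ) (⟨⟩-cong g (λ f → ⟨⟩-mono (expo A) (λ h → φ (f ⊕ h))))))

    combination-supported : ∀ gs α → ¬ Cover generators α → ⟨ combination gs , (λ f → bool (f ≟ₑ α)) ⟩ ≈ 0#
    combination-supported []                  α ¬u = ≈-refl
    combination-supported ((g , A , nf) ∷ gs) α ¬u = ≈-trans (⟨⟩-combination g A nf gs _)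
      (≈-trans (+-cong (⟨⟩-zero g (λ f → bool-no ((f ⊕ expo A) ≟ₑ α)
          (λ e → ¬u (nonface-cover A nf (subst (expo A ≤ₑ_) e (≤ₑ-⊕ʳ f (expo A)))))))
        (combination-supported gs α ¬u)) (+-identityʳ 0#))

    -- A term with exponent in the ideal is a multiple of one generator. Terms outside may cancel
    -- only in total, so they are dropped one by one, and the mask on the right records this.
    decompose : ∀ p → Σ (List Generator) (λ gs → ∀ φ →
                ⟨ combination gs , φ ⟩ ≈ ⟨ p , (λ f → bool (cover? generators f) * φ f) ⟩)
    decompose []            = [] , λ φ → ≈-refl
    decompose ((a , f) ∷ p) with cover? generators f | decompose p
    ... | no _  | gs , eq = gs , λ φ → ≈-trans (eq φ) (≈-sym (≈-trans (+-congʳ (≈-trans (*-congˡ (zeroˡ _)) (zeroʳ a))) (+-identityˡ _)))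
    ... | yes u | gs , eq with cover-nonface u
    ...   | A , nf , le = (((a , f ⊖ expo A) ∷ []) , A , nf) ∷ gs , λ φ →
            ≈-trans (⟨⟩-combination ((a , f ⊖ expo A) ∷ []) A nf gs φ)
              (+-cong (≈-trans (+-identityʳ _) (*-congˡ (≈-trans (reflexive (cong φ (⊖-⊕ le))) (≈-sym (*-identityˡ _))))) (eq φ))

    I⇒Supported : ∀ v → I X v → Supported (Cover generators) v
    I⇒Supported v (gs , lift e) = lift (λ α ¬u → ≈-trans (e α) (≈-trans (coeff-⟨⟩ (combination gs) α)
      (combination-supported gs α ¬u)))

    Supported⇒I : ∀ v → Supported (Cover generators) v → I X v
    Supported⇒I v (lift out) with decompose (v zero)
    ... | gs , eq = gs , lift (λ α → ≈-sym (≈-trans (coeff-⟨⟩ (combination gs) α) (≈-trans (eq _)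
            (≈-trans (⟨⟩-mask (cover? generators) (v zero) α) (mask-supported (cover? generators) (v zero) α (out α))))))

  module _ (X Y : SimplicialComplex n) where
    private
      U V : Exp → Set
      U = Cover (generators X)
      V = Cover (generators Y)
      U? : ∀ α → Dec (U α)
      U? = cover? (generators X)
      V? : ∀ α → Dec (V α)
      V? = cover? (generators Y)

    ∩⇒Supported : ∀ v → (I X ∩ᵢ I Y) v → Supported (λ α → U α × V α) v
    ∩⇒Supported v (x , y) = lift (λ α ¬uv → outside α ¬uv (U? α))
      where
      -- A negated conjunction by itself gives neither negation; deciding `U` tells which of the two
      -- ideals makes the coefficient vanish.
      outside : ∀ α → ¬ (U α × V α) → Dec (U α) → coeff (v zero) α ≈ 0#
      outside α ¬uv (no ¬u) = lower (I⇒Supported X v x) α ¬u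
      outside α ¬uv (yes u) = lower (I⇒Supported Y v y) α (λ w → ¬uv (u , w))

    Supported⇒∩ : ∀ v → Supported (λ α → U α × V α) v → (I X ∩ᵢ I Y) v
    Supported⇒∩ v (lift out) =
      Supported⇒I X v (lift (λ α ¬u → out α (λ uv → ¬u (proj₁ uv)))) ,
      Supported⇒I Y v (lift (λ α ¬v → out α (λ uv → ¬v (proj₂ uv))))

    +⇒Supported : ∀ v → (I X +ᵢ I Y) v → Supported (λ α → U α ⊎ V α) v
    +⇒Supported v (g , h , x , y , lift e) = lift (λ α ¬uv → ≈-trans (e α) (≈-trans (coeff-+ g h α)
      (≈-trans (+-cong (lower (I⇒Supported X (λ _ → g) x) α (λ u → ¬uv (inj₁ u)))
                       (lower (I⇒Supported Y (λ _ → h) y) α (λ w → ¬uv (inj₂ w)))) (+-identityʳ 0#))))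

    -- Terms with exponent in `U` go to `I X`. Among the others, an exponent outside `V` has total
    -- coefficient zero, so they make up an element of `I Y`.
    Supported⇒+ : ∀ v → Supported (λ α → U α ⊎ V α) v → (I X +ᵢ I Y) v
    Supported⇒+ v (lift out) = g , h ,
      Supported⇒I X (λ _ → g) (lift (λ α ¬u → ≈-trans (coeff-restrict U? p α) (≈-trans (*-congʳ (bool-no (U? α) ¬u)) (zeroˡ _)))) ,
      Supported⇒I Y (λ _ → h) (lift (λ α ¬v → ≈-trans (coeff-restrict (λ f → ¬? (U? f)) p α) (rest α ¬v (U? α)))) ,
      lift (λ α → ≈-sym (≈-trans (coeff-+ g h α) (≈-trans (+-cong (coeff-restrict U? p α) (coeff-restrict (λ f → ¬? (U? f)) p α)) (split α (U? α)))))
      where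
      p = v zero
      g = restrict U? p
      h = restrict (λ f → ¬? (U? f)) p
      rest : ∀ α → ¬ V α → (u? : Dec (U α)) → bool (¬? u?) * coeff p α ≈ 0#
      rest α ¬v (yes _) = zeroˡ _
      rest α ¬v (no ¬u) = ≈-trans (*-identityˡ _) (out α (λ { (inj₁ u) → ¬u u ; (inj₂ w) → ¬v w }))
      split : ∀ α → (u? : Dec (U α)) → bool u? * coeff p α +ᴷ bool (¬? u?) * coeff p α ≈ coeff p α
      split α (yes _) = ≈-trans (+-cong (*-identityˡ _) (zeroˡ _)) (+-identityʳ _)
      split α (no _)  = ≈-trans (+-cong (zeroˡ _) (*-identityˡ _)) (+-identityˡ _)

    pd-∩-+ : ∀ a b → PdLe a 1 (I X) → PdLe b 1 (I Y) →
             PdLe (a + b) 1 (I X ∩ᵢ I Y) × PdLe (a + b + 1) 1 (I X +ᵢ I Y)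
    pd-∩-+ a b pX pY =
      PdLe-⇔ (a + b) Supported⇒∩ ∩⇒Supported (pd-Supported (λ α → U? α ×-dec V? α)
        -- The length `pred (suc a + suc b)` computes to `a + suc b`: of two copies of S only one
        -- remains.
        (LRes-⇔ (ℕₚ.≤-reflexive (ℕₚ.+-suc a b)) (λ p → p) (λ p → p) (Intersection.intersectionRes F G))) ,
      PdLe-⇔ (a + b + 1) Supported⇒+ +⇒Supported (pd-Supported (λ α → U? α ⊎-dec V? α)
        -- Here the full length `suc a + suc b` is kept, whence the additional 1 in the bound.
        (LRes-⇔ (ℕₚ.≤-reflexive (cong suc (≡.trans (ℕₚ.+-suc a b) (ℕₚ.+-comm 1 (a + b))))) (λ p → p) (λ p → p) (Sum.sumRes F G)))
      where
      F : LRes (suc a) U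
      F = multigraded-resolution a (generators X) (PdLe-⇔ a (I⇒Supported X) (Supported⇒I X) pX)
      G : LRes (suc b) V
      G = multigraded-resolution b (generators Y) (PdLe-⇔ b (I⇒Supported Y) (Supported⇒I Y) pY)

theorem1p5 : ∀ {c ℓ : Level} (K : Field c ℓ) (n : ℕ) (X Y : SimplicialComplex n)
    → let open Poly K n in
      ∀ (a b : ℕ) → PdLe a 1 (I X) → PdLe b 1 (I Y)
      → PdLe (a + b) 1 (I X ∩ᵢ I Y) × PdLe (a + b + 1) 1 (I X +ᵢ I Y)
theorem1p5 K n X Y = MonomialIdeals.pd-∩-+ K n X Y
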